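{- Let $P \in \mathbb{Z}[x]$ be a monic polynomial of degree $d$ with roots $\alpha_1,\dots,\alpha_d$, and let $n>1$ be an integer with $l$ distinct prime factors. Put $r = 2^{l-1}$. Then the integer $U(n) = U(P;n)$ is divisible by $n^{d^r}$.
   Context: Roots are listed with multiplicity. For a multiset $\mathcal{N}=\{n_1,\dots,n_r\}$ of positive integers (entries may repeat), define $P_{\mathcal{N}}(x) := \prod_{j_1,\dots,j_r=1}^{d}\big(x-\alpha_{j_1}^{n_1}\cdots\alpha_{j_r}^{n_r}\big)\in\mathbb{Z}[x]$, a monic polynomial of degree $d^r$. For $n>1$ let $\mathcal{D}_+(n)=\{m\mid n:\mu(n/m)=1\}$ and $\mathcal{D}_-(n)=\{m\mid n:\mu(n/m)=-1\}$, where $\mu$ is the Möbius function; if $n$ has $l$ distinct prime factors, each of these sets has $2^{l-1}$ elements. For monic polynomials $A,B$ the resultant is $\operatorname{Res}(A,B)=\prod_{A(a)=0,\,B(b)=0}(a-b)$ (roots with multiplicity). Define $U(n)=U(P;n):=\operatorname{Res}(P_{\mathcal{D}_+(n)},P_{\mathcal{D}_-(n)})\in\mathbb{Z}$. -}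

module Defs where

open import Level using (Level)
open import Algebra.Bundles using (CommutativeRing)
open import Data.Nat as ℕ using (ℕ; zero; suc; _∸_)
open import Data.Nat.Divisibility using (_∣_; _∣?_)
open import Data.Nat.Primality using (Prime; prime?)
open import Data.Integer as ℤ using (ℤ; +_; -[1+_])
open import Data.Fin using (Fin)
open import Data.Vec as Vec using (Vec; _∷_; []; _∷ʳ_)
open import Data.List as List using (List; upTo; filter; length; concatMap)
open import Data.Product using (_×_)
open import Relation.Nullary using (yes; no)
open import Relation.Nullary.Decidable using (_×-dec_)

-- Möbius function μ(n) for n ≥ 1, by trial division.
-- muAux fuel n j : tests the candidate divisor k = 2 + j of n.
-- Every divisor found this way is prime (smaller primes were already
-- removed). If k ∣ n and k² ∣ n the value is 0; if k ∣ n but k² ∤ n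
-- the value is - μ(n / k); otherwise move to the next candidate.
-- Fuel n is always enough for input n (value on fuel exhaustion is
-- irrelevant; it is never reached).

muAux : ℕ → ℕ → ℕ → ℤ
muAux zero    n j = + 0
muAux (suc f) 1 j = + 1
muAux (suc f) n j with (2 ℕ.+ j) ∣? n
... | no  _ = muAux f n (suc j)
... | yes _ with ((2 ℕ.+ j) ℕ.* (2 ℕ.+ j)) ∣? n
...   | yes _ = + 0
...   | no  _ = ℤ.- muAux f (n ℕ./ (2 ℕ.+ j)) (suc j)

μ : ℕ → ℤ
μ n = muAux n n 0

Dplus : ℕ → List ℕ
Dplus n = List.map suc
  (filter (λ i → (suc i ∣? n) ×-dec (μ (n ℕ./ suc i) ℤ.≟ + 1)) (upTo n))

Dminus : ℕ → List ℕ
Dminus n = List.map suc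
  (filter (λ i → (suc i ∣? n) ×-dec (μ (n ℕ./ suc i) ℤ.≟ ℤ.- (+ 1))) (upTo n))

numPrimeFactors : ℕ → ℕ
numPrimeFactors n = length (filter (λ p → prime? p ×-dec (p ∣? n)) (upTo (suc n)))

module _ {c ℓ : Level} (R : CommutativeRing c ℓ) where
  open CommutativeRing R

  natR : ℕ → Carrier
  natR zero    = 0#
  natR (suc k) = 1# + natR k

  ι : ℤ → Carrier
  ι (+ k)      = natR k
  ι -[1+ k ]   = - natR (suc k)

  pow : Carrier → ℕ → Carrier
  pow x zero    = 1#
  pow x (suc k) = x * pow x k

  -- multiply a coefficient vector (lowest degree first) by (X - a)
  mulLin : ∀ {k} → Carrier → Vec Carrier (suc k) → Vec Carrier (suc (suc k))
  mulLin a v = Vec.zipWith (λ x y → x + - y) (0# ∷ v) (Vec.map (a *_) v ∷ʳ 0#)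

  linProd : ∀ {d} → (Fin d → Carrier) → Vec Carrier (suc d)
  linProd {zero}  α = 1# ∷ []
  linProd {suc d} α = mulLin (α Fin.zero) (linProd (λ j → α (Fin.suc j)))
    where import Data.Fin as Fin

  -- coefficients (lowest first) of the monic polynomial
  -- X^d + p_{d-1} X^{d-1} + ... + p_0 , mapped into R
  monicCoeffs : ∀ {d} → Vec ℤ d → Vec Carrier (suc d)
  monicCoeffs p = Vec.map ι p ∷ʳ 1#

  -- the roots (with multiplicity) of P_N for N = {n₁,…,n_r}:
  -- all products α_{j₁}^{n₁} ⋯ α_{j_r}^{n_r}
  rootsP : ∀ {d} → (Fin d → Carrier) → List ℕ → List Carrier
  rootsP α List.[] = 1# List.∷ List.[]
  rootsP {d} α (n List.∷ N) =
    concatMap (λ j → List.map (λ b → pow (α j) n * b) (rootsP α N))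
              (List.allFin d)

  prodR : List Carrier → Carrier
  prodR = List.foldr _*_ 1#

  -- Res(A,B) = ∏_{A(a)=0, B(b)=0} (a - b), roots with multiplicity
  resRoots : List Carrier → List Carrier → Carrier
  resRoots as bs = prodR (concatMap (λ a → List.map (λ b → a + - b) bs) as)

  U : ∀ {d} → (Fin d → Carrier) → ℕ → Carrier
  U α n = resRoots (rootsP α (Dplus n)) (rootsP α (Dminus n))

{-# OPTIONS --safe #-}

-- A list L of roots is recorded by its series c_L(t) = ∏ (1 - a t), and L is rational if
-- the coefficients of c_L are integers.  For rational L and integral g, the product
-- ∏ g(a) over L is the determinant of g acting on ℤ[y]/(f_L), so it is an integer given
-- by a formula that makes sense over every commutative ring and commutes with
-- homomorphisms.  Over ℤ[t] this yields formulas for the series of the powers L^(q) and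
-- of the products L ⊗ M in terms of c_L and c_M; in particular they respect congruences.
--
-- In a ring where p = 0, the series of L^(p) arises from c_L by raising the coefficients
-- to the p-th power, as one sees in a splitting ring.  Hence c_{L^(p)} ≡ c_L mod p, and
-- applied to g + s h over ℤ[s]/p it shows that c_L ≡ c_M mod p^k implies
-- c_{L^(p)} ≡ c_{M^(p)} mod p^(k+1).  By induction the series of L^(p^(k+1)) and L^(p^k)
-- are congruent mod p^(k+1).
--
-- If n = p^(k+1) m with p ∤ m, then D₊(n) = p^(k+1) D₊(m) ∪ p^k D₋(m) and
-- D₋(n) = p^(k+1) D₋(m) ∪ p^k D₊(m), so P_{D₊(n)} ≡ P_{D₋(n)} mod p^(k+1), and therefore
-- mod n.  Thus P_{D₋(n)}(a) = n Q(a) with Q ∈ ℤ[x] for each of the d^r roots a of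
-- P_{D₊(n)}, and U(n) = n^(d^r) ∏ Q(a), where ∏ Q(a) is an integer.
module Submission where

open import Defs
open import Level using (Level; _⊔_; 0ℓ)
open import Algebra.Bundles using (CommutativeRing)
open import Data.Nat using (ℕ; zero; suc; _≤_; _<_; _≤?_; _^_; _∸_; z≤n; s≤s)
open import Data.Integer using (ℤ; +_; -[1+_])
open import Data.Fin using (Fin; toℕ)
open import Data.Vec using (Vec; []; _∷_; _∷ʳ_; lookup)
open import Data.Vec.Relation.Binary.Pointwise.Inductive using (Pointwise)
open import Data.Product using (Σ; Σ-syntax; ∃; ∃₂; _×_; _,_; proj₁; proj₂)
open import Relation.Binary.PropositionalEquality using (_≡_)

import Algebra.Properties.AbelianGroup as AbelianGroupProperties
import Algebra.Properties.CommutativeSemiring.Binomial as Binomial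
import Algebra.Properties.Ring as RingProperties
import Algebra.Properties.Semiring.Exp as Exp
import Algebra.Properties.Semiring.Mult as Mult
import Algebra.Properties.Semiring.Sum as Sum
import Algebra.Solver.Ring as RingSolver
open import Algebra.Solver.Ring.AlmostCommutativeRing
  using (fromCommutativeRing; _-Raw-AlmostCommutative⟶_)
open import Data.Bool using (Bool; true; false)
open import Data.Empty using (⊥-elim)
import Data.Fin as Fin
import Data.Fin.Properties as Fin
import Data.Integer as ℤ
import Data.Integer.Divisibility.Signed as Signed
import Data.Integer.Properties as ℤ
open import Data.List as List using (List; []; _∷_; _++_; concatMap)
import Data.List.Properties as List
open import Data.List.Membership.Propositional using (_∈_)
import Data.List.Relation.Binary.Permutation.Propositional as Perm
import Data.List.Relation.Binary.Permutation.Propositional.Properties as Perm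
import Data.List.Relation.Binary.Permutation.Setoid as SetoidPerm
import Data.List.Relation.Binary.Permutation.Setoid.Properties as SetoidPermProperties
open import Data.List.Relation.Binary.Pointwise as Listwise using ([]; _∷_)
  renaming (Pointwise to Listwise)
open import Data.List.Relation.Unary.All as All using (All; []; _∷_)
open import Data.List.Relation.Unary.Any using (here; there)
open import Data.Maybe using (Maybe; just; nothing)
import Data.Nat as ℕ
open import Data.Nat.Combinatorics using (_C_; nCn≡1)
import Data.Nat.Divisibility as ℕ∣
open import Data.Nat.Primality using (Prime; prime⇒nonTrivial)
import Data.Nat.Properties as ℕ
open import Data.Sum using (_⊎_; inj₁; inj₂)
import Data.Vec as Vec
import Data.Vec.Properties as Vec
import Data.Vec.Relation.Binary.Pointwise.Inductive as VecPointwise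
open import Function using (_∘_)
import Relation.Binary.PropositionalEquality as ≡
import Relation.Binary.Reasoning.Setoid as SetoidReasoning
open import Relation.Nullary using (¬_; yes; no)

-- `R` is an arbitrary commutative ring containing ℤ. The integer n may be invertible in it and zero
-- divisors may occur, so divisibility seen in `R` says nothing about ℤ, and the given roots cannot
-- simply be reduced modulo p. Congruences are therefore stated between coefficients lying in ℤ, and
-- roots serve only to identify which series a formula computes; injectivity of `ι` carries such
-- identifications back to ℤ. The same formula is evaluated on two unrelated sets of roots: those in
-- `R`, which give it its meaning, and roots adjoined afresh over a ring with p = 0, which give its
-- reduction. Determinants take the place of the theorem on symmetric functions: the formula is
-- explicit, needs no division, and its compatibility with homomorphisms is a structural induction.

private
  variable
    a b c ℓ ℓ₁ ℓ₂ ℓ₃ : Level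

-- Elementary number theory: prime powers, μ and the two divisor lists.

module NumberTheory where
  open import Data.List using (upTo; filter)
  open import Data.List.Membership.Propositional.Properties
    using (∈-filter⁺; ∈-filter⁻; ∈-map⁺; ∈-map⁻; ∈-upTo⁺; ∈-++⁺ˡ; ∈-++⁺ʳ; ∈-++⁻)
  open import Data.List.Membership.Propositional.Properties.WithK using (unique∧set⇒bag)
  open import Data.List.Relation.Binary.BagAndSetEquality using (∼bag⇒↭)
  open import Data.List.Relation.Binary.Permutation.Propositional using (_↭_)
  open import Data.List.Relation.Binary.Permutation.Propositional.Properties using (↭-length)
  open import Data.List.Relation.Unary.Unique.Propositional using (Unique; []; _∷_)
  import Data.List.Relation.Unary.Unique.Propositional.Properties as Unique
  open import Data.Nat using (_≟_; _+_; _*_; _!; NonZero)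
  open import Data.Nat.Combinatorics using (nCk≡n!/k![n-k]!; k![n∸k]!∣n!)
  open import Data.Nat.Divisibility
  open import Data.Nat.DivMod using (m*n/n≡m; m/n*n≡m; m*[n/m]≡n)
  open import Data.Nat.Induction using (<-rec)
  open import Data.Nat.Primality
    using (prime?; euclidsLemma; prime⇒nonZero; prime⇒irreducible; _Rough_; 2-rough;
           rough∧∣⇒prime; rough∧∣⇒rough; ∤⇒rough-suc; rough⇒≤)
  open import Data.Nat.Primality.Factorisation using (factorise; module PrimeFactorisation)
  open import Data.Nat.Solver using (module +-*-Solver)
  open import Data.Sum using ([_,_])
  open import Function using (mk⇔)
  open import Relation.Binary.PropositionalEquality using (_≢_; refl; sym; trans; cong; cong₂; subst)
  open import Relation.Nullary using (Dec)
  open import Relation.Nullary.Decidable using (_×-dec_)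

  -- Prime powers

  module PrimeDivision {p : ℕ} (pp : Prime p) where

    instance
      p≢0 : NonZero p
      p≢0 = prime⇒nonZero pp

    1<p : 1 < p
    1<p = ℕ.nonTrivial⇒n>1 p {{prime⇒nonTrivial pp}}

    p∤1 : ¬ p ∣ 1
    p∤1 p∣1 = ℕ.<⇒≱ 1<p (∣⇒≤ p∣1)

    ∣prime⇒≡ : ∀ {q} → Prime q → p ∣ q → p ≡ q
    ∣prime⇒≡ qq p∣q with prime⇒irreducible qq p∣q
    ... | inj₁ refl = ⊥-elim (p∤1 ∣-refl)
    ... | inj₂ e    = e

    ∣^⇒∣ : ∀ q k → p ∣ q ^ k → p ∣ q
    ∣^⇒∣ q zero    h = ⊥-elim (p∤1 h)
    ∣^⇒∣ q (suc k) h with euclidsLemma q (q ^ k) pp h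
    ... | inj₁ p∣q = p∣q
    ... | inj₂ h′  = ∣^⇒∣ q k h′

    ^-cancelˡ : ∀ k {x y} → p ^ k * x ≡ p ^ k * y → x ≡ y
    ^-cancelˡ k {x} {y} = ℕ.*-cancelˡ-≡ x y (p ^ k) {{ℕ.m^n≢0 p k}}

    coprime-^∣ : ∀ k {m x} → ¬ p ∣ m → p ^ k ∣ m * x → p ^ k ∣ x
    coprime-^∣ zero    p∤m h = 1∣ _
    coprime-^∣ (suc k) {m} {x} p∤m h with euclidsLemma m x pp (∣-trans (m∣m*n (p ^ k)) h)
    ... | inj₁ p∣m = ⊥-elim (p∤m p∣m)
    ... | inj₂ (divides-refl y) = subst (p * p ^ k ∣_) (ℕ.*-comm p y)
      (*-monoʳ-∣ p (coprime-^∣ k p∤m (*-cancelˡ-∣ p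
        (subst (p * p ^ k ∣_) (trans (sym (ℕ.*-assoc m y p)) (ℕ.*-comm (m * y) p)) h))))

    valuation : ∀ n → 0 < n → ∃₂ λ k m → n ≡ p ^ k * m × ¬ p ∣ m
    valuation = <-rec _ λ n rec 0<n → go n rec 0<n (p ∣? n)
      where
      go : ∀ n → (∀ {m} → m < n → 0 < m → ∃₂ λ k r → m ≡ p ^ k * r × ¬ p ∣ r) → 0 < n →
        Dec (p ∣ n) → ∃₂ λ k m → n ≡ p ^ k * m × ¬ p ∣ m
      go n rec 0<n (no p∤n) = 0 , n , sym (ℕ.*-identityˡ n) , p∤n
      go n rec 0<n (yes (divides-refl (suc q))) with rec (ℕ.m<m*n (suc q) p 1<p) (s≤s z≤n)
      ... | k , m , e , p∤m = suc k , m , trans (ℕ.*-comm (suc q) p) (trans (cong (p *_) e) (sym (ℕ.*-assoc p (p ^ k) m))) , p∤m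

  prime-divisor : ∀ n → 1 < n → ∃ λ p → Prime p × p ∣ n
  prime-divisor n 1<n = go (PrimeFactorisation.factors F) (PrimeFactorisation.isFactorisation F)
    (PrimeFactorisation.factorsPrime F)
    where
    F = factorise n {{ℕ.>-nonZero (ℕ.<⇒≤ 1<n)}}
    go : ∀ ps → n ≡ List.foldr _*_ 1 ps → All Prime ps → ∃ λ p → Prime p × p ∣ n
    go []       e _        = ⊥-elim (ℕ.<⇒≢ 1<n (sym e))
    go (p ∷ ps) e (pp ∷ _) = p , pp , subst (p ∣_) (sym e) (m∣m*n _)

  prime-power-split : ∀ n → 1 < n → ∃ λ p → Prime p × ∃₂ λ k m → n ≡ p ^ suc k * m × ¬ p ∣ m
  prime-power-split n 1<n with prime-divisor n 1<n
  ... | p , pp , p∣n with PrimeDivision.valuation pp n (ℕ.<⇒≤ 1<n)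
  ...   | zero  , m , e , p∤m = ⊥-elim (p∤m (subst (p ∣_) (trans e (ℕ.*-identityˡ m)) p∣n))
  ...   | suc k , m , e , p∤m = p , pp , k , m , e , p∤m

  cofactor-positive : ∀ {p m} → ¬ p ∣ m → 0 < m
  cofactor-positive {p} {zero}  p∤0 = ⊥-elim (p∤0 (p ∣0))
  cofactor-positive {p} {suc m} _   = s≤s z≤n

  -- Each step removes a whole prime power, so the cofactor is coprime to the prime removed. The
  -- divisor lists and their lengths decompose along such factorisations.
  prime-power-induction : (P : ℕ → Set) → P 1 →
    (∀ {p} → Prime p → ∀ k m → ¬ p ∣ m → P m → P (p ^ suc k * m)) → ∀ n → 0 < n → P n
  prime-power-induction P P1 step = <-rec _ go
    where
    go : ∀ n → (∀ {m} → m < n → 0 < m → P m) → 0 < n → P n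
    go (suc zero)      rec _ = P1
    go n@(suc (suc _)) rec _ with prime-power-split n (s≤s (s≤s z≤n))
    ... | p , pp , k , m , e , p∤m = subst P (sym e) (step pp k m p∤m (rec m<n 0<m))
      where
      open PrimeDivision pp
      0<m = cofactor-positive p∤m
      m<n : m < n
      m<n = subst (m <_) (trans (ℕ.*-comm m _) (sym e))
        (ℕ.m<m*n m (p ^ suc k) {{ℕ.>-nonZero 0<m}}
          (ℕ.<-≤-trans 1<p (ℕ.m≤m*n p (p ^ k) {{ℕ.m^n≢0 p k}})))

  prime-powers-∣ : ∀ n → 0 < n → ∀ x →
    (∀ {p} → Prime p → ∀ k m → n ≡ p ^ suc k * m → ¬ p ∣ m → p ^ suc k ∣ x) → n ∣ x
  prime-powers-∣ n 0<n x = prime-power-induction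
    (λ n → (∀ {p} → Prime p → ∀ k m → n ≡ p ^ suc k * m → ¬ p ∣ m → p ^ suc k ∣ x) → n ∣ x)
    (λ _ → 1∣ x) step n 0<n
    where
    open +-*-Solver
    step : ∀ {p} → Prime p → ∀ k m → ¬ p ∣ m →
      ((∀ {q} → Prime q → ∀ j r → m ≡ q ^ suc j * r → ¬ q ∣ r → q ^ suc j ∣ x) → m ∣ x) →
      (∀ {q} → Prime q → ∀ j r → p ^ suc k * m ≡ q ^ suc j * r → ¬ q ∣ r → q ^ suc j ∣ x) →
      p ^ suc k * m ∣ x
    step {p} pp k m p∤m rec hyp
      -- A prime power exact in `m` is exact in `p ^ suc k * m` too: a prime q dividing both `m` and
      -- `p ^ suc k` would be p, which does not divide `m`.
      with rec (λ {q} qq j r m≡ q∤r → hyp qq j (p ^ suc k * r)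
        (trans (cong (p ^ suc k *_) m≡)
          (solve 3 (λ a b c → a :* (b :* c) := b :* (a :* c)) refl (p ^ suc k) (q ^ suc j) r))
        (λ q∣ → [ (λ q∣pᵏ → p∤m (subst (_∣ m)
                    (PrimeDivision.∣prime⇒≡ qq pp (PrimeDivision.∣^⇒∣ qq p (suc k) q∣pᵏ))
                    (subst (q ∣_) (sym m≡) (∣-trans (m∣m*n (q ^ j)) (m∣m*n r)))))
                , q∤r ] (euclidsLemma (p ^ suc k) r qq q∣)))
    ... | divides-refl y = subst (p ^ suc k * m ∣_) (ℕ.*-comm m y)
      (subst (_∣ m * y) (ℕ.*-comm m (p ^ suc k)) (*-monoʳ-∣ m
        (PrimeDivision.coprime-^∣ pp (suc k) p∤m (subst (p ^ suc k ∣_) (ℕ.*-comm y m) (hyp pp k m refl p∤m)))))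

  prime∤! : ∀ {p} → Prime p → ∀ k → k < p → ¬ p ∣ k !
  prime∤! pp zero    k<p p∣1 = ℕ.<⇒≱ (ℕ.nonTrivial⇒n>1 _ {{prime⇒nonTrivial pp}}) (∣⇒≤ p∣1)
  prime∤! pp (suc k) k<p p∣k! with euclidsLemma (suc k) (k !) pp p∣k!
  ... | inj₁ p∣1+k = ℕ.<⇒≱ k<p (∣⇒≤ p∣1+k)
  ... | inj₂ p∣k!′ = prime∤! pp k (ℕ.<⇒≤ k<p) p∣k!′

  prime∣C : ∀ {p} → Prime p → ∀ k → 0 < k → k < p → p ∣ p C k
  prime∣C {p@(suc _)} pp k 0<k k<p
    with euclidsLemma (p C k) (k ! * (p ∸ k) !) pp
           (subst (p ∣_) (sym C*k!≡p!) (m∣m*n _))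
    where
    instance _ = k ℕ.!* (p ∸ k) !≢0
    C*k!≡p! : (p C k) * (k ! * (p ∸ k) !) ≡ p !
    C*k!≡p! = trans (cong (λ m → m * (k ! * (p ∸ k) !)) (nCk≡n!/k![n-k]! (ℕ.<⇒≤ k<p)))
      (m/n*n≡m (k![n∸k]!∣n! (ℕ.<⇒≤ k<p)))
  ... | inj₁ h = h
  ... | inj₂ h with euclidsLemma (k !) ((p ∸ k) !) pp h
  ...   | inj₁ h′ = ⊥-elim (prime∤! pp k k<p h′)
  ...   | inj₂ h′ = ⊥-elim (prime∤! pp (p ∸ k) (ℕ.∸-monoʳ-< 0<k (ℕ.<⇒≤ k<p)) h′)

  -- The Möbius function

  -- `muAux` removes primes in increasing order, whereas the decomposition of the divisor lists
  -- removes an arbitrary prime. The relation allows any order of removal; `möbius-unique` shows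
  -- that the value does not depend on it.
  data Möbius : ℕ → ℤ → Set where
    one    : Möbius 1 (+ 1)
    step   : ∀ {n p q x} → n ≡ p * q → Prime p → ¬ p ∣ q → Möbius q x → Möbius n (ℤ.- x)
    square : ∀ {n p q} → n ≡ p * (p * q) → Prime p → Möbius n (+ 0)

  private
    other-prime : ∀ {p r q s} → Prime p → Prime r → p ≢ r → p * q ≡ r * s → ∃ λ t → s ≡ p * t × q ≡ r * t
    other-prime {p} {r} {q} {s} pp rr p≢r e with euclidsLemma r s pp (subst (p ∣_) e (m∣m*n q))
    ... | inj₁ p∣r = ⊥-elim (p≢r (PrimeDivision.∣prime⇒≡ pp rr p∣r))
    ... | inj₂ (divides t s≡) = t , trans s≡ (ℕ.*-comm t p) ,
      ℕ.*-cancelˡ-≡ q (r * t) p {{prime⇒nonZero pp}} (trans e (trans (cong (r *_) s≡)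
        (solve 3 (λ r t p → r :* (t :* p) := p :* (r :* t)) refl r t p)))
      where open +-*-Solver

    ≢1 : ∀ {p q} → Prime p → 1 ≢ p * q
    ≢1 {p} {q} pp e = PrimeDivision.p∤1 pp (subst (p ∣_) (sym e) (m∣m*n q))

    cancel : ∀ {p q r} → Prime p → p * q ≡ p * r → q ≡ r
    cancel {p} {q} {r} pp = ℕ.*-cancelˡ-≡ q r p {{prime⇒nonZero pp}}

  -- A derivation may remove another prime r first. Then p is removed from the cofactor of r by
  -- recursion and r is put back; a square factor of r stays in `q` because r differs from p.
  möbius-divide : ∀ {n x p q} → Möbius n x → Prime p → n ≡ p * q → ¬ p ∣ q → Möbius q (ℤ.- x)
  möbius-divide one pp e _ = ⊥-elim (≢1 pp e)
  möbius-divide {p = p} {q} (step {p = r} {s} {x} e′ rr r∤s M) pp e p∤q with p ≟ r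
  ... | yes refl = subst (λ t → Möbius t (ℤ.- (ℤ.- x))) (cancel pp (trans (sym e′) e))
    (subst (Möbius s) (sym (ℤ.neg-involutive x)) M)
  ... | no p≢r with other-prime pp rr p≢r (trans (sym e) e′)
  ...   | t , s≡pt , q≡rt = step q≡rt rr
    (λ r∣t → r∤s (subst (r ∣_) (sym s≡pt) (∣-trans r∣t (n∣m*n p))))
    (möbius-divide M pp s≡pt (λ p∣t → p∤q (subst (p ∣_) (sym q≡rt) (∣-trans p∣t (n∣m*n r)))))
  möbius-divide {p = p} {q} (square {p = r} {s} e′ rr) pp e p∤q with p ≟ r
  ... | yes refl = ⊥-elim (p∤q (subst (p ∣_) (cancel pp (trans (sym e′) e)) (m∣m*n s)))
  ... | no p≢r with other-prime pp rr p≢r (trans (sym e) e′)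
  ...   | t , rs≡pt , q≡rt with other-prime pp rr p≢r (sym rs≡pt)
  ...     | t′ , _ , t≡ = square (trans q≡rt (cong (r *_) t≡)) rr

  möbius-square : ∀ {n x p q} → Möbius n x → Prime p → n ≡ p * (p * q) → x ≡ + 0
  möbius-square one pp e = ⊥-elim (≢1 pp e)
  möbius-square {p = p} {q} (step {p = r} {s} e′ rr r∤s M) pp e with p ≟ r
  ... | yes refl = ⊥-elim (r∤s (subst (r ∣_) (cancel pp (trans (sym e) e′)) (m∣m*n q)))
  ... | no p≢r with other-prime pp rr p≢r (trans (sym e) e′)
  ...   | t , s≡pt , pq≡rt with other-prime pp rr p≢r pq≡rt
  ...     | t′ , t≡pt′ , _ = cong ℤ.-_ (möbius-square M pp (trans s≡pt (cong (p *_) t≡pt′)))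
  möbius-square (square _ _) pp e = refl

  möbius-unique : ∀ {n x y} → Möbius n x → Möbius n y → x ≡ y
  möbius-unique one          one            = refl
  möbius-unique one          (step e pp _ _) = ⊥-elim (≢1 pp e)
  möbius-unique one          (square e pp)  = ⊥-elim (≢1 pp e)
  möbius-unique (step {x = x} e pp p∤q M) N =
    trans (cong ℤ.-_ (möbius-unique M (möbius-divide N pp e p∤q))) (ℤ.neg-involutive _)
  möbius-unique (square e pp) N = sym (möbius-square N pp e)

  -- Roughness records that all smaller candidates are excluded, so a divisor that is found is
  -- prime. The bound `n ≤ f + j` survives each step, which lowers the fuel and raises `j` by one;
  -- as a rough `n` other than 1 is at least `2 + j`, the fuel cannot run out.
  muAux-möbius : ∀ f n j → 0 < n → 0 < f → n ≤ f + j → (2 + j) Rough n → Möbius n (muAux f n j)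
  muAux-möbius (suc f) (suc zero) j _ _ _ _ = one
  muAux-möbius (suc f) n@(suc (suc _)) j 0<n _ n≤ rough with (2 + j) ∣? n
  ... | no k∤n = muAux-möbius f n (suc j) 0<n
      (ℕ.+-cancelʳ-≤ (suc (suc j)) 1 f (ℕ.≤-trans (rough⇒≤ (∤⇒rough-suc k∤n rough))
        (ℕ.≤-trans n≤ (subst (suc (f + j) ≤_) (sym (trans (ℕ.+-suc f (suc j)) (cong suc (ℕ.+-suc f j))))
          (ℕ.n≤1+n _)))))
      (subst (n ≤_) (sym (ℕ.+-suc f j)) n≤)
      (∤⇒rough-suc k∤n rough)
  ... | yes k∣n with ((2 + j) * (2 + j)) ∣? n
  ...   | yes (divides q e) = square {q = q} (trans e (trans (ℕ.*-comm q ((2 + j) * (2 + j))) (ℕ.*-assoc (2 + j) (2 + j) q)))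
      (rough∧∣⇒prime rough k∣n)
  ...   | no k²∤n = step n≡ (rough∧∣⇒prime rough k∣n) k∤q
      (muAux-möbius f (n ℕ./ (2 + j)) (suc j) 0<q 0<f
        (ℕ.≤-trans (∣⇒≤ q∣n) (subst (n ≤_) (sym (ℕ.+-suc f j)) n≤))
        (∤⇒rough-suc k∤q (rough∧∣⇒rough rough q∣n)))
    where
    n≡ : n ≡ (2 + j) * (n ℕ./ (2 + j))
    n≡ = sym (m*[n/m]≡n k∣n)
    q∣n : n ℕ./ (2 + j) ∣ n
    q∣n = subst (n ℕ./ (2 + j) ∣_) (sym n≡) (n∣m*n (2 + j))
    k∤q : ¬ (2 + j) ∣ n ℕ./ (2 + j)
    k∤q k∣q = k²∤n (subst ((2 + j) * (2 + j) ∣_) (sym n≡) (*-monoʳ-∣ (2 + j) k∣q))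
    0<q : 0 < n ℕ./ (2 + j)
    0<q = cofactor-positive k∤q
    0<f : 0 < f
    0<f = ℕ.+-cancelʳ-≤ (suc j) 1 f (subst (2 + j ≤_) (sym (ℕ.+-suc f j)) (ℕ.≤-trans (∣⇒≤ k∣n) n≤))

  μ-möbius : ∀ n → 0 < n → Möbius n (μ n)
  μ-möbius n 0<n = muAux-möbius n n 0 0<n 0<n (ℕ.≤-reflexive (sym (ℕ.+-identityʳ n))) 2-rough

  μ-step : ∀ {p} → Prime p → ∀ q → 0 < q → ¬ p ∣ q → μ (p * q) ≡ ℤ.- μ q
  μ-step {p} pp q 0<q p∤q = möbius-unique
    (μ-möbius (p * q) (ℕ.<-≤-trans 0<q (ℕ.m≤n*m q p {{prime⇒nonZero pp}})))
    (step refl pp p∤q (μ-möbius q 0<q))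

  μ-square : ∀ {p} → Prime p → ∀ q → 0 < p * (p * q) → μ (p * (p * q)) ≡ + 0
  μ-square pp q 0<n = möbius-square (μ-möbius _ 0<n) pp refl

  -- The divisor sets D₊ and D₋

  divisor? : ∀ σ n i → Dec (suc i ∣ n × μ (n ℕ./ suc i) ≡ σ)
  divisor? σ n i = (suc i ∣? n) ×-dec (μ (n ℕ./ suc i) ℤ.≟ σ)

  -- `Dplus` and `Dminus` are by definition the values at 1 and -1. Treating the sign as a parameter
  -- lets one decomposition, which exchanges the signs, serve both.
  Divisors : ℤ → ℕ → List ℕ
  Divisors σ n = List.map suc (filter (divisor? σ n) (upTo n))

  ∈-Divisors⁺ : ∀ {σ n} d e → 0 < n → n ≡ e * d → μ e ≡ σ → d ∈ Divisors σ n
  ∈-Divisors⁺ zero    e 0<n n≡ed μe≡σ = ⊥-elim (ℕ.<⇒≢ 0<n (sym (trans n≡ed (ℕ.*-zeroʳ e))))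
  ∈-Divisors⁺ {σ} {n} (suc i) e 0<n refl μe≡σ = ∈-map⁺ suc (∈-filter⁺ (divisor? σ n)
    (∈-upTo⁺ (∣⇒≤ {{ℕ.>-nonZero 0<n}} (n∣m*n e)))
    (n∣m*n e , trans (cong μ (m*n/n≡m e (suc i))) μe≡σ))

  ∈-Divisors⁻ : ∀ {σ n d} → d ∈ Divisors σ n → ∃ λ e → n ≡ e * d × μ e ≡ σ
  ∈-Divisors⁻ {σ} {n} d∈ with ∈-map⁻ suc d∈
  ... | i , i∈ , refl with proj₂ (∈-filter⁻ (divisor? σ n) {xs = upTo n} i∈)
  ...   | divides-refl e , μ≡ = e , refl , trans (cong μ (sym (m*n/n≡m e (suc i)))) μ≡

  Divisors-unique : ∀ σ n → Unique (Divisors σ n)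
  Divisors-unique σ n = Unique.map⁺ ℕ.suc-injective (Unique.filter⁺ (divisor? σ n) (Unique.upTo⁺ n))

  module _ {p : ℕ} (pp : Prime p) (k m : ℕ) (p∤m : ¬ p ∣ m) where
    open PrimeDivision pp
    open +-*-Solver

    private
      n : ℕ
      n = p ^ suc k * m

      0<m : 0 < m
      0<m = cofactor-positive p∤m

      0<n : 0 < n
      0<n = ℕ.<-≤-trans 0<m (ℕ.m≤n*m m (p ^ suc k) {{ℕ.m^n≢0 p (suc k)}})

      factor-positive : ∀ {x y z} → 0 < x → x ≡ y * z → 0 < y
      factor-positive {y = suc y} 0<x e = s≤s z≤n
      factor-positive {y = zero}  0<x e = ⊥-elim (ℕ.<⇒≢ 0<x (sym e))

    lifted : ℤ → ℕ → List ℕ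
    lifted σ j = List.map (p ^ j *_) (Divisors σ m)

    -- Let n = e d with μ(e) = σ. As σ is not 0, p² does not divide e. If p does not divide e, then
    -- d absorbs the full power of p; if e = p e′, then d absorbs all but one factor p, and μ(e′) =
    -- -σ. Both lists are free of duplicates, so equality as sets gives a permutation.
    Divisors-prime-power : ∀ σ → σ ≢ + 0 → Divisors σ n ↭ lifted σ (suc k) ++ lifted (ℤ.- σ) k
    Divisors-prime-power σ σ≢0 = ∼bag⇒↭ (unique∧set⇒bag (Divisors-unique σ n)
      (Unique.++⁺ (Unique.map⁺ (^-cancelˡ (suc k)) (Divisors-unique σ m))
                  (Unique.map⁺ (^-cancelˡ k) (Divisors-unique (ℤ.- σ) m)) disjoint)
      (mk⇔ to (λ h → [ fromˡ , fromʳ ] (∈-++⁻ (lifted σ (suc k)) h))))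
      where
      disjoint : ∀ {d} → ¬ (d ∈ lifted σ (suc k) × d ∈ lifted (ℤ.- σ) k)
      disjoint (h₁ , h₂) with ∈-map⁻ (p ^ suc k *_) h₁ | ∈-map⁻ (p ^ k *_) h₂
      ... | d₁ , _ , refl | d₂ , d₂∈ , e with ∈-Divisors⁻ {ℤ.- σ} d₂∈
      ...   | c , m≡ , _ = p∤m (subst (p ∣_) (sym m≡) (∣-trans (subst (p ∣_) pd₁≡d₂ (m∣m*n d₁)) (n∣m*n c)))
        where
        pd₁≡d₂ : p * d₁ ≡ d₂
        pd₁≡d₂ = ^-cancelˡ k (trans (solve 3 (λ a b c → b :* (a :* c) := (a :* b) :* c) refl p (p ^ k) d₁) e)

      to : ∀ {d} → d ∈ Divisors σ n →
        d ∈ lifted σ (suc k) ++ lifted (ℤ.- σ) k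
      to {d} d∈ with ∈-Divisors⁻ {σ} d∈
      ... | e , n≡ , μe≡σ with p ∣? e
      ...   | no p∤e with coprime-^∣ (suc k) p∤e (subst (p ^ suc k ∣_) n≡ (m∣m*n m))
      ...     | divides d′ d≡ = ∈-++⁺ˡ (subst (_∈ lifted σ (suc k)) (trans (ℕ.*-comm (p ^ suc k) d′) (sym d≡))
        (∈-map⁺ (p ^ suc k *_) (∈-Divisors⁺ d′ e 0<m (^-cancelˡ (suc k) (trans n≡ (trans (cong (e *_) d≡)
          (solve 3 (λ e d q → e :* (d :* q) := q :* (e :* d)) refl e d′ (p ^ suc k))))) μe≡σ)))
      to {d} d∈ | e , n≡ , μe≡σ | yes (divides e′ e≡) with p ∣? e′
      ...     | yes (divides e″ e′≡) = ⊥-elim (σ≢0 (trans (sym μe≡σ) (trans (cong μ e≡ppe″)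
          (μ-square pp e″ (subst (0 <_) e≡ppe″ (factor-positive 0<n n≡))))))
        where
        e≡ppe″ : e ≡ p * (p * e″)
        e≡ppe″ = trans e≡ (trans (cong (_* p) e′≡) (solve 2 (λ p e → e :* p :* p := p :* (p :* e)) refl p e″))
      ...     | no p∤e′ with coprime-^∣ k p∤e′ (subst (p ^ k ∣_) reduced (m∣m*n m))
        where
        reduced : p ^ k * m ≡ e′ * d
        reduced = ℕ.*-cancelˡ-≡ (p ^ k * m) (e′ * d) p
          (trans (sym (ℕ.*-assoc p (p ^ k) m)) (trans n≡ (trans (cong (_* d) e≡)
            (solve 3 (λ e p d → e :* p :* d := p :* (e :* d)) refl e′ p d))))
      ...       | divides d′ d≡ = ∈-++⁺ʳ (lifted σ (suc k)) (subst (_∈ lifted (ℤ.- σ) k) (trans (ℕ.*-comm (p ^ k) d′) (sym d≡))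
        (∈-map⁺ (p ^ k *_) (∈-Divisors⁺ d′ e′ 0<m m≡ μe′≡)))
        where
        m≡ : m ≡ e′ * d′
        m≡ = ^-cancelˡ (suc k) (trans n≡ (trans (cong₂ _*_ e≡ d≡)
          (solve 4 (λ e p d q → e :* p :* (d :* q) := p :* q :* (e :* d)) refl e′ p d′ (p ^ k))))
        μe′≡ : μ e′ ≡ ℤ.- σ
        μe′≡ = trans (sym (ℤ.neg-involutive (μ e′))) (cong ℤ.-_ (trans
          (sym (μ-step pp e′ (factor-positive 0<m m≡) p∤e′))
          (trans (cong μ (trans (ℕ.*-comm p e′) (sym e≡))) μe≡σ)))

      fromˡ : ∀ {d} → d ∈ lifted σ (suc k) → d ∈ Divisors σ n
      fromˡ h with ∈-map⁻ (p ^ suc k *_) h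
      ... | d′ , d′∈ , refl with ∈-Divisors⁻ {σ} d′∈
      ...   | e , m≡ , μe≡ = ∈-Divisors⁺ (p ^ suc k * d′) e 0<n (trans (cong (p ^ suc k *_) m≡)
        (solve 3 (λ e d q → q :* (e :* d) := e :* (q :* d)) refl e d′ (p ^ suc k))) μe≡

      fromʳ : ∀ {d} → d ∈ lifted (ℤ.- σ) k → d ∈ Divisors σ n
      fromʳ h with ∈-map⁻ (p ^ k *_) h
      ... | d′ , d′∈ , refl with ∈-Divisors⁻ {ℤ.- σ} d′∈
      ...   | e , m≡ , μe≡ = ∈-Divisors⁺ (p ^ k * d′) (p * e) 0<n (trans (cong (p ^ suc k *_) m≡)
        (solve 4 (λ e d p q → p :* q :* (e :* d) := p :* e :* (q :* d)) refl e d′ p (p ^ k)))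
        (trans (μ-step pp e (factor-positive 0<m m≡)
            (λ p∣e → p∤m (subst (p ∣_) (sym m≡) (∣-trans p∣e (m∣m*n d′)))))
          (trans (cong ℤ.-_ μe≡) (ℤ.neg-involutive σ)))

    |Divisors|-prime-power : ∀ σ → σ ≢ + 0 →
      List.length (Divisors σ n) ≡ List.length (Divisors σ m) + List.length (Divisors (ℤ.- σ) m)
    |Divisors|-prime-power σ σ≢0 = trans (↭-length (Divisors-prime-power σ σ≢0))
      (trans (List.length-++ (List.map (p ^ suc k *_) (Divisors σ m)))
        (cong₂ _+_ (List.length-map _ (Divisors σ m)) (List.length-map _ (Divisors (ℤ.- σ) m))))

    private
      primeDivisor? : ∀ n q → Dec (Prime q × q ∣ n)
      primeDivisor? n q = prime? q ×-dec (q ∣? n)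

      PrimeDivisors : ℕ → List ℕ
      PrimeDivisors n = filter (primeDivisor? n) (upTo (suc n))

      ∈-PrimeDivisors⁺ : ∀ {n q} → 0 < n → Prime q → q ∣ n → q ∈ PrimeDivisors n
      ∈-PrimeDivisors⁺ {n} 0<n qq q∣n = ∈-filter⁺ (primeDivisor? n) (∈-upTo⁺ (s≤s (∣⇒≤ {{ℕ.>-nonZero 0<n}} q∣n))) (qq , q∣n)

      ∈-PrimeDivisors⁻ : ∀ {n q} → q ∈ PrimeDivisors n → Prime q × q ∣ n
      ∈-PrimeDivisors⁻ {n} q∈ = proj₂ (∈-filter⁻ (primeDivisor? n) {xs = upTo (suc n)} q∈)

      PrimeDivisors-unique : ∀ n → Unique (PrimeDivisors n)
      PrimeDivisors-unique n = Unique.filter⁺ (primeDivisor? n) (Unique.upTo⁺ (suc n))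

    numPrimeFactors-prime-power : numPrimeFactors n ≡ suc (numPrimeFactors m)
    numPrimeFactors-prime-power = ↭-length (∼bag⇒↭ (unique∧set⇒bag (PrimeDivisors-unique n)
      (All.tabulate (λ q∈ p≡q → p∤m (subst (_∣ m) (sym p≡q) (proj₂ (∈-PrimeDivisors⁻ {m} q∈)))) ∷ PrimeDivisors-unique m)
      (mk⇔ to from)))
      where
      to : ∀ {q} → q ∈ PrimeDivisors n → q ∈ p ∷ PrimeDivisors m
      to {q} q∈ with ∈-PrimeDivisors⁻ {n} q∈
      ... | qq , q∣n with euclidsLemma (p ^ suc k) m qq q∣n
      ...   | inj₁ q∣pᵏ = here (PrimeDivision.∣prime⇒≡ qq pp (PrimeDivision.∣^⇒∣ qq p (suc k) q∣pᵏ))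
      ...   | inj₂ q∣m  = there (∈-PrimeDivisors⁺ 0<m qq q∣m)
      from : ∀ {q} → q ∈ p ∷ PrimeDivisors m → q ∈ PrimeDivisors n
      from (here refl) = ∈-PrimeDivisors⁺ 0<n pp (∣-trans (m∣m*n (p ^ k)) (m∣m*n m))
      from (there q∈) with ∈-PrimeDivisors⁻ {m} q∈
      ... | qq , q∣m = ∈-PrimeDivisors⁺ 0<n qq (∣-trans q∣m (n∣m*n (p ^ suc k)))

  -- Only the total satisfies a formula that holds from n = 1 on, where the lengths are 1 and 0.
  -- Each single length for n equals the total for the cofactor, which then gives half of the total
  -- for n > 1.
  |Divisors|-total : ∀ n → 0 < n →
    List.length (Dplus n) + List.length (Dminus n) ≡ 2 ^ numPrimeFactors n
  |Divisors|-total = prime-power-induction _ refl λ pp k m p∤m rec →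
    trans (cong₂ _+_ (|Divisors|-prime-power pp k m p∤m (+ 1) (λ ())) (|Divisors|-prime-power pp k m p∤m (ℤ.- (+ 1)) (λ ())))
    (trans (rearrange (List.length (Dplus m)) (List.length (Dminus m)))
    (trans (cong (2 *_) rec) (cong (2 ^_) (sym (numPrimeFactors-prime-power pp k m p∤m)))))
    where
    open +-*-Solver
    rearrange : ∀ a b → (a + b) + (b + a) ≡ 2 * (a + b)
    rearrange = solve 2 (λ a b → (a :+ b) :+ (b :+ a) := con 2 :* (a :+ b)) refl

  private
    pred-numPrimeFactors : ∀ {p} → Prime p → ∀ k m → ¬ p ∣ m →
      numPrimeFactors (p ^ suc k * m) ∸ 1 ≡ numPrimeFactors m
    pred-numPrimeFactors pp k m p∤m = cong (_∸ 1) (numPrimeFactors-prime-power pp k m p∤m)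

  |Dplus| : ∀ n → 1 < n → List.length (Dplus n) ≡ 2 ^ (numPrimeFactors n ∸ 1)
  |Dplus| n 1<n with prime-power-split n 1<n
  ... | p , pp , k , m , refl , p∤m = trans (|Divisors|-prime-power pp k m p∤m (+ 1) (λ ()))
    (trans (|Divisors|-total m (cofactor-positive p∤m)) (cong (2 ^_) (sym (pred-numPrimeFactors pp k m p∤m))))

  |Dminus| : ∀ n → 1 < n → List.length (Dminus n) ≡ 2 ^ (numPrimeFactors n ∸ 1)
  |Dminus| n 1<n with prime-power-split n 1<n
  ... | p , pp , k , m , refl , p∤m = trans (|Divisors|-prime-power pp k m p∤m (ℤ.- (+ 1)) (λ ()))
    (trans (ℕ.+-comm (List.length (Dminus m)) _)
    (trans (|Divisors|-total m (cofactor-positive p∤m)) (cong (2 ^_) (sym (pred-numPrimeFactors pp k m p∤m)))))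

open NumberTheory
  using (prime∣C; prime-powers-∣; Divisors-prime-power; |Dplus|; |Dminus|)
open import Data.Integer.Divisibility using (_∣_)

-- Homomorphisms of commutative rings.

record Hom (A : CommutativeRing a ℓ₁) (B : CommutativeRing b ℓ₂) : Set (a ⊔ b ⊔ ℓ₁ ⊔ ℓ₂) where
  private
    module A = CommutativeRing A
    module B = CommutativeRing B
  field
    fun    : A.Carrier → B.Carrier
    cong   : ∀ {x y} → x A.≈ y → fun x B.≈ fun y
    +-homo : ∀ x y → fun (x A.+ y) B.≈ fun x B.+ fun y
    *-homo : ∀ x y → fun (x A.* y) B.≈ fun x B.* fun y
    0-homo : fun A.0# B.≈ B.0#
    1-homo : fun A.1# B.≈ B.1#

  neg-homo : ∀ x → fun (A.- x) B.≈ B.- fun x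
  neg-homo x = inverseˡ-unique _ _ (begin
    fun (A.- x) B.+ fun x ≈⟨ B.sym (+-homo _ _) ⟩
    fun (A.- x A.+ x)     ≈⟨ cong (A.-‿inverseˡ x) ⟩
    fun A.0#              ≈⟨ 0-homo ⟩
    B.0#                  ∎)
    where
    open AbelianGroupProperties B.+-abelianGroup using (inverseˡ-unique)
    open SetoidReasoning B.setoid

  sub-homo : ∀ x y → fun (x A.- y) B.≈ fun x B.- fun y
  sub-homo x y = B.trans (+-homo _ _) (B.+-congˡ (neg-homo y))

infixr 9 _∘ʰ_
_∘ʰ_ : {A : CommutativeRing a ℓ₁} {B : CommutativeRing b ℓ₂} {C : CommutativeRing c ℓ₃} →
       Hom B C → Hom A B → Hom A C
_∘ʰ_ {C = C} g f = record
  { fun    = λ x → g.fun (f.fun x)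
  ; cong   = λ e → g.cong (f.cong e)
  ; +-homo = λ x y → C.trans (g.cong (f.+-homo x y)) (g.+-homo _ _)
  ; *-homo = λ x y → C.trans (g.cong (f.*-homo x y)) (g.*-homo _ _)
  ; 0-homo = C.trans (g.cong f.0-homo) g.0-homo
  ; 1-homo = C.trans (g.cong f.1-homo) g.1-homo
  }
  where
  module C = CommutativeRing C
  module f = Hom f
  module g = Hom g

idʰ : (A : CommutativeRing a ℓ) → Hom A A
idʰ A = record
  { fun = λ x → x ; cong = λ e → e ; +-homo = λ _ _ → refl ; *-homo = λ _ _ → refl
  ; 0-homo = refl ; 1-homo = refl }
  where open CommutativeRing A

-- The canonical map from the integers.

ℤᴿ : CommutativeRing 0ℓ 0ℓ
ℤᴿ = ℤ.+-*-commutativeRing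

module _ (R : CommutativeRing c ℓ) where
  open CommutativeRing R
  open SetoidReasoning setoid
  open Mult semiring using (×-homo-+; ×1-homo-*) renaming (_×_ to _·_)
  open RingProperties ring
  open AbelianGroupProperties +-abelianGroup using (⁻¹-∙-comm)

  natR≈× : ∀ n → natR R n ≈ n · 1#
  natR≈× zero    = refl
  natR≈× (suc n) = +-congˡ (natR≈× n)

  natR-+ : ∀ m n → natR R (m ℕ.+ n) ≈ natR R m + natR R n
  natR-+ m n = trans (natR≈× (m ℕ.+ n)) (trans (×-homo-+ 1# m n)
    (sym (+-cong (natR≈× m) (natR≈× n))))

  natR-* : ∀ m n → natR R (m ℕ.* n) ≈ natR R m * natR R n
  natR-* m n = trans (natR≈× (m ℕ.* n)) (trans (×1-homo-* m n)
    (sym (*-cong (natR≈× m) (natR≈× n))))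

  private
    cancel-1+ : ∀ x y → x - y ≈ (1# + x) - (1# + y)
    cancel-1+ x y = sym (begin
      (1# + x) - (1# + y)       ≈⟨ +-congˡ (sym (⁻¹-∙-comm 1# y)) ⟩
      (1# + x) + (- 1# + - y)   ≈⟨ +-congʳ (+-comm 1# x) ⟩
      (x + 1#) + (- 1# + - y)   ≈⟨ +-assoc x 1# _ ⟩
      x + (1# + (- 1# + - y))   ≈⟨ +-congˡ (sym (+-assoc 1# _ _)) ⟩
      x + ((1# - 1#) + - y)     ≈⟨ +-congˡ (+-congʳ (-‿inverseʳ 1#)) ⟩
      x + (0# + - y)            ≈⟨ +-congˡ (+-identityˡ _) ⟩
      x - y                     ∎)

    ι-⊖ : ∀ m n → ι R (m ℤ.⊖ n) ≈ natR R m - natR R n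
    ι-⊖ m       zero    = sym (trans (+-congˡ -0#≈0#) (+-identityʳ _))
    ι-⊖ zero    (suc n) = sym (+-identityˡ _)
    ι-⊖ (suc m) (suc n) = begin
      ι R (suc m ℤ.⊖ suc n)  ≡⟨ ≡.cong (ι R) (ℤ.[1+m]⊖[1+n]≡m⊖n m n) ⟩
      ι R (m ℤ.⊖ n)          ≈⟨ ι-⊖ m n ⟩
      natR R m - natR R n                ≈⟨ cancel-1+ _ _ ⟩
      natR R (suc m) - natR R (suc n)    ∎

  ι-+ : ∀ x y → ι R (x ℤ.+ y) ≈ ι R x + ι R y
  ι-+ (+ m)    (+ n)    = natR-+ m n
  ι-+ (+ m)    -[1+ n ] = ι-⊖ m (suc n)
  ι-+ -[1+ m ] (+ n)    = trans (ι-⊖ n (suc m)) (+-comm _ _)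
  ι-+ -[1+ m ] -[1+ n ] = begin
    - natR R (suc (suc (m ℕ.+ n)))        ≡⟨ ≡.cong (λ k → - natR R (suc k)) (≡.sym (ℕ.+-suc m n)) ⟩
    - natR R (suc m ℕ.+ suc n)            ≈⟨ -‿cong (natR-+ (suc m) (suc n)) ⟩
    - (natR R (suc m) + natR R (suc n))   ≈⟨ sym (⁻¹-∙-comm _ _) ⟩
    - natR R (suc m) - natR R (suc n)     ∎

  ι-neg : ∀ x → ι R (ℤ.- x) ≈ - ι R x
  ι-neg (+ zero)  = sym -0#≈0#
  ι-neg (+ suc n) = refl
  ι-neg -[1+ n ]  = sym (-‿involutive _)

  private
    ι-*-pos : ∀ m y → ι R (+ m ℤ.* y) ≈ natR R m * ι R y
    ι-*-pos m (+ n) = trans (reflexive (≡.cong (ι R) (≡.sym (ℤ.pos-* m n)))) (natR-* m n)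
    ι-*-pos m -[1+ n ] = begin
      ι R (+ m ℤ.* -[1+ n ])          ≡⟨ ≡.cong (ι R) (≡.sym (ℤ.neg-distribʳ-* (+ m) (+ suc n))) ⟩
      ι R (ℤ.- (+ m ℤ.* + suc n))     ≈⟨ ι-neg (+ m ℤ.* + suc n) ⟩
      - ι R (+ m ℤ.* + suc n)         ≈⟨ -‿cong (ι-*-pos m (+ suc n)) ⟩
      - (natR R m * natR R (suc n))       ≈⟨ -‿distribʳ-* _ _ ⟩
      natR R m * - natR R (suc n)         ∎

  ι-* : ∀ x y → ι R (x ℤ.* y) ≈ ι R x * ι R y
  ι-* (+ m)    y = ι-*-pos m y
  ι-* -[1+ m ] y = begin
    ι R (-[1+ m ] ℤ.* y)          ≡⟨ ≡.cong (ι R) (≡.sym (ℤ.neg-distribˡ-* (+ suc m) y)) ⟩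
    ι R (ℤ.- (+ suc m ℤ.* y))     ≈⟨ ι-neg (+ suc m ℤ.* y) ⟩
    - ι R (+ suc m ℤ.* y)         ≈⟨ -‿cong (ι-*-pos (suc m) y) ⟩
    - (natR R (suc m) * ι R y)        ≈⟨ -‿distribˡ-* _ _ ⟩
    - natR R (suc m) * ι R y          ∎

  ιʰ : Hom ℤᴿ R
  ιʰ = record
    { fun = ι R ; cong = λ { ≡.refl → refl } ; +-homo = ι-+ ; *-homo = ι-*
    ; 0-homo = refl ; 1-homo = +-identityʳ 1# }

-- A ring solver with integer coefficients, so that cancellation is decided
-- in every commutative ring.
module Solver (R : CommutativeRing c ℓ) where
  private
    morphism : CommutativeRing.rawRing ℤᴿ -Raw-AlmostCommutative⟶ fromCommutativeRing R
    morphism = record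
      { ⟦_⟧ = ι R ; +-homo = ι-+ R ; *-homo = ι-* R ; -‿homo = ι-neg R
      ; 0-homo = CommutativeRing.refl R ; 1-homo = Hom.1-homo (ιʰ R) }

    dec : (x y : ℤ) → Maybe (CommutativeRing._≈_ R (ι R x) (ι R y))
    dec x y with x ℤ.≟ y
    ... | yes ≡.refl = just (CommutativeRing.refl R)
    ... | no _       = nothing

  open RingSolver (CommutativeRing.rawRing ℤᴿ) (fromCommutativeRing R) morphism dec public
    using (solve; con; _:=_; _:+_; _:*_; _:-_; :-_)

-- Polynomial rings.

module Polynomials (A : CommutativeRing c ℓ) where
  open CommutativeRing A
  open RingProperties ring using (-0#≈0#)
  open Solver A

  Poly : Set c
  Poly = List Carrier

  coeff : Poly → ℕ → Carrier
  coeff []      i       = 0#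
  coeff (x ∷ p) zero    = x
  coeff (x ∷ p) (suc i) = coeff p i

  infix 4 _≋_
  -- Comparing coefficients makes trailing zeros harmless, so no test for zero in the coefficient
  -- ring is called for. The record wrapper keeps `p` and `q` inferable.
  record _≋_ (p q : Poly) : Set ℓ where
    constructor coeffwise
    field at : ∀ i → coeff p i ≈ coeff q i
  open _≋_ public

  infixl 6 _⊕_
  infixl 7 _⊛_
  _⊕_ : Poly → Poly → Poly
  []      ⊕ q       = q
  (x ∷ p) ⊕ []      = x ∷ p
  (x ∷ p) ⊕ (y ∷ q) = x + y ∷ p ⊕ q

  neg : Poly → Poly
  neg = List.map (-_)

  scale : Carrier → Poly → Poly
  scale x = List.map (x *_)

  _⊛_ : Poly → Poly → Poly
  []      ⊛ q = []
  (x ∷ p) ⊛ q = scale x q ⊕ (0# ∷ p ⊛ q)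

  coeff-⊕ : ∀ p q i → coeff (p ⊕ q) i ≈ coeff p i + coeff q i
  coeff-⊕ []      q       i       = sym (+-identityˡ _)
  coeff-⊕ (x ∷ p) []      i       = sym (+-identityʳ _)
  coeff-⊕ (x ∷ p) (y ∷ q) zero    = refl
  coeff-⊕ (x ∷ p) (y ∷ q) (suc i) = coeff-⊕ p q i

  coeff-neg : ∀ p i → coeff (neg p) i ≈ - coeff p i
  coeff-neg []      i       = sym -0#≈0#
  coeff-neg (x ∷ p) zero    = refl
  coeff-neg (x ∷ p) (suc i) = coeff-neg p i

  coeff-scale : ∀ x p i → coeff (scale x p) i ≈ x * coeff p i
  coeff-scale x []      i       = sym (zeroʳ x)
  coeff-scale x (y ∷ p) zero    = refl
  coeff-scale x (y ∷ p) (suc i) = coeff-scale x p i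

  coeff-⊛-zero : ∀ x p q → coeff ((x ∷ p) ⊛ q) 0 ≈ x * coeff q 0
  coeff-⊛-zero x p q = trans (coeff-⊕ (scale x q) _ 0)
    (trans (+-identityʳ _) (coeff-scale x q 0))

  coeff-⊛-suc : ∀ x p q i →
    coeff ((x ∷ p) ⊛ q) (suc i) ≈ x * coeff q (suc i) + coeff (p ⊛ q) i
  coeff-⊛-suc x p q i = trans (coeff-⊕ (scale x q) _ (suc i)) (+-congʳ (coeff-scale x q (suc i)))

  ≋-refl : ∀ {p} → p ≋ p
  ≋-refl .at i = refl

  ≋-sym : ∀ {p q} → p ≋ q → q ≋ p
  ≋-sym e .at i = sym (at e i)

  ≋-trans : ∀ {p q r} → p ≋ q → q ≋ r → p ≋ r
  ≋-trans e f .at i = trans (at e i) (at f i)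

  ∷-cong : ∀ {x y p q} → x ≈ y → p ≋ q → (x ∷ p) ≋ (y ∷ q)
  ∷-cong e f .at zero    = e
  ∷-cong e f .at (suc i) = at f i

  ∷-uncons : ∀ {x y p q} → (x ∷ p) ≋ (y ∷ q) → p ≋ q
  ∷-uncons e .at i = at e (suc i)

  ⊕-cong : ∀ {p p′ q q′} → p ≋ p′ → q ≋ q′ → p ⊕ q ≋ p′ ⊕ q′
  ⊕-cong {p} {p′} {q} {q′} e f .at i =
    trans (coeff-⊕ p q i) (trans (+-cong (at e i) (at f i)) (sym (coeff-⊕ p′ q′ i)))

  neg-cong : ∀ {p p′} → p ≋ p′ → neg p ≋ neg p′
  neg-cong {p} {p′} e .at i =
    trans (coeff-neg p i) (trans (-‿cong (at e i)) (sym (coeff-neg p′ i)))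

  scale-cong : ∀ {x y p q} → x ≈ y → p ≋ q → scale x p ≋ scale y q
  scale-cong {x} {y} {p} {q} e f .at i =
    trans (coeff-scale x p i) (trans (*-cong e (at f i)) (sym (coeff-scale y q i)))

  ⊕-assoc : ∀ p q r → (p ⊕ q) ⊕ r ≋ p ⊕ (q ⊕ r)
  ⊕-assoc p q r .at i = trans (coeff-⊕ (p ⊕ q) r i)
    (trans (+-congʳ (coeff-⊕ p q i))
    (trans (+-assoc _ _ _)
    (sym (trans (coeff-⊕ p (q ⊕ r) i) (+-congˡ (coeff-⊕ q r i))))))

  ⊕-comm : ∀ p q → p ⊕ q ≋ q ⊕ p
  ⊕-comm p q .at i = trans (coeff-⊕ p q i) (trans (+-comm _ _) (sym (coeff-⊕ q p i)))

  ⊕-identityʳ : ∀ p → p ⊕ [] ≋ p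
  ⊕-identityʳ p .at i = trans (coeff-⊕ p [] i) (+-identityʳ _)

  neg-inverseˡ : ∀ p → neg p ⊕ p ≋ []
  neg-inverseˡ p .at i = trans (coeff-⊕ (neg p) p i)
    (trans (+-congʳ (coeff-neg p i)) (-‿inverseˡ _))

  neg-inverseʳ : ∀ p → p ⊕ neg p ≋ []
  neg-inverseʳ p = ≋-trans (⊕-comm p (neg p)) (neg-inverseˡ p)

  ⊛-congˡ : ∀ p {q r} → q ≋ r → p ⊛ q ≋ p ⊛ r
  ⊛-congˡ []      e = ≋-refl
  ⊛-congˡ (x ∷ p) e = ⊕-cong (scale-cong refl e) (∷-cong refl (⊛-congˡ p e))

  ⊛-zeroʳ : ∀ p → p ⊛ [] ≋ []
  ⊛-zeroʳ []      = ≋-refl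
  ⊛-zeroʳ (x ∷ p) .at zero    = refl
  ⊛-zeroʳ (x ∷ p) .at (suc i) = at (⊛-zeroʳ p) i

  ⊛-distribˡ : ∀ p q r → p ⊛ (q ⊕ r) ≋ p ⊛ q ⊕ p ⊛ r
  ⊛-distribˡ [] q r = ≋-refl
  ⊛-distribˡ (x ∷ p) q r .at zero =
    trans (coeff-⊛-zero x p (q ⊕ r))
    (trans (*-congˡ (coeff-⊕ q r 0))
    (trans (distribˡ _ _ _)
    (sym (trans (coeff-⊕ ((x ∷ p) ⊛ q) _ 0)
      (+-cong (coeff-⊛-zero x p q) (coeff-⊛-zero x p r))))))
  ⊛-distribˡ (x ∷ p) q r .at (suc i) =
    trans (coeff-⊛-suc x p (q ⊕ r) i)
    (trans (+-cong (*-congˡ (coeff-⊕ q r (suc i)))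
             (trans (at (⊛-distribˡ p q r) i) (coeff-⊕ (p ⊛ q) _ i)))
    (trans (solve 5 (λ x q r u v → x :* (q :+ r) :+ (u :+ v) := (x :* q :+ u) :+ (x :* r :+ v))
             refl x (coeff q (suc i)) (coeff r (suc i)) (coeff (p ⊛ q) i) (coeff (p ⊛ r) i))
    (sym (trans (coeff-⊕ ((x ∷ p) ⊛ q) _ (suc i))
      (+-cong (coeff-⊛-suc x p q i) (coeff-⊛-suc x p r i))))))

  private
    ⊛-∷ʳ-zero : ∀ p y q → coeff (p ⊛ (y ∷ q)) 0 ≈ y * coeff p 0
    ⊛-∷ʳ-zero []      y q = sym (zeroʳ y)
    ⊛-∷ʳ-zero (x ∷ p) y q = trans (coeff-⊛-zero x p (y ∷ q)) (*-comm x y)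

    ⊛-∷ʳ-suc : ∀ p y q i →
      coeff (p ⊛ (y ∷ q)) (suc i) ≈ y * coeff p (suc i) + coeff (p ⊛ q) i
    ⊛-∷ʳ-suc []      y q i       = sym (trans (+-identityʳ _) (zeroʳ y))
    ⊛-∷ʳ-suc (x ∷ p) y q zero    =
      trans (coeff-⊛-suc x p (y ∷ q) 0)
      (trans (+-congˡ (⊛-∷ʳ-zero p y q))
      (trans (+-comm _ _) (+-congˡ (sym (coeff-⊛-zero x p q)))))
    ⊛-∷ʳ-suc (x ∷ p) y q (suc i) =
      trans (coeff-⊛-suc x p (y ∷ q) (suc i))
      (trans (+-congˡ (⊛-∷ʳ-suc p y q i))
      (trans (solve 3 (λ u v w → u :+ (v :+ w) := v :+ (u :+ w)) refl _ _ _)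
      (+-congˡ (sym (coeff-⊛-suc x p q i)))))

  ⊛-comm : ∀ p q → p ⊛ q ≋ q ⊛ p
  ⊛-comm p []      = ⊛-zeroʳ p
  ⊛-comm p (y ∷ q) .at zero    = trans (⊛-∷ʳ-zero p y q) (sym (coeff-⊛-zero y q p))
  ⊛-comm p (y ∷ q) .at (suc i) = trans (⊛-∷ʳ-suc p y q i)
    (trans (+-congˡ (at (⊛-comm p q) i)) (sym (coeff-⊛-suc y q p i)))

  ⊛-cong : ∀ {p p′ q q′} → p ≋ p′ → q ≋ q′ → p ⊛ q ≋ p′ ⊛ q′
  ⊛-cong {p} {p′} {q} {q′} e f =
    ≋-trans (⊛-congˡ p f) (≋-trans (⊛-comm p q′) (≋-trans (⊛-congˡ q′ e) (⊛-comm q′ p′)))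

  ⊛-distribʳ : ∀ r p q → (p ⊕ q) ⊛ r ≋ p ⊛ r ⊕ q ⊛ r
  ⊛-distribʳ r p q = ≋-trans (⊛-comm (p ⊕ q) r) (≋-trans (⊛-distribˡ r p q)
    (⊕-cong (⊛-comm r p) (⊛-comm r q)))

  scale-⊛ : ∀ x p q → scale x p ⊛ q ≋ scale x (p ⊛ q)
  scale-⊛ x []      q = ≋-refl
  scale-⊛ x (y ∷ p) q .at zero =
    trans (coeff-⊛-zero (x * y) (scale x p) q) (trans (*-assoc x y _)
    (sym (trans (coeff-scale x ((y ∷ p) ⊛ q) 0) (*-congˡ (coeff-⊛-zero y p q)))))
  scale-⊛ x (y ∷ p) q .at (suc i) =
    trans (coeff-⊛-suc (x * y) (scale x p) q i)
    (trans (+-cong (*-assoc x y _) (trans (at (scale-⊛ x p q) i) (coeff-scale x (p ⊛ q) i)))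
    (trans (sym (distribˡ _ _ _))
    (sym (trans (coeff-scale x ((y ∷ p) ⊛ q) (suc i)) (*-congˡ (coeff-⊛-suc y p q i))))))

  0∷-⊛ : ∀ p q → (0# ∷ p) ⊛ q ≋ (0# ∷ p ⊛ q)
  0∷-⊛ p q .at zero    = trans (coeff-⊛-zero 0# p q) (zeroˡ _)
  0∷-⊛ p q .at (suc i) = trans (coeff-⊛-suc 0# p q i)
    (trans (+-congʳ (zeroˡ _)) (+-identityˡ _))

  ⊛-assoc : ∀ p q r → (p ⊛ q) ⊛ r ≋ p ⊛ (q ⊛ r)
  ⊛-assoc []      q r = ≋-refl
  ⊛-assoc (x ∷ p) q r = ≋-trans (⊛-distribʳ r (scale x q) _)
    (⊕-cong (scale-⊛ x q r) (≋-trans (0∷-⊛ (p ⊛ q) r) (∷-cong refl (⊛-assoc p q r))))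

  ⊛-identityˡ : ∀ p → (1# ∷ []) ⊛ p ≋ p
  ⊛-identityˡ p .at zero    = trans (coeff-⊛-zero 1# [] p) (*-identityˡ _)
  ⊛-identityˡ p .at (suc i) = trans (coeff-⊛-suc 1# [] p i)
    (trans (+-identityʳ _) (*-identityˡ _))

  polyRing : CommutativeRing c ℓ
  polyRing = record
    { Carrier = Poly
    ; _≈_ = _≋_
    ; _+_ = _⊕_
    ; _*_ = _⊛_
    ; -_  = neg
    ; 0#  = []
    ; 1#  = 1# ∷ []
    ; isCommutativeRing = record
      { isRing = record
        { +-isAbelianGroup = record
          { isGroup = record
            { isMonoid = record
              { isSemigroup = record
                { isMagma = record
                  { isEquivalence = record { refl = ≋-refl ; sym = ≋-sym ; trans = ≋-trans }
                  ; ∙-cong = ⊕-cong }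
                ; assoc = ⊕-assoc }
              ; identity = (λ p → ≋-refl) , ⊕-identityʳ }
            ; inverse = neg-inverseˡ , neg-inverseʳ
            ; ⁻¹-cong = neg-cong }
          ; comm = ⊕-comm }
        ; *-cong = ⊛-cong
        ; *-assoc = ⊛-assoc
        ; *-identity = ⊛-identityˡ , λ p → ≋-trans (⊛-comm p _) (⊛-identityˡ p)
        ; distrib = ⊛-distribˡ , ⊛-distribʳ }
      ; *-comm = ⊛-comm }
    }

  eval : Carrier → Poly → Carrier
  eval x []      = 0#
  eval x (y ∷ p) = y + x * eval x p

  -- Σ sᵢ xᵈ⁻ⁱ
  hornerPoly : (ℕ → Carrier) → ℕ → Poly
  hornerPoly s zero    = s 0 ∷ []
  hornerPoly s (suc d) = s (suc d) ∷ hornerPoly s d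

  private
    eval-≋[] : ∀ x p → p ≋ [] → eval x p ≈ 0#
    eval-≋[] x []      e = refl
    eval-≋[] x (y ∷ p) e = trans (+-cong (at e 0) (*-congˡ (eval-≋[] x p (coeffwise λ i → at e (suc i)))))
      (trans (+-identityˡ _) (zeroʳ x))

  eval-cong : ∀ {x y p q} → x ≈ y → p ≋ q → eval x p ≈ eval y q
  eval-cong {p = []}    {[]}    f e = refl
  eval-cong {p = []}    {_ ∷ _} f e = sym (eval-≋[] _ (_ ∷ _) (≋-sym e))
  eval-cong {p = _ ∷ _} {[]}    f e = eval-≋[] _ (_ ∷ _) e
  eval-cong {p = _ ∷ _} {_ ∷ _} f e = +-cong (at e 0) (*-cong f (eval-cong f (∷-uncons e)))

  eval-⊕ : ∀ x p q → eval x (p ⊕ q) ≈ eval x p + eval x q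
  eval-⊕ x []      q       = sym (+-identityˡ _)
  eval-⊕ x (y ∷ p) []      = sym (+-identityʳ _)
  eval-⊕ x (y ∷ p) (z ∷ q) = trans (+-congˡ (*-congˡ (eval-⊕ x p q)))
    (solve 5 (λ x y z p q → (y :+ z) :+ x :* (p :+ q) := (y :+ x :* p) :+ (z :+ x :* q))
      refl x y z _ _)

  eval-scale : ∀ x y p → eval x (scale y p) ≈ y * eval x p
  eval-scale x y []      = sym (zeroʳ y)
  eval-scale x y (z ∷ p) = trans (+-congˡ (*-congˡ (eval-scale x y p)))
    (solve 4 (λ x y z p → y :* z :+ x :* (y :* p) := y :* (z :+ x :* p)) refl x y z _)

  eval-⊛ : ∀ x p q → eval x (p ⊛ q) ≈ eval x p * eval x q
  eval-⊛ x []      q = sym (zeroˡ _)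
  eval-⊛ x (y ∷ p) q = trans (eval-⊕ x (scale y q) _)
    (trans (+-cong (eval-scale x y q) (trans (+-identityˡ _) (*-congˡ (eval-⊛ x p q))))
    (solve 4 (λ x y p q → y :* q :+ x :* (p :* q) := (y :+ x :* p) :* q) refl x y _ _))

  evalʰ : Carrier → Hom polyRing A
  evalʰ x = record
    { fun = eval x ; cong = eval-cong refl ; +-homo = eval-⊕ x ; *-homo = eval-⊛ x
    ; 0-homo = refl ; 1-homo = trans (+-congˡ (zeroʳ x)) (+-identityʳ _) }

  constʰ : Hom A polyRing
  constʰ = record
    { fun = λ x → x ∷ []
    ; cong = λ e → ∷-cong e ≋-refl
    ; +-homo = λ _ _ → ≋-refl
    ; *-homo = λ x y → ≋-sym (⊕-identityʳ′ (x * y))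
    ; 0-homo = 0∷[]
    ; 1-homo = ≋-refl }
    where
    0∷[] : 0# ∷ [] ≋ []
    0∷[] .at zero    = refl
    0∷[] .at (suc i) = refl
    ⊕-identityʳ′ : ∀ x → (x + 0#) ∷ [] ≋ x ∷ []
    ⊕-identityʳ′ x .at zero    = +-identityʳ x
    ⊕-identityʳ′ x .at (suc i) = refl

module _ {A : CommutativeRing a ℓ₁} {B : CommutativeRing b ℓ₂} (φ : Hom A B) where
  private
    module A = CommutativeRing A
    module B = CommutativeRing B
    module PA = Polynomials A
    module PB = Polynomials B
    open Hom φ

  coeff-map : ∀ p i → fun (PA.coeff p i) B.≈ PB.coeff (List.map fun p) i
  coeff-map []      i       = 0-homo
  coeff-map (x ∷ p) zero    = B.refl
  coeff-map (x ∷ p) (suc i) = coeff-map p i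

  private
    map-⊕ : ∀ p q → List.map fun (p PA.⊕ q) PB.≋ List.map fun p PB.⊕ List.map fun q
    map-⊕ []      q       = PB.≋-refl
    map-⊕ (x ∷ p) []      = PB.≋-refl
    map-⊕ (x ∷ p) (y ∷ q) = PB.∷-cong (+-homo x y) (map-⊕ p q)

    map-scale : ∀ x p → List.map fun (PA.scale x p) PB.≋ PB.scale (fun x) (List.map fun p)
    map-scale x []      = PB.≋-refl
    map-scale x (y ∷ p) = PB.∷-cong (*-homo x y) (map-scale x p)

    map-⊛ : ∀ p q → List.map fun (p PA.⊛ q) PB.≋ List.map fun p PB.⊛ List.map fun q
    map-⊛ []      q = PB.≋-refl
    map-⊛ (x ∷ p) q = PB.≋-trans (map-⊕ (PA.scale x q) _)
      (PB.⊕-cong (map-scale x q) (PB.∷-cong 0-homo (map-⊛ p q)))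

  polyʰ : Hom PA.polyRing PB.polyRing
  polyʰ = record
    { fun = List.map fun
    ; cong = λ {p} {q} e → PB.coeffwise λ i →
        B.trans (B.sym (coeff-map p i)) (B.trans (cong (PA.at e i)) (coeff-map q i))
    ; +-homo = map-⊕ ; *-homo = map-⊛
    ; 0-homo = PB.≋-refl ; 1-homo = PB.∷-cong 1-homo PB.≋-refl }

-- The quotient A/(d) is A itself with a coarser equality.
module Quotient (A : CommutativeRing c ℓ) (d : CommutativeRing.Carrier A) where
  open CommutativeRing A
  open Solver A

  infix 4 _≡ₘ_
  record _≡ₘ_ (x y : Carrier) : Set (c ⊔ ℓ) where
    constructor differBy
    field
      quotient : Carrier
      equality : x ≈ y + d * quotient

  ≈⇒≡ₘ : ∀ {x y} → x ≈ y → x ≡ₘ y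
  ≈⇒≡ₘ e = differBy 0# (trans e (sym (trans (+-congˡ (zeroʳ d)) (+-identityʳ _))))

  private
    ≡ₘ-sym : ∀ {x y} → x ≡ₘ y → y ≡ₘ x
    ≡ₘ-sym {x} {y} (differBy q e) = differBy (- q) (trans
      (solve 3 (λ y d q → y := (y :+ d :* q) :+ d :* (:- q)) refl y d q) (+-congʳ (sym e)))

    ≡ₘ-trans : ∀ {x y z} → x ≡ₘ y → y ≡ₘ z → x ≡ₘ z
    ≡ₘ-trans {x} {y} {z} (differBy q e) (differBy r f) = differBy (r + q) (trans e (trans (+-congʳ f)
      (solve 4 (λ z d q r → (z :+ d :* r) :+ d :* q := z :+ d :* (r :+ q)) refl z d q r)))

    ≡ₘ-+ : ∀ {x x′ y y′} → x ≡ₘ x′ → y ≡ₘ y′ → x + y ≡ₘ x′ + y′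
    ≡ₘ-+ {x} {x′} {y} {y′} (differBy q e) (differBy r f) = differBy (q + r) (trans (+-cong e f)
      (solve 5 (λ x y d q r → (x :+ d :* q) :+ (y :+ d :* r) := (x :+ y) :+ d :* (q :+ r))
        refl x′ y′ d q r))

    ≡ₘ-* : ∀ {x x′ y y′} → x ≡ₘ x′ → y ≡ₘ y′ → x * y ≡ₘ x′ * y′
    ≡ₘ-* {x} {x′} {y} {y′} (differBy q e) (differBy r f) =
      differBy (x′ * r + q * y′ + q * (d * r)) (trans (*-cong e f)
      (solve 5 (λ x y d q r → (x :+ d :* q) :* (y :+ d :* r)
                 := x :* y :+ d :* (x :* r :+ q :* y :+ q :* (d :* r)))
        refl x′ y′ d q r))

    ≡ₘ-neg : ∀ {x y} → x ≡ₘ y → - x ≡ₘ - y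
    ≡ₘ-neg {x} {y} (differBy q e) = differBy (- q) (trans (-‿cong e)
      (solve 3 (λ y d q → :- (y :+ d :* q) := (:- y) :+ d :* (:- q)) refl y d q))

  quotientRing : CommutativeRing c (c ⊔ ℓ)
  quotientRing = record
    { Carrier = Carrier
    ; _≈_ = _≡ₘ_
    ; _+_ = _+_ ; _*_ = _*_ ; -_  = -_ ; 0#  = 0# ; 1#  = 1#
    ; isCommutativeRing = record
      { isRing = record
        { +-isAbelianGroup = record
          { isGroup = record
            { isMonoid = record
              { isSemigroup = record
                { isMagma = record
                  { isEquivalence = record { refl = ≈⇒≡ₘ refl ; sym = ≡ₘ-sym ; trans = ≡ₘ-trans }
                  ; ∙-cong = ≡ₘ-+ }
                ; assoc = λ x y z → ≈⇒≡ₘ (+-assoc x y z) }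
              ; identity = (λ x → ≈⇒≡ₘ (+-identityˡ x)) , (λ x → ≈⇒≡ₘ (+-identityʳ x)) }
            ; inverse = (λ x → ≈⇒≡ₘ (-‿inverseˡ x)) , (λ x → ≈⇒≡ₘ (-‿inverseʳ x))
            ; ⁻¹-cong = ≡ₘ-neg }
          ; comm = λ x y → ≈⇒≡ₘ (+-comm x y) }
        ; *-cong = ≡ₘ-*
        ; *-assoc = λ x y z → ≈⇒≡ₘ (*-assoc x y z)
        ; *-identity = (λ x → ≈⇒≡ₘ (*-identityˡ x)) , (λ x → ≈⇒≡ₘ (*-identityʳ x))
        ; distrib = (λ x y z → ≈⇒≡ₘ (distribˡ x y z)) , (λ x y z → ≈⇒≡ₘ (distribʳ x y z)) }
      ; *-comm = λ x y → ≈⇒≡ₘ (*-comm x y) }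
    }

  projectʰ : Hom A quotientRing
  projectʰ = record
    { fun = λ x → x ; cong = ≈⇒≡ₘ
    ; +-homo = λ _ _ → ≈⇒≡ₘ refl ; *-homo = λ _ _ → ≈⇒≡ₘ refl
    ; 0-homo = ≈⇒≡ₘ refl ; 1-homo = ≈⇒≡ₘ refl }

  d≡ₘ0 : d ≡ₘ 0#
  d≡ₘ0 = differBy 1# (sym (trans (+-identityˡ _) (*-identityʳ d)))

-- Series attached to lists of roots.

module Series (A : CommutativeRing c ℓ) where
  open CommutativeRing A
  open Solver A
  open RingProperties ring using (-0#≈0#)

  infix 4 _≗_
  _≗_ : {I : Set} → (I → Carrier) → (I → Carrier) → Set ℓ
  u ≗ v = ∀ i → u i ≈ v i

  δ : ℕ → Carrier
  δ zero    = 1#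
  δ (suc i) = 0#

  -- Multiplication by 1 - x t. With this factor instead of t - x, the constant coefficient stays 1
  -- and coefficients are indexed without reference to the number of roots.
  lin : Carrier → (ℕ → Carrier) → ℕ → Carrier
  lin x m zero    = m 0
  lin x m (suc i) = m (suc i) - x * m i

  -- The coefficients of ∏ (1 - x t) over the entries x of the list.
  series : List Carrier → ℕ → Carrier
  series []      = δ
  series (x ∷ L) = lin x (series L)

  lin-cong : ∀ {x y m m′} → x ≈ y → m ≗ m′ → lin x m ≗ lin y m′
  lin-cong f e zero    = e 0
  lin-cong f e (suc i) = +-cong (e (suc i)) (-‿cong (*-cong f (e i)))

  lin-comm : ∀ x y m → lin x (lin y m) ≗ lin y (lin x m)
  lin-comm x y m zero          = refl
  lin-comm x y m (suc zero)    =
    solve 4 (λ x y u v → (u :- y :* v) :- x :* v := (u :- x :* v) :- y :* v) refl x y _ _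
  lin-comm x y m (suc (suc i)) =
    solve 5 (λ x y u v w → (u :- y :* v) :- x :* (v :- y :* w)
                        := (u :- x :* v) :- y :* (v :- x :* w)) refl x y _ _ _

  series-0 : ∀ L → series L 0 ≈ 1#
  series-0 []      = refl
  series-0 (x ∷ L) = series-0 L

  series-> : ∀ L i → List.length L < i → series L i ≈ 0#
  series-> []      (suc i) _         = refl
  series-> (x ∷ L) (suc i) (s≤s d<i) = trans
    (+-cong (series-> L (suc i) (ℕ.m<n⇒m<1+n d<i)) (-‿cong (trans (*-congˡ (series-> L i d<i)) (zeroʳ x))))
    (trans (+-identityˡ _) -0#≈0#)

-- The endomorphism X of the sequences is multiplication by y on A[y]/(f), where
-- f(y) = Σ cᵢ yᵈ⁻ⁱ and yᵏ is represented by tᵈ⁻¹⁻ᵏ.  In terms of power series,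
-- X v = (v - v₀ c)/t, which no longer mentions d.
module Resultant (A : CommutativeRing c ℓ) where
  open CommutativeRing A
  open Series A
  open Polynomials A

  Seq : Set c
  Seq = ℕ → Carrier

  X : Seq → Seq → Seq
  X c v i = v (suc i) - v 0 * c (suc i)

  act : Seq → Poly → Seq → Seq
  act c []      v i = 0#
  act c (x ∷ g) v i = x * v i + act c g (X c v) i

  -- The exterior algebra on n generators, with coordinates indexed by subsets.
  Λ : ℕ → Set c
  Λ n = Vec Bool n → Carrier

  unit : ∀ {n} → Λ n
  unit []          = 1#
  unit (true  ∷ S) = 0#
  unit (false ∷ S) = unit S

  -- Left multiplication by v; the head of a subset refers to the last coordinate.
  wedge : ∀ {n} → Seq → Λ n → Λ n
  wedge         v x []          = 0#
  wedge         v x (false ∷ S) = wedge v (λ T → x (false ∷ T)) S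
  wedge {suc n} v x (true ∷ S)  = v n * x (false ∷ S) - wedge v (λ T → x (true ∷ T)) S

  -- The number `k` of vectors is independent of the number `n` of coordinates, since expansion
  -- along the last coordinate of a determinant leaves n vectors with n + 1 coordinates.
  krylov : ∀ {n} → Seq → Poly → ℕ → Seq → Λ n
  krylov c g zero    v = unit
  krylov c g (suc k) v = wedge (act c g v) (krylov c g k (X c v))

  shift : ℕ → Seq → Seq
  shift zero    m i       = m i
  shift (suc k) m zero    = 0#
  shift (suc k) m (suc i) = shift k m i

  -- The monomial tᵈ⁻¹, which represents 1 in A[y]/(f) and from which X generates the standard
  -- basis. In degree 0 the algebra is zero.
  initial : ℕ → Seq
  initial zero    = λ _ → 0#
  initial (suc k) = shift k δ

  full : ∀ n → Vec Bool n
  full n = Vec.replicate n true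

  -- The determinant of g(X): the wedge of g(X)Xᵏw over k < d, where w, Xw, …, Xᵈ⁻¹w
  -- is the standard basis.
  res : ℕ → Seq → Poly → Carrier
  res d c g = krylov c g d (initial d) (full d)

-- Compatibility of the determinant with homomorphisms.

module _ {A : CommutativeRing a ℓ₁} {B : CommutativeRing b ℓ₂} (φ : Hom A B) where
  private
    module A = CommutativeRing A
    module B = CommutativeRing B
    module PA = Polynomials A
    module PB = Polynomials B
    module SA = Series A
    module SB = Series B
    module RA = Resultant A
    module RB = Resultant B
    open Hom φ

  _~_ : {I : Set} → (I → A.Carrier) → (I → B.Carrier) → Set ℓ₂
  u ~ v = ∀ i → fun (u i) B.≈ v i

  δ~ : SA.δ ~ SB.δ
  δ~ zero    = 1-homo
  δ~ (suc i) = 0-homo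

  series~ : ∀ L → SA.series L ~ SB.series (List.map fun L)
  series~ []      i       = δ~ i
  series~ (x ∷ L) zero    = series~ L 0
  series~ (x ∷ L) (suc i) = B.trans (sub-homo _ _)
    (B.+-cong (series~ L (suc i)) (B.-‿cong (B.trans (*-homo _ _) (B.*-congˡ (series~ L i)))))

  private
    X~ : ∀ {c c′ v v′} → c ~ c′ → v ~ v′ → RA.X c v ~ RB.X c′ v′
    X~ γ ε i = B.trans (sub-homo _ _) (B.+-cong (ε (suc i))
      (B.-‿cong (B.trans (*-homo _ _) (B.*-cong (ε 0) (γ (suc i))))))

    act~ : ∀ {c c′ v v′} g g′ → c ~ c′ → (PA.coeff g) ~ (PB.coeff g′) → v ~ v′ →
           RA.act c g v ~ RB.act c′ g′ v′
    act~ []      []        γ η ε i = 0-homo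
    act~ []      (y ∷ g′) γ η ε i = B.sym (B.trans
      (B.+-cong (B.trans (B.*-congʳ (B.trans (B.sym (η 0)) 0-homo)) (B.zeroˡ _))
        (B.sym (act~ [] g′ γ (λ j → η (suc j)) (X~ γ ε) i)))
      (B.+-identityˡ _))
    act~ (x ∷ g) []        γ η ε i = B.trans (+-homo _ _) (B.trans
      (B.+-cong (B.trans (*-homo _ _) (B.trans (B.*-congʳ (η 0)) (B.zeroˡ _)))
        (act~ g [] γ (λ j → η (suc j)) (X~ γ ε) i))
      (B.+-identityˡ _))
    act~ (x ∷ g) (y ∷ g′) γ η ε i = B.trans (+-homo _ _)
      (B.+-cong (B.trans (*-homo _ _) (B.*-cong (η 0) (ε i)))
        (act~ g g′ γ (λ j → η (suc j)) (X~ γ ε) i))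

    wedge~ : ∀ {n v v′} {x : RA.Λ n} {x′ : RB.Λ n} → v ~ v′ → x ~ x′ → RA.wedge v x ~ RB.wedge v′ x′
    wedge~         ε ξ []          = 0-homo
    wedge~         ε ξ (false ∷ S) = wedge~ ε (λ T → ξ (false ∷ T)) S
    wedge~ {suc n} ε ξ (true ∷ S)  = B.trans (sub-homo _ _) (B.+-cong
      (B.trans (*-homo _ _) (B.*-cong (ε n) (ξ (false ∷ S))))
      (B.-‿cong (wedge~ ε (λ T → ξ (true ∷ T)) S)))

    unit~ : ∀ {n} → RA.unit {n} ~ RB.unit
    unit~ []          = 1-homo
    unit~ (true ∷ S)  = 0-homo
    unit~ (false ∷ S) = unit~ S

    krylov~ : ∀ {n c c′ v v′} g g′ k → c ~ c′ → (PA.coeff g) ~ (PB.coeff g′) → v ~ v′ →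
              RA.krylov {n} c g k v ~ RB.krylov c′ g′ k v′
    krylov~ g g′ zero    γ η ε = unit~
    krylov~ g g′ (suc k) γ η ε = wedge~ (act~ g g′ γ η ε) (krylov~ g g′ k γ η (X~ γ ε))

    shift~ : ∀ {m m′} k → m ~ m′ → RA.shift k m ~ RB.shift k m′
    shift~ zero    ε i       = ε i
    shift~ (suc k) ε zero    = 0-homo
    shift~ (suc k) ε (suc i) = shift~ k ε i

    initial~ : ∀ k → RA.initial k ~ RB.initial k
    initial~ zero    i = 0-homo
    initial~ (suc k) i = shift~ k δ~ i

  -- `res` is built from ring operations alone. The condition on `g` and `g′` concerns coefficients,
  -- so lists of different lengths may be compared. When φ is the projection to a quotient, the
  -- lemma says that `res` respects congruences.
  res~ : ∀ d {c c′} g g′ → c ~ c′ → (PA.coeff g) ~ (PB.coeff g′) →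
         fun (RA.res d c g) B.≈ RB.res d c′ g′
  res~ d g g′ γ η = krylov~ g g′ d γ η (initial~ d) (RA.full d)

-- The determinant as a product over the roots.

module _ (A : CommutativeRing c ℓ) where
  open CommutativeRing A
  open Solver A
  open Series A
  open Polynomials A
  open Resultant A
  open RingProperties ring using (-0#≈0#)
  open SetoidReasoning setoid

  private
    X-lin : ∀ c s v w → X c (λ i → s * v i + w i) ≗ λ i → s * X c v i + X c w i
    X-lin c s v w i = solve 6
      (λ s v₁ w₁ v₀ w₀ c → (s :* v₁ :+ w₁) :- (s :* v₀ :+ w₀) :* c
                        := s :* (v₁ :- v₀ :* c) :+ (w₁ :- w₀ :* c))
      refl s (v (suc i)) (w (suc i)) (v 0) (w 0) (c (suc i))

    X-cong : ∀ c {v w} → v ≗ w → X c v ≗ X c w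
    X-cong c e i = +-cong (e (suc i)) (-‿cong (*-congʳ (e 0)))

    act-cong : ∀ {c} g {v w} → v ≗ w → act c g v ≗ act c g w
    act-cong []      e i = refl
    act-cong {c} (x ∷ g) e i = +-cong (*-congˡ (e i)) (act-cong g (X-cong c e) i)

    act-lin : ∀ c g s v w → act c g (λ i → s * v i + w i) ≗ λ i → s * act c g v i + act c g w i
    act-lin c []      s v w i = sym (trans (+-identityʳ _) (zeroʳ s))
    act-lin c (x ∷ g) s v w i = trans
      (+-congˡ (trans (act-cong g (X-lin c s v w) i) (act-lin c g s (X c v) (X c w) i)))
      (solve 6 (λ x s v w p q → x :* (s :* v :+ w) :+ (s :* p :+ q)
                             := s :* (x :* v :+ p) :+ (x :* w :+ q))
        refl x s (v i) (w i) _ _)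

    act-zero : ∀ c g {v} → v ≗ (λ _ → 0#) → act c g v ≗ λ _ → 0#
    act-zero c []      e i = refl
    act-zero c (x ∷ g) e i = trans (+-cong (trans (*-congˡ (e i)) (zeroʳ x))
      (act-zero c g (λ j → trans (X-cong c e j)
        (trans (+-identityˡ _) (trans (-‿cong (zeroˡ _)) -0#≈0#))) i)) (+-identityˡ _)

    wedge-cong : ∀ {n v w} {x y : Λ n} → v ≗ w → x ≗ y → wedge v x ≗ wedge w y
    wedge-cong         e f []          = refl
    wedge-cong         e f (false ∷ S) = wedge-cong e (λ T → f (false ∷ T)) S
    wedge-cong {suc n} e f (true ∷ S)  =
      +-cong (*-cong (e n) (f (false ∷ S))) (-‿cong (wedge-cong e (λ T → f (true ∷ T)) S))

    wedge-linˡ : ∀ {n} s v w (x : Λ n) →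
      wedge (λ i → s * v i + w i) x ≗ λ S → s * wedge v x S + wedge w x S
    wedge-linˡ         s v w x []          = sym (trans (+-identityʳ _) (zeroʳ s))
    wedge-linˡ         s v w x (false ∷ S) = wedge-linˡ s v w _ S
    wedge-linˡ {suc n} s v w x (true ∷ S)  = trans (+-congˡ (-‿cong (wedge-linˡ s v w _ S)))
      (solve 6 (λ s v w x p q → (s :* v :+ w) :* x :- (s :* p :+ q)
                             := s :* (v :* x :- p) :+ (w :* x :- q)) refl s (v n) (w n) _ _ _)

    wedge-linʳ : ∀ {n} v s (x y : Λ n) →
      wedge v (λ S → s * x S + y S) ≗ λ S → s * wedge v x S + wedge v y S
    wedge-linʳ         v s x y []          = sym (trans (+-identityʳ _) (zeroʳ s))
    wedge-linʳ         v s x y (false ∷ S) = wedge-linʳ v s _ _ S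
    wedge-linʳ {suc n} v s x y (true ∷ S)  = trans (+-congˡ (-‿cong (wedge-linʳ v s _ _ S)))
      (solve 6 (λ s v x y p q → v :* (s :* x :+ y) :- (s :* p :+ q)
                             := s :* (v :* x :- p) :+ (v :* y :- q)) refl s (v n) _ _ _ _)

    wedge-neg : ∀ {n} v (x : Λ n) → wedge v (λ S → - x S) ≗ λ S → - wedge v x S
    wedge-neg         v x []          = sym -0#≈0#
    wedge-neg         v x (false ∷ S) = wedge-neg v _ S
    wedge-neg {suc n} v x (true ∷ S)  = trans (+-congˡ (-‿cong (wedge-neg v _ S)))
      (solve 3 (λ v x p → v :* (:- x) :- (:- p) := :- (v :* x :- p)) refl (v n) _ _)

    wedge-zeroˡ : ∀ {n v} (x : Λ n) → v ≗ (λ _ → 0#) → wedge v x ≗ λ _ → 0#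
    wedge-zeroˡ         x e []          = refl
    wedge-zeroˡ         x e (false ∷ S) = wedge-zeroˡ _ e S
    wedge-zeroˡ {suc n} x e (true ∷ S)  = trans
      (+-cong (trans (*-congʳ (e n)) (zeroˡ _)) (-‿cong (wedge-zeroˡ _ e S)))
      (trans (+-identityˡ _) -0#≈0#)

    wedge-zeroʳ : ∀ {n} v {x : Λ n} → x ≗ (λ _ → 0#) → wedge v x ≗ λ _ → 0#
    wedge-zeroʳ         v e []          = refl
    wedge-zeroʳ         v e (false ∷ S) = wedge-zeroʳ v (λ T → e (false ∷ T)) S
    wedge-zeroʳ {suc n} v e (true ∷ S)  = trans
      (+-cong (trans (*-congˡ (e (false ∷ S))) (zeroʳ _)) (-‿cong (wedge-zeroʳ v (λ T → e (true ∷ T)) S)))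
      (trans (+-identityˡ _) -0#≈0#)

    wedge-scaleʳ : ∀ {n} v s (x : Λ n) → wedge v (λ S → s * x S) ≗ λ S → s * wedge v x S
    wedge-scaleʳ v s x S = begin
      wedge v (λ T → s * x T) S                   ≈⟨ wedge-cong (λ _ → refl) (λ T → sym (+-identityʳ _)) S ⟩
      wedge v (λ T → s * x T + 0#) S              ≈⟨ wedge-linʳ v s x (λ _ → 0#) S ⟩
      s * wedge v x S + wedge v (λ _ → 0#) S      ≈⟨ +-congˡ (wedge-zeroʳ v (λ _ → refl) S) ⟩
      s * wedge v x S + 0#                        ≈⟨ +-identityʳ _ ⟩
      s * wedge v x S                             ∎

    wedge-subʳ : ∀ {n} v s (x y : Λ n) →
      wedge v (λ S → s * x S - y S) ≗ λ S → s * wedge v x S - wedge v y S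
    wedge-subʳ v s x y S = trans (wedge-linʳ v s x (λ T → - y T) S) (+-congˡ (wedge-neg v y S))

    wedge-square : ∀ {n} v (x : Λ n) → wedge v (wedge v x) ≗ λ _ → 0#
    wedge-square         v x []          = refl
    wedge-square         v x (false ∷ S) = wedge-square v _ S
    wedge-square {suc n} v x (true ∷ S)  = trans
      (+-congˡ (-‿cong (trans (wedge-subʳ v (v n) _ _ S) (+-congˡ (-‿cong (wedge-square v _ S))))))
      (solve 1 (λ p → p :- (p :- con (+ 0)) := con (+ 0)) refl _)

    wedge-anticomm : ∀ {n} v w (x : Λ n) → wedge v (wedge w x) ≗ λ S → - wedge w (wedge v x) S
    wedge-anticomm         v w x []          = sym -0#≈0#
    wedge-anticomm         v w x (false ∷ S) = wedge-anticomm v w _ S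
    wedge-anticomm {suc n} v w x (true ∷ S)  = trans
      (+-congˡ (-‿cong (trans (wedge-subʳ v (w n) _ _ S) (+-congˡ (-‿cong (wedge-anticomm v w _ S))))))
      (trans (solve 5 (λ v w p q r → v :* p :- (w :* q :- (:- r)) := :- (w :* q :- (v :* p :- r)))
          refl (v n) (w n) _ _ _)
        (sym (-‿cong (+-congˡ (-‿cong (wedge-subʳ w (v n) _ _ S))))))

    wedge-anticomm-zero : ∀ {n} v w {x : Λ n} → wedge w x ≗ (λ _ → 0#) → wedge w (wedge v x) ≗ λ _ → 0#
    wedge-anticomm-zero v w e S = trans (wedge-anticomm w v _ S)
      (trans (-‿cong (wedge-zeroʳ v e S)) -0#≈0#)

    krylov-cong : ∀ {n c} g k {v w} → v ≗ w → krylov {n} c g k v ≗ krylov c g k w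
    krylov-cong g zero    e S = refl
    krylov-cong {c = c} g (suc k) e S = wedge-cong (act-cong g e) (krylov-cong g k (X-cong c e)) S

  module _ (c : Seq) where
    private
      -- The operator X - x, in the form s v + w to which the linearity lemmas apply.
      Y : Carrier → Seq → Seq
      Y x v i = - x * v i + X c v i

      X-Y : ∀ x v → X c v ≗ λ i → x * v i + Y x v i
      X-Y x v i = solve 3 (λ x v w → w := x :* v :+ (:- x :* v :+ w)) refl x (v i) (X c v i)

      act-X : ∀ g x v → act c g (X c v) ≗ λ i → x * act c g v i + act c g (Y x v) i
      act-X g x v i = trans (act-cong g (X-Y x v) i) (act-lin c g x v (Y x v) i)

      -- The wedge of g(X) applied to v, (X - x₁)v, (X - x₂)(X - x₁)v, and so on, along which g(X)
      -- is triangular; `flag₁` is the wedge of these vectors themselves.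
      flag : ∀ {n} → Poly → List Carrier → Seq → Λ n
      flag g []      v = unit
      flag g (x ∷ L) v = wedge (act c g v) (flag g L (Y x v))

      flag₁ : ∀ {n} → List Carrier → Seq → Λ n
      flag₁ []      v = unit
      flag₁ (x ∷ L) v = wedge v (flag₁ L (Y x v))

      remainder : List Carrier → Seq → Seq
      remainder []      v = v
      remainder (x ∷ L) v = remainder L (Y x v)

      -- Replacing each g(X)Xʲ⁺¹v by g(X)Xʲ(X - x)v subtracts x times the preceding vector of the
      -- wedge. This is a column operation, harmless by `wedge-square`.
      krylov-step : ∀ {n} g k x v →
        wedge (act c g v) (krylov {n} c g k (X c v)) ≗ wedge (act c g v) (krylov c g k (Y x v))
      krylov-step g zero    x v S = refl
      krylov-step g (suc k) x v S = begin
        wedge gv (wedge (act c g (X c v)) (krylov c g k (X c (X c v)))) S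
          ≈⟨ wedge-cong (λ _ → refl) (krylov-step g k x (X c v)) S ⟩
        wedge gv (wedge (act c g (X c v)) (krylov c g k (Y x (X c v)))) S
          ≈⟨ wedge-cong (λ _ → refl) (wedge-cong (λ _ → refl)
               (krylov-cong g k (λ i → sym (X-lin c (- x) v (X c v) i)))) S ⟩
        wedge gv (wedge (act c g (X c v)) Z) S
          ≈⟨ +-identityˡ _ ⟨
        0# + wedge gv (wedge (act c g (X c v)) Z) S
          ≈⟨ +-congʳ (trans (*-congˡ (wedge-square gv Z S)) (zeroʳ _)) ⟨
        - x * wedge gv (wedge gv Z) S + wedge gv (wedge (act c g (X c v)) Z) S
          ≈⟨ wedge-linʳ gv (- x) _ _ S ⟨
        wedge gv (λ T → - x * wedge gv Z T + wedge (act c g (X c v)) Z T) S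
          ≈⟨ wedge-cong (λ _ → refl) (wedge-linˡ (- x) gv _ Z) S ⟨
        wedge gv (wedge (λ i → - x * gv i + act c g (X c v) i) Z) S
          ≈⟨ wedge-cong (λ _ → refl) (wedge-cong (act-lin c g (- x) v (X c v)) (λ _ → refl)) S ⟨
        wedge gv (wedge (act c g (Y x v)) Z) S ∎
        where
        gv = act c g v
        Z  = krylov c g k (X c (Y x v))

      krylov-flag : ∀ {n} g L v → krylov {n} c g (List.length L) v ≗ flag g L v
      krylov-flag g []      v S = refl
      krylov-flag g (x ∷ L) v S = trans (krylov-step g (List.length L) x v S)
        (wedge-cong (λ _ → refl) (krylov-flag g L (Y x v)) S)

      -- If the product of all X - x kills v, the vectors of the flag span a submodule stable under
      -- X. It contains g(X)v, so the wedge vanishes. The induction splits X as x + (X - x).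
      flag₁-kills : ∀ {n} g L v → remainder L v ≗ (λ _ → 0#) →
        wedge (act c g v) (flag₁ {n} L v) ≗ λ _ → 0#
      flag₁-kills g       []      v e S = wedge-zeroˡ unit (act-zero c g e) S
      flag₁-kills []      (x ∷ L) v e S = wedge-zeroˡ _ (λ _ → refl) S
      flag₁-kills (y ∷ g) (x ∷ L) v e S = begin
        wedge (λ i → y * v i + act c g (X c v) i) W S
          ≈⟨ wedge-linˡ y v _ W S ⟩
        y * wedge v W S + wedge (act c g (X c v)) W S
          ≈⟨ +-cong (trans (*-congˡ (wedge-square v _ S)) (zeroʳ y)) (wedge-cong (act-X g x v) (λ _ → refl) S) ⟩
        0# + wedge (λ i → x * act c g v i + act c g (Y x v) i) W S
          ≈⟨ +-congˡ (wedge-linˡ x _ _ W S) ⟩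
        0# + (x * wedge (act c g v) W S + wedge (act c g (Y x v)) W S)
          ≈⟨ +-congˡ (+-cong (trans (*-congˡ (flag₁-kills g (x ∷ L) v e S)) (zeroʳ x))
               (wedge-anticomm-zero v _ (flag₁-kills g L (Y x v) e) S)) ⟩
        0# + (0# + 0#)
          ≈⟨ trans (+-identityˡ _) (+-identityˡ _) ⟩
        0# ∎
        where W = flag₁ (x ∷ L) v

      -- Modulo the later vectors of the flag, v is an eigenvector of X with eigenvalue x, so g(X)v
      -- may be replaced by g(x)v.
      flag₁-eigen : ∀ {n} g x L v → remainder (x ∷ L) v ≗ (λ _ → 0#) →
        wedge (act c g v) (flag₁ {n} L (Y x v)) ≗ λ S → eval x g * flag₁ (x ∷ L) v S
      flag₁-eigen []      x L v e S = trans (wedge-zeroˡ _ (λ _ → refl) S) (sym (zeroˡ _))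
      flag₁-eigen (y ∷ g) x L v e S = begin
        wedge (λ i → y * v i + act c g (X c v) i) W S
          ≈⟨ wedge-linˡ y v _ W S ⟩
        y * wedge v W S + wedge (act c g (X c v)) W S
          ≈⟨ +-congˡ (trans (wedge-cong (act-X g x v) (λ _ → refl) S) (wedge-linˡ x _ _ W S)) ⟩
        y * wedge v W S + (x * wedge (act c g v) W S + wedge (act c g (Y x v)) W S)
          ≈⟨ +-congˡ (+-cong (*-congˡ (flag₁-eigen g x L v e S)) (flag₁-kills g L (Y x v) e S)) ⟩
        y * wedge v W S + (x * (eval x g * wedge v W S) + 0#)
          ≈⟨ solve 4 (λ y x p w → y :* w :+ (x :* (p :* w) :+ con (+ 0)) := (y :+ x :* p) :* w)
               refl y x (eval x g) _ ⟩
        (y + x * eval x g) * wedge v W S ∎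
        where W = flag₁ L (Y x v)

      flag-eigen : ∀ {n} g L v → remainder L v ≗ (λ _ → 0#) →
        flag {n} g L v ≗ λ S → prodR A (List.map (λ x → eval x g) L) * flag₁ L v S
      flag-eigen g []      v e S = sym (*-identityˡ _)
      flag-eigen g (x ∷ L) v e S = begin
        wedge gv (flag g L (Y x v)) S             ≈⟨ wedge-cong (λ _ → refl) (flag-eigen g L (Y x v) e) S ⟩
        wedge gv (λ T → π * flag₁ L (Y x v) T) S  ≈⟨ wedge-scaleʳ gv π _ S ⟩
        π * wedge gv (flag₁ L (Y x v)) S          ≈⟨ *-congˡ (flag₁-eigen g x L v e S) ⟩
        π * (eval x g * flag₁ (x ∷ L) v S)        ≈⟨ solve 3 (λ p e f → p :* (e :* f) := (e :* p) :* f) refl _ _ _ ⟩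
        eval x g * π * flag₁ (x ∷ L) v S          ∎
        where
        gv = act c g v
        π  = prodR A (List.map (λ x → eval x g) L)

      one : Poly
      one = 1# ∷ []

      act-one : ∀ v → act c one v ≗ v
      act-one v i = trans (+-identityʳ _) (*-identityˡ _)

      flag-one : ∀ {n} L v → flag {n} one L v ≗ flag₁ L v
      flag-one []      v S = refl
      flag-one (x ∷ L) v S = wedge-cong (act-one v) (flag-one L (Y x v)) S

      -- The accumulating form of `series`: it multiplies in the order in which `remainder` consumes
      -- the roots.
      lins : List Carrier → Seq → Seq
      lins []      m = m
      lins (x ∷ L) m = lins L (lin x m)

      lins-lin : ∀ x L m → lins L (lin x m) ≗ lin x (lins L m)
      lins-lin x []      m i = refl
      lins-lin x (y ∷ L) m i = trans (lins-cong L (lin-comm y x m) i) (lins-lin x L (lin y m) i)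
        where
        lins-cong : ∀ L {m m′} → m ≗ m′ → lins L m ≗ lins L m′
        lins-cong []      e = e
        lins-cong (z ∷ L) e = lins-cong L (lin-cong refl e)

      lins-δ : ∀ L → lins L δ ≗ series L
      lins-δ []      i = refl
      lins-δ (x ∷ L) i = trans (lins-lin x L δ i) (lin-cong refl (lins-δ L) i)

      shift-lin : ∀ x k m i → shift k (lin x m) i ≈ - x * shift (suc k) m i + shift k m i
      shift-lin x zero    m zero    = sym (trans (+-congʳ (zeroʳ _)) (+-identityˡ _))
      shift-lin x zero    m (suc i) = solve 3 (λ x m n → m :- x :* n := :- x :* n :+ m) refl x _ _
      shift-lin x (suc k) m zero    = sym (trans (+-congʳ (zeroʳ _)) (+-identityˡ _))
      shift-lin x (suc k) m (suc i) = shift-lin x k m i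

      remainder-cong : ∀ L {v w} → v ≗ w → remainder L v ≗ remainder L w
      remainder-cong []      e = e
      remainder-cong (x ∷ L) e = remainder-cong L (λ i → +-cong (*-congˡ (e i)) (X-cong c e i))

      -- Cayley-Hamilton on the starting vector. X - x turns tᵏ⁺¹ m into tᵏ (1 - x t) m, so the
      -- factors of c accumulate. In the last step c = (1 - x t) m, hence X m = (m - c)/t = x m.
      remainder-shift : ∀ k L m → List.length L ≡ suc k → m 0 ≈ 1# → c ≗ lins L m →
        remainder L (shift k m) ≗ λ _ → 0#
      remainder-shift zero    (x ∷ []) m _ m₀ e i = begin
        - x * m i + (m (suc i) - m 0 * c (suc i))
          ≈⟨ +-congˡ (+-congˡ (-‿cong (trans (*-cong m₀ (e (suc i))) (*-identityˡ _)))) ⟩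
        - x * m i + (m (suc i) - (m (suc i) - x * m i))
          ≈⟨ solve 3 (λ x m n → :- x :* m :+ (n :- (n :- x :* m)) := con (+ 0)) refl x _ _ ⟩
        0# ∎
      remainder-shift (suc k) (x ∷ L) m |L| m₀ e i = trans
        (remainder-cong L (λ j → trans (+-congˡ (trans (+-congˡ (trans (-‿cong (zeroˡ _)) -0#≈0#))
          (+-identityʳ _))) (sym (shift-lin x k m j))) i)
        (remainder-shift k L (lin x m) (ℕ.suc-injective |L|) m₀ e i)

      shift-δ-< : ∀ {k n} → k < n → shift k δ n ≈ 0#
      shift-δ-< {zero}  {suc n} _         = refl
      shift-δ-< {suc k} {suc n} (s≤s k<n) = shift-δ-< k<n

      shift-δ-≡ : ∀ n → shift n δ n ≈ 1#
      shift-δ-≡ zero    = refl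
      shift-δ-≡ (suc n) = shift-δ-≡ n

      -- X maps tᵏ to tᵏ⁻¹ when k is positive, because the constant term of tᵏ is 0; for k = 0 both
      -- wedges are empty.
      krylov-X-initial : ∀ {n} g k → krylov {n} c g k (X c (initial (suc k))) ≗ krylov c g k (initial k)
      krylov-X-initial g zero    S = refl
      krylov-X-initial g (suc k) S = krylov-cong g (suc k)
        (λ i → trans (+-congˡ (trans (-‿cong (zeroˡ _)) -0#≈0#)) (+-identityʳ _)) S

      krylov-true : ∀ {n} k → k ≤ n → (S : Vec Bool n) → krylov c one k (initial k) (true ∷ S) ≈ 0#
      krylov-true     zero    _   S = refl
      krylov-true {n} (suc k) k<n S = trans
        (+-cong (trans (*-congʳ (trans (act-one (shift k δ) n) (shift-δ-< k<n))) (zeroˡ _))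
          (-‿cong (wedge-zeroʳ (act c one (shift k δ))
            (λ T → trans (krylov-X-initial one k (true ∷ T)) (krylov-true k (ℕ.<⇒≤ k<n) T)) S)))
        (trans (+-identityˡ _) -0#≈0#)

      krylov-false : ∀ {n} k → (S : Vec Bool n) →
        krylov c one k (initial k) (false ∷ S) ≈ krylov c one k (initial k) S
      krylov-false zero    S = refl
      krylov-false (suc k) S = wedge-cong (λ _ → refl) (λ T →
        trans (krylov-X-initial one k (false ∷ T)) (trans (krylov-false k T)
          (sym (krylov-X-initial one k T)))) S

      res-one : ∀ d → res d c one ≈ 1#
      res-one zero    = refl
      res-one (suc n) = begin
        act c one (shift n δ) n * krylov c one n (X c (initial (suc n))) (false ∷ (full n))
          - wedge (act c one (shift n δ)) (λ T → krylov c one n (X c (initial (suc n))) (true ∷ T)) (full n)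
          ≈⟨ +-cong (*-cong (trans (act-one (shift n δ) n) (shift-δ-≡ n))
               (trans (krylov-X-initial one n (false ∷ (full n))) (trans (krylov-false n (full n)) (res-one n))))
             (-‿cong (wedge-zeroʳ (act c one (shift n δ)) (λ T →
               trans (krylov-X-initial one n (true ∷ T)) (krylov-true n ℕ.≤-refl T)) (full n))) ⟩
        1# * 1# - 0#
          ≈⟨ trans (+-cong (*-identityˡ 1#) -0#≈0#) (+-identityʳ 1#) ⟩
        1# ∎

    res-roots : ∀ L g → c ≗ series L →
      res (List.length L) c g ≈ prodR A (List.map (λ x → eval x g) L)
    res-roots []        g e = refl
    res-roots L@(_ ∷ M) g e = begin
      krylov c g d v (full d)    ≈⟨ krylov-flag g L v (full d) ⟩
      flag g L v (full d)        ≈⟨ flag-eigen g L v vanishes (full d) ⟩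
      -- The wedge of the flag itself is not computed: the same steps read backwards for g = 1 turn
      -- it into the determinant of the identity.
      π * flag₁ L v (full d)     ≈⟨ *-congˡ (flag-one L v (full d)) ⟨
      π * flag one L v (full d)  ≈⟨ *-congˡ (krylov-flag one L v (full d)) ⟨
      π * res d c one        ≈⟨ *-congˡ (res-one d) ⟩
      π * 1#                 ≈⟨ *-identityʳ π ⟩
      π                      ∎
      where
      d = List.length L
      v = initial d
      π = prodR A (List.map (λ x → eval x g) L)
      vanishes : remainder L v ≗ λ _ → 0#
      vanishes = remainder-shift (List.length M) L δ ≡.refl refl
        (λ i → trans (e i) (sym (lins-δ L i)))

Injective : {A : CommutativeRing a ℓ₁} {B : CommutativeRing b ℓ₂} → Hom A B → Set _
Injective {A = A} {B} φ = ∀ {x y} → Hom.fun φ x B.≈ Hom.fun φ y → x A.≈ y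
  where
  module A = CommutativeRing A
  module B = CommutativeRing B

-- Splitting rings

-- The universal ring in which the series c = Σ cᵢ tⁱ, of degree suc d, acquires a
-- factor 1 - θ t.  The Horner polynomials are the coefficients of c/(1 - θ t).
module AdjoinRoot (A : CommutativeRing 0ℓ 0ℓ) (d : ℕ) (s : ℕ → CommutativeRing.Carrier A)
  (s₀ : CommutativeRing._≈_ A (s 0) (CommutativeRing.1# A))
  (deg : ∀ i → suc d < i → CommutativeRing._≈_ A (s i) (CommutativeRing.0# A)) where
  open CommutativeRing A
  open Polynomials A

  horner : ℕ → Poly
  horner = hornerPoly s

  open Quotient polyRing (horner (suc d)) public using (quotientRing; projectʰ)
  open Quotient polyRing (horner (suc d)) using (differBy; ≈⇒≡ₘ; d≡ₘ0)

  private
    module Q = CommutativeRing quotientRing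

  baseʰ : Hom A quotientRing
  baseʰ = projectʰ ∘ʰ constʰ

  θ : Poly
  θ = 0# ∷ 1# ∷ []

  private
    θ-⊛ : ∀ p → θ ⊛ p ≋ (0# ∷ p)
    θ-⊛ p = ≋-trans (0∷-⊛ (1# ∷ []) p) (∷-cong refl (⊛-identityˡ p))

    horner-suc : ∀ i → horner (suc i) ≋ (s (suc i) ∷ []) ⊕ θ ⊛ horner i
    horner-suc i = ≋-sym (≋-trans (⊕-cong (≋-refl {s (suc i) ∷ []}) (θ-⊛ (horner i))) (∷-cong (+-identityʳ _) ≋-refl))

    horner-lead : ∀ n → coeff (horner n) n ≈ 1#
    horner-lead zero    = s₀
    horner-lead (suc n) = horner-lead n

    horner-high : ∀ n i → n < i → coeff (horner n) i ≈ 0#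
    horner-high zero    (suc i) _         = refl
    horner-high (suc n) (suc i) (s≤s n<i) = horner-high n i n<i

    -- The quotient is cleared from the top: once its tail vanishes, the coefficient of q F in
    -- degree `suc d` is the head of q. Since F has leading coefficient 1, this works over every
    -- ring.
    monic-cancel : ∀ F → coeff F (suc d) ≈ 1# → (∀ i → suc d < i → coeff F i ≈ 0#) →
      ∀ q → (∀ i → suc d ≤ i → coeff (q ⊛ F) i ≈ 0#) → q ≋ []
    monic-cancel F lead high []      e = ≋-refl
    monic-cancel F lead high (x ∷ q) e = result
      where
      q≋[] : q ≋ []
      q≋[] = monic-cancel F lead high q λ i d<i →
        trans (sym (trans (coeff-⊛-suc x q F i)
            (trans (+-congʳ (trans (*-congˡ (high (suc i) (s≤s d<i))) (zeroʳ x))) (+-identityˡ _))))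
          (e (suc i) (ℕ.m≤n⇒m≤1+n d<i))
      x≈0 : x ≈ 0#
      x≈0 = trans (sym (trans (coeff-⊛-suc x q F d)
          (trans (+-cong (trans (*-congˡ lead) (*-identityʳ x)) (at (⊛-cong {q = F} q≋[] ≋-refl) d))
            (+-identityʳ _))))
        (e (suc d) ℕ.≤-refl)
      result : (x ∷ q) ≋ []
      result .at zero    = x≈0
      result .at (suc i) = at q≋[] i

  -- A difference of constants that equals F q has no coefficients in degree `suc d` or above, and
  -- monicity of F then forces q = 0. This lets identities verified on adjoined roots descend to
  -- `A`.
  base-injective : Injective baseʰ
  base-injective {x} {y} (differBy q e) = trans (at e 0) (trans
    (trans (coeff-⊕ (y ∷ []) (F ⊛ q) 0) (+-congˡ (at (≋-trans (⊛-congˡ F q≋[]) (⊛-zeroʳ F)) 0)))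
    (+-identityʳ y))
    where
    F = horner (suc d)
    q≋[] : q ≋ []
    q≋[] = monic-cancel F (horner-lead (suc d)) (horner-high (suc d)) q λ
      { (suc i) _ → trans (at (⊛-comm q F) (suc i)) (trans (sym (+-identityˡ _))
          (trans (sym (coeff-⊕ (y ∷ []) (F ⊛ q) (suc i))) (sym (at e (suc i))))) }

  horner-0 : horner 0 Q.≈ Q.1#
  horner-0 = ≈⇒≡ₘ (∷-cong s₀ ≋-refl)

  -- Index `suc d` is the polynomial divided out, which is where the cofactor loses one degree;
  -- beyond it the Horner recursion only adds zeros.
  horner-degree : ∀ i → d < i → horner i Q.≈ Q.0#
  horner-degree (suc i) (s≤s d≤i) with ℕ.m≤n⇒m<n∨m≡n d≤i
  ... | inj₂ ≡.refl = d≡ₘ0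
  ... | inj₁ d<i    = Q.trans (≈⇒≡ₘ (horner-suc i)) (Q.trans
    (Q.+-cong (Q.trans (≈⇒≡ₘ (∷-cong (deg (suc i) (s≤s d<i)) ≋-refl)) (Hom.0-homo baseʰ))
      (Q.trans (Q.*-congˡ {θ} (horner-degree i d<i)) (Q.zeroʳ θ)))
    (Q.+-identityˡ Q.0#))

  horner-factor : ∀ i → Series.lin quotientRing θ horner i Q.≈ Hom.fun baseʰ (s i)
  horner-factor zero    = Q.refl
  horner-factor (suc i) = Q.trans (Q.+-congʳ (≈⇒≡ₘ (horner-suc i)))
    (Solver.solve quotientRing 2 (λ x y → (x S.:+ y) S.:- y S.:= x) Q.refl (s (suc i) ∷ []) (θ ⊛ horner i))
    where module S = Solver quotientRing

record Splitting (A : CommutativeRing 0ℓ 0ℓ) (d : ℕ) (s : ℕ → CommutativeRing.Carrier A) : Set₁ where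
  field
    ring      : CommutativeRing 0ℓ 0ℓ
    embed     : Hom A ring
    injective : Injective embed
    roots     : List (CommutativeRing.Carrier ring)
    |roots|   : List.length roots ≡ d
    split     : ∀ i → CommutativeRing._≈_ ring (Hom.fun embed (s i)) (Series.series ring roots i)

lin~ : {A : CommutativeRing a ℓ₁} {B : CommutativeRing b ℓ₂} (φ : Hom A B) →
  let open Hom φ; open CommutativeRing B using (_≈_) in ∀ x m i →
  fun (Series.lin A x m i) ≈ Series.lin B (fun x) (λ j → fun (m j)) i
lin~ {B = B} φ x m zero    = CommutativeRing.refl B
lin~ {B = B} φ x m (suc i) = trans (sub-homo _ _) (+-congˡ (-‿cong (*-homo _ _)))
  where
  open CommutativeRing B
  open Hom φ

-- After one root is adjoined, the cofactor formed by the Horner polynomials is split over the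
-- enlarged ring.
splitting : (A : CommutativeRing 0ℓ 0ℓ) (d : ℕ) (s : ℕ → CommutativeRing.Carrier A) →
  let open CommutativeRing A using (_≈_; 0#; 1#) in
  s 0 ≈ 1# → (∀ i → d < i → s i ≈ 0#) → Splitting A d s
splitting A zero s s₀ deg = record
  { ring = A ; embed = idʰ A ; injective = λ e → e ; roots = [] ; |roots| = ≡.refl
  ; split = λ { zero → s₀ ; (suc i) → deg (suc i) (s≤s z≤n) } }
splitting A (suc d) s s₀ deg = record
  { ring = ring ; embed = embed ∘ʰ baseʰ
  ; injective = λ e → base-injective (injective e)
  ; roots = Hom.fun embed θ ∷ roots
  ; |roots| = ≡.cong suc |roots|
  ; split = λ i → trans (Hom.cong embed (CommutativeRing.sym quotientRing (horner-factor i)))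
      (trans (lin~ embed θ horner i) (Series.lin-cong ring refl split i)) }
  where
  open AdjoinRoot A d s s₀ deg
  open Splitting (splitting quotientRing d horner horner-0 horner-degree)
  open CommutativeRing ring using (trans; refl)

-- Frobenius

pow-cong : (R : CommutativeRing c ℓ) → let open CommutativeRing R in
  ∀ {x y} n → x ≈ y → pow R x n ≈ pow R y n
pow-cong R zero    e = CommutativeRing.refl R
pow-cong R (suc n) e = CommutativeRing.*-cong R e (pow-cong R n e)

pow-hom : {A : CommutativeRing a ℓ₁} {B : CommutativeRing b ℓ₂} (φ : Hom A B) →
  let open Hom φ; open CommutativeRing B using (_≈_) in
  ∀ x n → fun (pow A x n) ≈ pow B (fun x) n
pow-hom φ x zero    = Hom.1-homo φ
pow-hom {B = B} φ x (suc n) = trans (*-homo _ _) (*-congˡ (pow-hom φ x n))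
  where
  open CommutativeRing B
  open Hom φ

natR-hom : {A : CommutativeRing a ℓ₁} {B : CommutativeRing b ℓ₂} (φ : Hom A B) →
  let open Hom φ; open CommutativeRing B using (_≈_) in
  ∀ n → fun (natR A n) ≈ natR B n
natR-hom φ zero = Hom.0-homo φ
natR-hom {B = B} φ (suc n) = trans (+-homo _ _) (+-cong 1-homo (natR-hom φ n))
  where
  open CommutativeRing B
  open Hom φ

module Frobenius (R : CommutativeRing c ℓ) {p : ℕ} (pp : Prime p)
  (char : CommutativeRing._≈_ R (natR R p) (CommutativeRing.0# R)) where
  open CommutativeRing R
  open RingProperties ring using (+-inverseˡ-unique)
  open Exp semiring using () renaming (_^_ to _^ᴿ_)
  open Mult semiring using (×-assoc-*; ×-congʳ) renaming (_×_ to _·_)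
  open Sum semiring using (sum; sum-init-last; sum-cong-≋; sum-replicate-zero)
  open SetoidReasoning setoid

  private
    pow≡^ᴿ : ∀ x n → pow R x n ≡ x ^ᴿ n
    pow≡^ᴿ x zero    = ≡.refl
    pow≡^ᴿ x (suc n) = ≡.cong (x *_) (pow≡^ᴿ x n)

    p∣⇒natR≈0 : ∀ {n} → p ℕ∣.∣ n → natR R n ≈ 0#
    p∣⇒natR≈0 (ℕ∣.divides q ≡.refl) = trans (natR-* R q p) (trans (*-congˡ char) (zeroʳ _))

    binomial-vanishes : ∀ k z → 0 < k → k < p → (p C k) · z ≈ 0#
    binomial-vanishes k z 0<k k<p = begin
      (p C k) · z               ≈⟨ ×-congʳ (p C k) (*-identityˡ z) ⟨
      (p C k) · (1# * z)        ≈⟨ ×-assoc-* (p C k) 1# z ⟨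
      ((p C k) · 1#) * z        ≈⟨ *-congʳ (natR≈× R (p C k)) ⟨
      natR R (p C k) * z        ≈⟨ *-congʳ (p∣⇒natR≈0 (prime∣C pp k 0<k k<p)) ⟩
      0# * z                    ≈⟨ zeroˡ z ⟩
      0#                        ∎

    -- Exposing the predecessor `q` separates the first and the last binomial term from the middle
    -- ones, whose coefficients p divides.
    ^ᴿ-+ : ∀ q → p ≡ suc q → ∀ x y → (x + y) ^ᴿ p ≈ x ^ᴿ p + y ^ᴿ p
    ^ᴿ-+ q ≡.refl x y = begin
      (x + y) ^ᴿ p
        ≈⟨ Binomial.theorem commutativeSemiring p x y ⟩
      t Fin.zero + sum (λ i → t (Fin.suc i))
        ≈⟨ +-congˡ (sum-init-last {q} (λ i → t (Fin.suc i))) ⟩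
      t Fin.zero + (sum (λ i → t (Fin.suc (Fin.inject₁ i))) + t (Fin.suc (Fin.fromℕ q)))
        ≈⟨ +-cong first (+-cong (trans (sum-cong-≋ middle) (sum-replicate-zero q)) last) ⟩
      y ^ᴿ p + (0# + x ^ᴿ p)
        ≈⟨ trans (+-congˡ (+-identityˡ _)) (+-comm _ _) ⟩
      x ^ᴿ p + y ^ᴿ p ∎
      where
      t : Fin (suc p) → Carrier
      t i = Binomial.binomialTerm commutativeSemiring x y p i
      first : t Fin.zero ≈ y ^ᴿ p
      first = trans (+-identityʳ _) (*-identityˡ _)
      middle : ∀ (i : Fin q) → t (Fin.suc (Fin.inject₁ i)) ≈ 0#
      middle i = binomial-vanishes _ _ (s≤s z≤n)
        (s≤s (≡.subst (_< q) (≡.sym (Fin.toℕ-inject₁ i)) (Fin.toℕ<n i)))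
      collapse : ∀ {k i j} → k ≡ 1 → i ≡ p → j ≡ 0 → k · (x ^ᴿ i * y ^ᴿ j) ≈ x ^ᴿ p
      collapse ≡.refl ≡.refl ≡.refl = trans (+-identityʳ _) (*-identityʳ _)
      last : t (Fin.suc (Fin.fromℕ q)) ≈ x ^ᴿ p
      last = collapse (≡.trans (≡.cong (p C_) top) (nCn≡1 p)) top
        (≡.trans (≡.cong (p ℕ.∸_) top) (ℕ.n∸n≡0 p))
        where
        top : toℕ (Fin.suc (Fin.fromℕ q)) ≡ p
        top = ≡.cong suc (Fin.toℕ-fromℕ q)

  pow-+ : ∀ x y → pow R (x + y) p ≈ pow R x p + pow R y p
  pow-+ x y rewrite pow≡^ᴿ (x + y) p | pow≡^ᴿ x p | pow≡^ᴿ y p = helper p ≡.refl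
    where
    helper : ∀ q → p ≡ q → (x + y) ^ᴿ p ≈ x ^ᴿ p + y ^ᴿ p
    helper zero    ≡.refl = ⊥-elim (ℕ.<⇒≱ (ℕ.nonTrivial⇒n>1 _ {{prime⇒nonTrivial pp}}) z≤n)
    helper (suc q) e      = ^ᴿ-+ q e x y

  pow-0 : pow R 0# p ≈ 0#
  pow-0 = helper p ≡.refl
    where
    helper : ∀ q → p ≡ q → pow R 0# p ≈ 0#
    helper zero    ≡.refl = ⊥-elim (ℕ.<⇒≱ (ℕ.nonTrivial⇒n>1 _ {{prime⇒nonTrivial pp}}) z≤n)
    helper (suc q) ≡.refl = zeroˡ _

  pow-neg : ∀ x → pow R (- x) p ≈ - pow R x p
  pow-neg x = +-inverseˡ-unique _ _ (begin
    pow R (- x) p + pow R x p  ≈⟨ pow-+ (- x) x ⟨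
    pow R (- x + x) p          ≈⟨ pow-cong R p (-‿inverseˡ x) ⟩
    pow R 0# p                 ≈⟨ pow-0 ⟩
    0#                         ∎)

pow-* : (R : CommutativeRing c ℓ) → let open CommutativeRing R in
  ∀ x y n → pow R (x * y) n ≈ pow R x n * pow R y n
pow-* R x y zero    = CommutativeRing.sym R (CommutativeRing.*-identityˡ R _)
pow-* R x y (suc n) = trans (*-congˡ (pow-* R x y n))
  (solve 4 (λ x y p q → (x :* y) :* (p :* q) := (x :* p) :* (y :* q)) refl x y _ _)
  where
  open CommutativeRing R
  open Solver R

pow-1 : (R : CommutativeRing c ℓ) → let open CommutativeRing R in
  ∀ n → pow R 1# n ≈ 1#
pow-1 R zero    = CommutativeRing.refl R
pow-1 R (suc n) = CommutativeRing.trans R (CommutativeRing.*-identityˡ R _) (pow-1 R n)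

-- In characteristic p the p-th power map is a ring homomorphism, and `series` is built from the
-- entries by ring operations.
series-frobenius : (R : CommutativeRing c ℓ) → let open CommutativeRing R; open Series R in
  ∀ {p} → Prime p → natR R p ≈ 0# →
  ∀ L i → series (List.map (λ x → pow R x p) L) i ≈ pow R (series L i) p
series-frobenius R {p} pp char = go
  where
  open CommutativeRing R
  open Series R
  open Frobenius R pp char
  go : ∀ L i → series (List.map (λ x → pow R x p) L) i ≈ pow R (series L i) p
  go []      zero    = sym (pow-1 R p)
  go []      (suc i) = sym pow-0
  go (x ∷ L) zero    = go L 0
  go (x ∷ L) (suc i) = sym (trans (pow-+ _ _) (+-cong (sym (go L (suc i)))
    (trans (pow-neg _) (-‿cong (trans (pow-* R _ _ p) (*-congˡ (sym (go L i))))))))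

-- Formulas for the series of powers and products of roots.

prodR-++ : (R : CommutativeRing c ℓ) → let open CommutativeRing R in
  ∀ xs ys → prodR R (xs ++ ys) ≈ prodR R xs * prodR R ys
prodR-++ R []       ys = CommutativeRing.sym R (CommutativeRing.*-identityˡ R _)
prodR-++ R (x ∷ xs) ys = trans (*-congˡ (prodR-++ R xs ys)) (sym (*-assoc x _ _))
  where open CommutativeRing R

module CharPoly (R : CommutativeRing c ℓ) where
  open CommutativeRing R
  open RingProperties ring using (-‿distribˡ-*)
  open Polynomials R
  open Series R

  charPoly : List Carrier → Poly
  charPoly L = prodR polyRing (List.map (λ x → 1# ∷ - x ∷ []) L)

  coeff-const-⊛ : ∀ x p i → coeff ((x ∷ []) ⊛ p) i ≈ x * coeff p i
  coeff-const-⊛ x p zero    = coeff-⊛-zero x [] p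
  coeff-const-⊛ x p (suc i) = trans (coeff-⊛-suc x [] p i) (+-identityʳ _)

  coeff-charPoly : ∀ L → coeff (charPoly L) ≗ series L
  coeff-charPoly []      zero    = refl
  coeff-charPoly []      (suc i) = refl
  coeff-charPoly (x ∷ L) zero    = trans (coeff-⊛-zero 1# (- x ∷ []) (charPoly L))
    (trans (*-identityˡ _) (coeff-charPoly L 0))
  coeff-charPoly (x ∷ L) (suc i) = trans (coeff-⊛-suc 1# (- x ∷ []) (charPoly L) i)
    (+-cong (trans (*-identityˡ _) (coeff-charPoly L (suc i)))
      (trans (coeff-const-⊛ (- x) (charPoly L) i) (trans (sym (-‿distribˡ-* _ _))
        (-‿cong (*-congˡ (coeff-charPoly L i))))))

  -- Concatenating lists multiplies their series. The multiplication takes place in `polyRing`,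
  -- where the series of a list is the coefficient sequence of its `charPoly`.
  series-concatMap : ∀ (h : Carrier → Poly) (N : Carrier → List Carrier) →
    (∀ x → coeff (h x) ≗ series (N x)) →
    ∀ L → coeff (prodR polyRing (List.map h L)) ≗ series (concatMap N L)
  series-concatMap h N e L i = trans (at (product L) i) (coeff-charPoly (concatMap N L) i)
    where
    product : ∀ L → prodR polyRing (List.map h L) ≋ charPoly (concatMap N L)
    product []      = ≋-refl
    product (x ∷ L) = ≋-trans
      (⊛-cong {p = h x} {charPoly (N x)} (coeffwise (λ j → trans (e x j) (sym (coeff-charPoly (N x) j)))) (product L))
      (≋-sym (≋-trans
        (CommutativeRing.reflexive polyRing (≡.cong (prodR polyRing) (List.map-++ _ (N x) (concatMap N L))))
        (prodR-++ polyRing (List.map (λ y → 1# ∷ - y ∷ []) (N x)) _)))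

module RootOperations (A : CommutativeRing c ℓ) where
  open CommutativeRing A
  open Polynomials A
  module PP = Polynomials polyRing

  t : Poly
  t = 0# ∷ 1# ∷ []

  negMonomial : ℕ → PP.Poly
  negMonomial zero    = neg t ∷ []
  negMonomial (suc q) = [] ∷ negMonomial q

  -- 1 - t y^q
  powerPoly : ℕ → PP.Poly
  powerPoly q = PP._⊕_ ((1# ∷ []) ∷ []) (negMonomial q)

  -- Σ eₖ tᵏ yᵏ over k ≤ m
  tensorPoly : ℕ → (ℕ → Carrier) → PP.Poly
  tensorPoly zero    e = (e 0 ∷ []) ∷ []
  tensorPoly (suc m) e = (e 0 ∷ []) ∷ PP.scale t (tensorPoly m (e ∘ suc))

  -- The product of 1 - t x^q over the roots x of `s`, as the determinant of 1 - t y^q over A[t],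
  -- with the coefficients of `s` constant in t.
  powerSeries : ℕ → ℕ → (ℕ → Carrier) → ℕ → Carrier
  powerSeries d q s = coeff (Resultant.res polyRing d (λ j → s j ∷ []) (powerPoly q))

  -- If e(t) = ∏ (1 - b t), then e(x t) = ∏ (1 - x b t). So the product of e(x t) over the roots x
  -- of `s` is the series of all products x b; it is the determinant of e(y t).
  tensorSeries : ℕ → (ℕ → Carrier) → ℕ → (ℕ → Carrier) → ℕ → Carrier
  tensorSeries d s m e = coeff (Resultant.res polyRing d (λ j → s j ∷ []) (tensorPoly m e))

powers : (R : CommutativeRing c ℓ) → let open CommutativeRing R in ℕ → List Carrier → List Carrier
powers R q = List.map (λ x → pow R x q)

tensor : (R : CommutativeRing c ℓ) → let open CommutativeRing R in
  List Carrier → List Carrier → List Carrier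
tensor R L M = concatMap (λ x → List.map (CommutativeRing._*_ R x) M) L

-- Naturality of the formulas for powers and products.

module _ {A : CommutativeRing a ℓ₁} {B : CommutativeRing b ℓ₂} (φ : Hom A B) where
  private
    module A = CommutativeRing A
    module B = CommutativeRing B
    module PA = Polynomials A
    module PB = Polynomials B
    module OA = RootOperations A
    module OB = RootOperations B
    module PPA = Polynomials PA.polyRing
    module PPB = Polynomials PB.polyRing
    open Hom φ
    module Pφ = Hom (polyʰ φ)

    const~ : ∀ {s s′} → _~_ φ s s′ → _~_ (polyʰ φ) {I = ℕ} (λ j → s j ∷ []) (λ j → s′ j ∷ [])
    const~ σ j = PB.∷-cong (σ j) PB.≋-refl

    t~ : Pφ.fun OA.t PB.≋ OB.t
    t~ = PB.∷-cong 0-homo (PB.∷-cong 1-homo PB.≋-refl)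

    negMonomial~ : ∀ q → _~_ (polyʰ φ) (PPA.coeff (OA.negMonomial q)) (PPB.coeff (OB.negMonomial q))
    negMonomial~ zero    zero    = PB.≋-trans (Pφ.neg-homo OA.t) (PB.neg-cong t~)
    negMonomial~ zero    (suc i) = PB.≋-refl
    negMonomial~ (suc q) zero    = PB.≋-refl
    negMonomial~ (suc q) (suc i) = negMonomial~ q i

    powerPoly~ : ∀ q → _~_ (polyʰ φ) (PPA.coeff (OA.powerPoly q)) (PPB.coeff (OB.powerPoly q))
    powerPoly~ q i = PB.≋-trans (Pφ.cong (PPA.coeff-⊕ unitA (OA.negMonomial q) i))
      (PB.≋-trans (Pφ.+-homo (PPA.coeff unitA i) _)
      (PB.≋-trans (PB.⊕-cong (unit~ i) (negMonomial~ q i))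
      (PB.≋-sym (PPB.coeff-⊕ unitB (OB.negMonomial q) i))))
      where
      unitA : PPA.Poly
      unitA = (A.1# ∷ []) ∷ []
      unitB : PPB.Poly
      unitB = (B.1# ∷ []) ∷ []
      unit~ : _~_ (polyʰ φ) (PPA.coeff unitA) (PPB.coeff unitB)
      unit~ zero    = Pφ.1-homo
      unit~ (suc i) = PB.≋-refl

    tensorPoly~ : ∀ m {e e′} → _~_ φ e e′ →
      _~_ (polyʰ φ) (PPA.coeff (OA.tensorPoly m e)) (PPB.coeff (OB.tensorPoly m e′))
    tensorPoly~ zero    ε zero    = const~ ε 0
    tensorPoly~ zero    ε (suc i) = PB.≋-refl
    tensorPoly~ (suc m) ε zero    = const~ ε 0
    tensorPoly~ (suc m) {e} {e′} ε (suc i) = PB.≋-trans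
      (Pφ.cong (PPA.coeff-scale OA.t (OA.tensorPoly m (e ∘ suc)) i))
      (PB.≋-trans (Pφ.*-homo OA.t _)
      (PB.≋-trans (PB.⊛-cong t~ (tensorPoly~ m (ε ∘ suc) i))
      (PB.≋-sym (PPB.coeff-scale OB.t (OB.tensorPoly m (e′ ∘ suc)) i))))

    coeff~ : ∀ {p q} → Pφ.fun p PB.≋ q → _~_ φ (PA.coeff p) (PB.coeff q)
    coeff~ {p} e i = B.trans (coeff-map φ p i) (PB.at e i)

  powerSeries~ : ∀ d q {s s′} → _~_ φ s s′ → _~_ φ (OA.powerSeries d q s) (OB.powerSeries d q s′)
  powerSeries~ d q σ = coeff~ (res~ (polyʰ φ) d (OA.powerPoly q) (OB.powerPoly q) (const~ σ) (powerPoly~ q))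

  tensorSeries~ : ∀ d {s s′} m {e e′} → _~_ φ s s′ → _~_ φ e e′ →
    _~_ φ (OA.tensorSeries d s m e) (OB.tensorSeries d s′ m e′)
  tensorSeries~ d m {e} {e′} σ ε =
    coeff~ (res~ (polyʰ φ) d (OA.tensorPoly m e) (OB.tensorPoly m e′) (const~ σ) (tensorPoly~ m ε))

-- The formulas evaluated on actual roots.

module _ (R : CommutativeRing c ℓ) where
  open CommutativeRing R
  open Polynomials R
  open Series R
  open CharPoly R
  open RootOperations R
  open RingProperties ring using (-0#≈0#; -‿distribʳ-*)
  private
    module SP = Series polyRing

    res-const : ∀ s L g → s ≗ series L →
      Resultant.res polyRing (List.length L) (λ j → s j ∷ []) g ≋
      prodR polyRing (List.map (λ x → PP.eval (x ∷ []) g) L)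
    res-const s L g e = ≋-trans
      (≡.subst (λ n → res n _ g ≋ res (List.length L′) _ g) (List.length-map _ L) ≋-refl)
      (≋-trans (res-roots polyRing (λ j → s j ∷ []) L′ g
        (λ i → ≋-trans (∷-cong (e i) ≋-refl) (series~ constʰ L i)))
      (CommutativeRing.reflexive polyRing (≡.cong (prodR polyRing) (≡.sym (List.map-∘ L)))))
      where
      open Resultant polyRing using (res)
      L′ = List.map (λ x → x ∷ []) L

    t-⊛ : ∀ p → t ⊛ p ≋ (0# ∷ p)
    t-⊛ p = ≋-trans (0∷-⊛ (1# ∷ []) p) (∷-cong refl (⊛-identityˡ p))

    eval-negMonomial : ∀ x q → PP.eval (x ∷ []) (negMonomial q) ≋ (0# ∷ - pow R x q ∷ [])
    eval-negMonomial x zero    = ≋-trans (⊕-cong {p = neg t} ≋-refl (⊛-zeroʳ (x ∷ [])))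
      (≋-trans (⊕-identityʳ (neg t)) (∷-cong -0#≈0# ≋-refl))
    eval-negMonomial x (suc q) = ≋-trans (⊛-congˡ (x ∷ []) (eval-negMonomial x q)) (coeffwise λ i →
      trans (coeff-const-⊛ x (0# ∷ - pow R x q ∷ []) i) (lemma i))
      where
      lemma : ∀ i → x * coeff (0# ∷ - pow R x q ∷ []) i ≈ coeff (0# ∷ - (x * pow R x q) ∷ []) i
      lemma zero          = zeroʳ x
      lemma (suc zero)    = sym (-‿distribʳ-* x _)
      lemma (suc (suc i)) = zeroʳ x

    eval-powerPoly : ∀ x q → coeff (PP.eval (x ∷ []) (powerPoly q)) ≗ series (pow R x q ∷ [])
    eval-powerPoly x q i = trans (at e i) (coeff-charPoly (pow R x q ∷ []) i)
      where
      e : PP.eval (x ∷ []) (powerPoly q) ≋ charPoly (pow R x q ∷ [])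
      e = ≋-trans (PP.eval-⊕ (x ∷ []) ((1# ∷ []) ∷ []) (negMonomial q))
        (≋-trans (⊕-cong {p = PP.eval (x ∷ []) ((1# ∷ []) ∷ [])}
           (≋-trans (⊕-cong {p = 1# ∷ []} ≋-refl (⊛-zeroʳ (x ∷ []))) (⊕-identityʳ (1# ∷ [])))
           (eval-negMonomial x q))
        (≋-trans (∷-cong (+-identityʳ 1#) ≋-refl)
        (≋-sym (CommutativeRing.*-identityʳ polyRing (1# ∷ - pow R x q ∷ [])))))

    -- This is the substitution of x t for t. The polynomial is truncated at degree m, and the
    -- vanishing of the later coefficients makes the two sides agree beyond it.
    eval-tensorPoly : ∀ x m e → (∀ i → m < i → e i ≈ 0#) →
      coeff (PP.eval (x ∷ []) (tensorPoly m e)) ≗ λ i → pow R x i * e i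
    eval-tensorPoly x zero    e deg zero    = trans
      (at (≋-trans (⊕-cong {p = e 0 ∷ []} ≋-refl (⊛-zeroʳ (x ∷ []))) (⊕-identityʳ (e 0 ∷ []))) 0)
      (sym (*-identityˡ _))
    eval-tensorPoly x zero    e deg (suc i) = trans
      (at (≋-trans (⊕-cong {p = e 0 ∷ []} ≋-refl (⊛-zeroʳ (x ∷ []))) (⊕-identityʳ (e 0 ∷ []))) (suc i))
      (sym (trans (*-congˡ (deg (suc i) (s≤s z≤n))) (zeroʳ _)))
    eval-tensorPoly x (suc m) e deg i = trans (at expand i) (lemma i)
      where
      E : Poly
      E = PP.eval (x ∷ []) (tensorPoly m (e ∘ suc))
      expand : PP.eval (x ∷ []) (tensorPoly (suc m) e) ≋ (e 0 ∷ []) ⊕ (x ∷ []) ⊛ (0# ∷ E)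
      expand = ⊕-cong {p = e 0 ∷ []} ≋-refl (⊛-congˡ (x ∷ [])
        (≋-trans (PP.eval-scale (x ∷ []) t (tensorPoly m (e ∘ suc))) (t-⊛ E)))
      lemma : ∀ i → coeff ((e 0 ∷ []) ⊕ (x ∷ []) ⊛ (0# ∷ E)) i ≈ pow R x i * e i
      lemma zero    = trans (coeff-⊕ (e 0 ∷ []) ((x ∷ []) ⊛ (0# ∷ E)) 0)
        (trans (+-congˡ (trans (coeff-const-⊛ x (0# ∷ E) 0) (zeroʳ x)))
        (trans (+-identityʳ _) (sym (*-identityˡ _))))
      lemma (suc i) = trans (coeff-⊕ (e 0 ∷ []) ((x ∷ []) ⊛ (0# ∷ E)) (suc i))
        (trans (+-identityˡ _) (trans (coeff-const-⊛ x (0# ∷ E) (suc i))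
        (trans (*-congˡ (eval-tensorPoly x m (e ∘ suc) (λ j m<j → deg (suc j) (s≤s m<j)) i))
        (sym (*-assoc x _ _)))))

    series-scale : ∀ x M i → series (List.map (x *_) M) i ≈ pow R x i * series M i
    series-scale x []      zero    = sym (*-identityˡ _)
    series-scale x []      (suc i) = sym (zeroʳ _)
    series-scale x (y ∷ M) zero    = series-scale x M 0
    series-scale x (y ∷ M) (suc i) = trans
      (+-cong (series-scale x M (suc i)) (-‿cong (*-congˡ (series-scale x M i))))
      (solve 5 (λ x y p u v → x :* p :* u :- x :* y :* (p :* v) := x :* p :* (u :- y :* v))
        refl x y (pow R x i) _ _)
      where open Solver R

  series-powers : ∀ q s L → s ≗ series L →
    powerSeries (List.length L) q s ≗ series (powers R q L)
  series-powers q s L e i = trans (at (res-const s L (powerPoly q) e) i)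
    (trans (series-concatMap _ (λ x → pow R x q ∷ []) (λ x → eval-powerPoly x q) L i)
    (reflexive (≡.cong (λ M → series M i) (≡.trans (≡.sym (List.concatMap-map List.[_] _ L))
      (List.concatMap-pure (powers R q L))))))

  series-tensor : ∀ s L e M → s ≗ series L → e ≗ series M →
    tensorSeries (List.length L) s (List.length M) e ≗ series (tensor R L M)
  series-tensor s L e M σ ε i = trans (at (res-const s L (tensorPoly (List.length M) e) σ) i)
    (series-concatMap _ (λ x → List.map (x *_) M) (λ x j →
      trans (eval-tensorPoly x (List.length M) e (λ k m<k → trans (ε k) (series-> M k m<k)) j)
      (trans (*-congˡ (ε j)) (sym (series-scale x M j)))) L i)

-- Congruences for the p-th power series.

powerSeries-frobenius : (A : CommutativeRing 0ℓ 0ℓ) → let open CommutativeRing A in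
  ∀ {p} → Prime p → natR A p ≈ 0# →
  ∀ d s → s 0 ≈ 1# → (∀ i → d < i → s i ≈ 0#) →
  ∀ i → RootOperations.powerSeries A d p s i ≈ pow A (s i) p
powerSeries-frobenius A {p} pp char d s s₀ deg i = injective (begin
  fun (RootOperations.powerSeries A d p s i)
    ≈⟨ powerSeries~ embed d p (λ _ → refl) i ⟩
  RootOperations.powerSeries ring d p (λ j → fun (s j)) i
    ≡⟨ ≡.cong (λ n → RootOperations.powerSeries ring n p (λ j → fun (s j)) i) |roots| ⟨
  RootOperations.powerSeries ring (List.length roots) p (λ j → fun (s j)) i
    ≈⟨ series-powers ring p (λ j → fun (s j)) roots split i ⟩
  Series.series ring (powers ring p roots) i
    ≈⟨ series-frobenius ring pp (trans (sym (natR-hom embed p)) (trans (cong char) 0-homo)) roots i ⟩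
  pow ring (Series.series ring roots i) p
    ≈⟨ pow-cong ring p (split i) ⟨
  pow ring (fun (s i)) p
    ≈⟨ pow-hom embed (s i) p ⟨
  fun (pow A (s i) p) ∎)
  where
  open Splitting (splitting A d s s₀ deg)
  open Hom embed
  open CommutativeRing ring using (refl; sym; trans; setoid)
  open SetoidReasoning setoid

ι-natural : {A : CommutativeRing a ℓ₁} {B : CommutativeRing b ℓ₂} (φ : Hom A B) →
  let open Hom φ; open CommutativeRing B using (_≈_) in
  ∀ x → fun (ι A x) ≈ ι B x
ι-natural φ (+ n)    = natR-hom φ n
ι-natural {B = B} φ -[1+ n ] = trans (neg-homo _) (-‿cong (natR-hom φ (suc n)))
  where
  open CommutativeRing B
  open Hom φ

natR-ℤ : ∀ n → natR ℤᴿ n ≡ + n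
natR-ℤ zero    = ≡.refl
natR-ℤ (suc n) = ≡.cong (ℤ._+_ (+ 1)) (natR-ℤ n)

ι-ℤ : ∀ x → ι ℤᴿ x ≡ x
ι-ℤ (+ n)    = natR-ℤ n
ι-ℤ -[1+ n ] = ≡.cong ℤ.-_ (natR-ℤ (suc n))

ℤ-initial : {B : CommutativeRing b ℓ} (φ : Hom ℤᴿ B) → let open CommutativeRing B using (_≈_) in
  ∀ x → Hom.fun φ x ≈ ι B x
ℤ-initial {B = B} φ x = trans (reflexive (≡.cong (Hom.fun φ) (≡.sym (ι-ℤ x)))) (ι-natural φ x)
  where open CommutativeRing B

-- Frobenius is additive and fixes 1, so it fixes every sum of ones and its negative.
fermat : (B : CommutativeRing c ℓ) → let open CommutativeRing B in
  ∀ {p} → Prime p → natR B p ≈ 0# → ∀ x → pow B (ι B x) p ≈ ι B x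
fermat B {p} pp char = λ { (+ n) → nat n ; -[1+ n ] → trans (pow-neg _) (-‿cong (nat (suc n))) }
  where
  open Frobenius B pp char
  open CommutativeRing B
  nat : ∀ n → pow B (natR B n) p ≈ natR B n
  nat zero    = pow-0
  nat (suc n) = trans (pow-+ 1# (natR B n)) (+-cong (pow-1 B p) (nat n))

Monic : (A : CommutativeRing c ℓ) → ℕ → (ℕ → CommutativeRing.Carrier A) → Set ℓ
Monic A d s = s 0 ≈ 1# × (∀ i → d < i → s i ≈ 0#)
  where open CommutativeRing A

powerSeries-char : {A : CommutativeRing c ℓ} {B : CommutativeRing 0ℓ 0ℓ} (φ : Hom A B) →
  let module A = CommutativeRing A; open CommutativeRing B; open Hom φ in
  ∀ {p} → Prime p → natR B p ≈ 0# → ∀ d s → Monic A d s →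
  ∀ i → fun (RootOperations.powerSeries A d p s i) ≈ pow B (fun (s i)) p
powerSeries-char {B = B} φ {p} pp char d s (s₀ , deg) i = trans
  (powerSeries~ φ d p (λ _ → refl) i)
  (powerSeries-frobenius B pp char d (λ j → fun (s j)) (trans (cong s₀) 1-homo)
    (λ j d<j → trans (cong (deg j d<j)) 0-homo) i)
  where
  open CommutativeRing B
  open Hom φ

natR-char : (A : CommutativeRing c ℓ) → ∀ p → let open Quotient A (natR A p) in
  CommutativeRing._≈_ quotientRing (natR quotientRing p) (CommutativeRing.0# A)
natR-char A p = trans (sym (natR-hom projectʰ p)) d≡ₘ0
  where
  open Quotient A (natR A p)
  open CommutativeRing quotientRing

powerSeries-fermat : ∀ {p} → Prime p → ∀ d s → Monic ℤᴿ d s →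
  ∀ i → Quotient._≡ₘ_ ℤᴿ (natR ℤᴿ p) (RootOperations.powerSeries ℤᴿ d p s i) (s i)
powerSeries-fermat {p} pp d s m i = go (Quotient.projectʰ ℤᴿ (natR ℤᴿ p)) (natR-char ℤᴿ p)
  where
  go : {B : CommutativeRing 0ℓ 0ℓ} (φ : Hom ℤᴿ B) → let open CommutativeRing B in
    natR B p ≈ 0# → Hom.fun φ (RootOperations.powerSeries ℤᴿ d p s i) ≈ Hom.fun φ (s i)
  go {B} φ char = trans (powerSeries-char φ pp char d s m i)
    (trans (pow-cong B p (ℤ-initial φ (s i))) (trans (fermat B pp char (s i)) (sym (ℤ-initial φ (s i)))))
    where open CommutativeRing B

module _ (A : CommutativeRing 0ℓ 0ℓ) where
  open CommutativeRing A
  open Polynomials A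
  open Solver A
  open RootOperations A using (powerSeries)
  open SetoidReasoning setoid

  private
    eval-0 : ∀ q → eval 0# q ≈ coeff q 0
    eval-0 []      = refl
    eval-0 (x ∷ q) = trans (+-congˡ (zeroˡ _)) (+-identityʳ x)

    eval-mod : ∀ x q → Σ[ r ∈ Carrier ] eval x q ≈ coeff q 0 + x * r
    eval-mod x []      = 0# , sym (trans (+-identityˡ _) (zeroʳ x))
    eval-mod x (y ∷ q) = eval x q , refl

    eval-const : ∀ x y → eval x (y ∷ []) ≈ y
    eval-const x y = trans (+-congˡ (zeroʳ x)) (+-identityʳ y)

    -- Over A[s] the power series of g + s h is ≡ gᵖ + (s h)ᵖ mod p.
    module Deform {p : ℕ} (pp : Prime p) (d : ℕ) (g h : ℕ → Carrier)
      (monic : Monic polyRing d (λ i → g i ∷ h i ∷ [])) (i : ℕ) where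

      open Quotient polyRing (natR polyRing p) using (_≡ₘ_; projectʰ)

      u : ℕ → Poly
      u j = g j ∷ h j ∷ []

      W base tail expansion : Poly
      W         = RootOperations.powerSeries polyRing d p u i
      base      = pow polyRing (g i ∷ []) p
      tail      = pow polyRing (0# ∷ h i ∷ []) p
      expansion = base ⊕ tail

      W≡expansion : W ≡ₘ expansion
      W≡expansion = go projectʰ (natR-char polyRing p)
        where
        go : {B : CommutativeRing 0ℓ 0ℓ} (φ : Hom polyRing B) → let module B = CommutativeRing B in
          natR B p B.≈ B.0# → Hom.fun φ W B.≈ Hom.fun φ expansion
        go {B} φ char = B.trans (powerSeries-char φ pp char d u monic i)
          (B.trans (pow-cong B p (B.trans (cong (∷-cong (sym (+-identityʳ (g i))) ≋-refl))
            (+-homo (g i ∷ []) (0# ∷ h i ∷ []))))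
          (B.trans (Frobenius.pow-+ B pp char (fun (g i ∷ [])) (fun (0# ∷ h i ∷ [])))
          (B.trans (B.+-cong (B.sym (pow-hom φ (g i ∷ []) p)) (B.sym (pow-hom φ (0# ∷ h i ∷ []) p)))
          (B.sym (+-homo base tail)))))
          where
          module B = CommutativeRing B
          open Hom φ

      D : Poly
      D = _≡ₘ_.quotient W≡expansion

      eval-W : ∀ x → powerSeries d p (λ j → g j + x * h j) i
        ≈ pow A (g i) p + pow A (x * h i) p + natR A p * eval x D
      eval-W x = begin
        powerSeries d p (λ j → g j + x * h j) i
          ≈⟨ powerSeries~ (evalʰ x) d p {u} (λ j → +-congˡ (*-congˡ (eval-const x (h j)))) i ⟨
        eval x W
          ≈⟨ cong (_≡ₘ_.equality W≡expansion) ⟩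
        eval x (expansion ⊕ natR polyRing p ⊛ D)
          ≈⟨ trans (+-homo expansion (natR polyRing p ⊛ D)) (+-cong (+-homo base tail) (*-homo (natR polyRing p) D)) ⟩
        eval x base + eval x tail + eval x (natR polyRing p) * eval x D
          ≈⟨ +-cong (+-cong
               (trans (pow-hom (evalʰ x) (g i ∷ []) p) (pow-cong A p (eval-const x (g i))))
               (trans (pow-hom (evalʰ x) (0# ∷ h i ∷ []) p)
                 (pow-cong A p (trans (+-identityˡ _) (*-congˡ (eval-const x (h i)))))))
               (*-congʳ (natR-hom (evalʰ x) p)) ⟩
        pow A (g i) p + pow A (x * h i) p + natR A p * eval x D ∎
        where open Hom (evalʰ x)

  -- Write f = g + x h. Over A[s] each coefficient for g + s h is gᵖ + (s h)ᵖ + p D(s), with one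
  -- polynomial D. Between s = x and s = 0 the term p D changes by a multiple of p x, and (x h)ᵖ is
  -- a multiple of x², hence of p x because p divides x. Frobenius applied to f and g separately
  -- would leave two unrelated error terms.
  powerSeries-lift : ∀ {p} → Prime p → ∀ d x x′ → x ≈ natR A p * x′ → ∀ f g →
    Monic A d f → Monic A d g → (∀ i → Quotient._≡ₘ_ A x (f i) (g i)) →
    ∀ i → Quotient._≡ₘ_ A (natR A p * x) (powerSeries d p f i) (powerSeries d p g i)
  powerSeries-lift {p} pp d x x′ x≈px′ f g (f₀ , f-deg) (g₀ , g-deg) f≡g i =
    Quotient.differBy δ (begin
      powerSeries d p f i
        ≈⟨ powerSeries~ (idʰ A) d p f≡g+xh i ⟩
      powerSeries d p (λ j → g j + x * h j) i
        ≈⟨ eval-W x ⟩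
      G + pow A (x * h i) p + P * eval x D
        ≈⟨ +-cong (+-congˡ (proj₂ divides-power)) (*-congˡ (proj₂ (eval-mod x D))) ⟩
      G + P * x * y + P * (coeff D 0 + x * z)
        -- The inserted 0 holds the place of the p-th power of 0 · h, so that the first bracket is
        -- `eval-W` at 0.
        ≈⟨ solve 6 (λ G p x y z e → G :+ p :* x :* y :+ p :* (e :+ x :* z)
                                  := (G :+ con (+ 0) :+ p :* e) :+ p :* x :* (y :+ z))
             refl G P x y z (coeff D 0) ⟩
      (G + 0# + P * coeff D 0) + P * x * δ
        ≈⟨ +-congʳ (+-cong (+-congˡ zero-power) (*-congˡ (eval-0 D))) ⟨
      (G + pow A (0# * h i) p + P * eval 0# D) + P * x * δ
        ≈⟨ +-congʳ (eval-W 0#) ⟨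
      powerSeries d p (λ j → g j + 0# * h j) i + P * x * δ
        ≈⟨ +-congʳ (powerSeries~ (idʰ A) d p (λ j → trans (+-congˡ (zeroˡ _)) (+-identityʳ (g j))) i) ⟩
      powerSeries d p g i + P * x * δ ∎)
    where
    P = natR A p

    -- The quotients supplied by the congruence are not determined when x is a zero divisor. At
    -- index 0 and beyond d, where f and g agree, they are replaced by 0, so that g + s h is monic
    -- of degree d over A[s].
    record Difference (i : ℕ) : Set where
      field
        value    : Carrier
        correct  : f i ≈ g i + x * value
        constant : i ≡ 0 → value ≈ 0#
        degree   : d < i → value ≈ 0#

    no-difference : ∀ {i} → f i ≈ g i → Difference i
    no-difference e = record
      { value = 0# ; correct = trans e (sym (trans (+-congˡ (zeroʳ x)) (+-identityʳ _)))
      ; constant = λ _ → refl ; degree = λ _ → refl }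

    difference : ∀ i → Difference i
    difference zero = no-difference (trans f₀ (sym g₀))
    difference (suc i) with suc i ≤? d
    ... | yes i≤d = record { value = quotient ; correct = equality
                           ; constant = λ () ; degree = λ d<i → ⊥-elim (ℕ.<⇒≱ d<i i≤d) }
      where open Quotient._≡ₘ_ (f≡g (suc i))
    ... | no i≰d  = no-difference (trans (f-deg _ (ℕ.≰⇒> i≰d)) (sym (g-deg _ (ℕ.≰⇒> i≰d))))

    h : ℕ → Carrier
    h i = Difference.value (difference i)

    f≡g+xh : ∀ i → f i ≈ g i + x * h i
    f≡g+xh i = Difference.correct (difference i)

    monic : Monic polyRing d (λ i → g i ∷ h i ∷ [])
    monic = top , λ i d<i → vanish (g-deg i d<i) (Difference.degree (difference i) d<i)
      where
      top : (g 0 ∷ h 0 ∷ []) ≋ (1# ∷ [])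
      top .at zero          = g₀
      top .at (suc zero)    = Difference.constant (difference 0) ≡.refl
      top .at (suc (suc i)) = refl
      vanish : ∀ {a b} → a ≈ 0# → b ≈ 0# → (a ∷ b ∷ []) ≋ []
      vanish e e′ .at zero          = e
      vanish e e′ .at (suc zero)    = e′
      vanish e e′ .at (suc (suc i)) = refl

    open Deform pp d g h monic i

    G = pow A (g i) p

    -- This is where p ≥ 2 enters: xᵖ is divisible by x², hence by p x.
    square-divides : ∀ q → 2 ≤ q → Σ[ y ∈ Carrier ] pow A (x * h i) q ≈ P * x * y
    square-divides (suc (suc q)) _ = x′ * h i * h i * r , (begin
      x * h i * (x * h i * r)         ≈⟨ *-congˡ (*-congʳ (*-congʳ x≈px′)) ⟩
      x * h i * (P * x′ * h i * r)    ≈⟨ solve 5 (λ x h x′ p r → x :* h :* (p :* x′ :* h :* r)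
                                                 := p :* x :* (x′ :* h :* h :* r)) refl x (h i) x′ P r ⟩
      P * x * (x′ * h i * h i * r)    ∎)
      where r = pow A (x * h i) q
    square-divides (suc zero) (s≤s ())

    2≤p : 2 ≤ p
    2≤p = ℕ.nonTrivial⇒n>1 p {{prime⇒nonTrivial pp}}

    divides-power = square-divides p 2≤p
    y = proj₁ divides-power
    z = proj₁ (eval-mod x D)
    δ = y + z

    zero-power : pow A (0# * h i) p ≈ 0#
    zero-power = go p 2≤p
      where
      go : ∀ q → 2 ≤ q → pow A (0# * h i) q ≈ 0#
      go (suc q) _ = trans (*-congʳ (zeroˡ _)) (zeroˡ _)

pow-+-exponent : (R : CommutativeRing c ℓ) → let open CommutativeRing R in
  ∀ x m n → pow R x (m ℕ.+ n) ≈ pow R x m * pow R x n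
pow-+-exponent R x zero    n = CommutativeRing.sym R (CommutativeRing.*-identityˡ R _)
pow-+-exponent R x (suc m) n = trans (*-congˡ (pow-+-exponent R x m n)) (sym (*-assoc x _ _))
  where open CommutativeRing R

pow-pow : (R : CommutativeRing c ℓ) → let open CommutativeRing R in
  ∀ x m n → pow R (pow R x m) n ≈ pow R x (n ℕ.* m)
pow-pow R x m zero    = CommutativeRing.refl R
pow-pow R x m (suc n) = trans (*-congˡ (pow-pow R x m n)) (sym (pow-+-exponent R x m (n ℕ.* m)))
  where open CommutativeRing R

≡ₘ-modulus : (A : CommutativeRing c ℓ) → let open CommutativeRing A in
  ∀ {d e x y} → d ≈ e → Quotient._≡ₘ_ A d x y → Quotient._≡ₘ_ A e x y
≡ₘ-modulus A d≈e (Quotient.differBy q eq) = Quotient.differBy q (trans eq (+-congˡ (*-congʳ d≈e)))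
  where open CommutativeRing A

series-pointwise : (R : CommutativeRing c ℓ) → let open CommutativeRing R; open Series R in
  ∀ {L M} → Listwise _≈_ L M → series L ≗ series M
series-pointwise R []      i = CommutativeRing.refl R
series-pointwise R (e ∷ p) i = Series.lin-cong R e (series-pointwise R p) i

-- The resultant of two lists of roots

module _ (R : CommutativeRing c ℓ) where
  open CommutativeRing R
  open Polynomials R
  open Series R
  open Solver R
  open SetoidReasoning setoid

  eval-hornerPoly-cong : ∀ x d {s s′} → s ≗ s′ → eval x (hornerPoly s d) ≈ eval x (hornerPoly s′ d)
  eval-hornerPoly-cong x zero    e = +-congʳ (e 0)
  eval-hornerPoly-cong x (suc d) e = +-cong (e (suc d)) (*-congˡ (eval-hornerPoly-cong x d e))

  private
    eval-hornerPoly-lin : ∀ x y s d → eval x (hornerPoly (lin y s) (suc d))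
      ≈ eval x (hornerPoly s (suc d)) - y * eval x (hornerPoly s d)
    eval-hornerPoly-lin x y s zero    =
      solve 4 (λ x y a b → (b :- y :* a) :+ x :* (a :+ x :* con (+ 0))
                        := (b :+ x :* (a :+ x :* con (+ 0))) :- y :* (a :+ x :* con (+ 0)))
        refl x y (s 0) (s 1)
    eval-hornerPoly-lin x y s (suc d) = trans (+-congˡ (*-congˡ (eval-hornerPoly-lin x y s d)))
      (solve 5 (λ x y a b u → (b :- y :* a) :+ x :* ((a :+ x :* u) :- y :* u)
                          := (b :+ x :* (a :+ x :* u)) :- y :* (a :+ x :* u))
        refl x y (s (suc d)) (s (suc (suc d))) (eval x (hornerPoly s d)))

  eval-hornerPoly-series : ∀ x L →
    eval x (hornerPoly (series L) (List.length L)) ≈ prodR R (List.map (λ y → x + - y) L)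
  eval-hornerPoly-series x []      = trans (+-congˡ (zeroʳ x)) (+-identityʳ _)
  eval-hornerPoly-series x (y ∷ L) = begin
    eval x (hornerPoly (lin y (series L)) (suc d))
      ≈⟨ eval-hornerPoly-lin x y (series L) d ⟩
    (series L (suc d) + x * E) - y * E
      ≈⟨ +-congʳ (+-congʳ (series-> L (suc d) ℕ.≤-refl)) ⟩
    (0# + x * E) - y * E
      ≈⟨ solve 3 (λ x y e → (con (+ 0) :+ x :* e) :- y :* e := (x :- y) :* e) refl x y E ⟩
    (x - y) * E
      ≈⟨ *-congˡ (eval-hornerPoly-series x L) ⟩
    (x - y) * prodR R (List.map (λ y → x + - y) L) ∎
    where
    d = List.length L
    E = eval x (hornerPoly (series L) d)

  eval-hornerPoly-linear : ∀ x s n h d →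
    eval x (hornerPoly (λ i → s i + n * h i) d) ≈ eval x (hornerPoly s d) + n * eval x (hornerPoly h d)
  eval-hornerPoly-linear x s n h zero =
    solve 4 (λ s n h x → (s :+ n :* h) :+ x :* con (+ 0) := (s :+ x :* con (+ 0)) :+ n :* (h :+ x :* con (+ 0)))
      refl (s 0) n (h 0) x
  eval-hornerPoly-linear x s n h (suc d) = trans (+-congˡ (*-congˡ (eval-hornerPoly-linear x s n h d)))
    (solve 6 (λ s n h x u v → (s :+ n :* h) :+ x :* (u :+ n :* v) := (s :+ x :* u) :+ n :* (h :+ x :* v))
      refl (s (suc d)) n (h (suc d)) x _ _)

  resRoots-prod : ∀ as bs →
    resRoots R as bs ≈ prodR R (List.map (λ x → prodR R (List.map (λ y → x + - y) bs)) as)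
  resRoots-prod []       bs = refl
  resRoots-prod (x ∷ as) bs = trans (prodR-++ R (List.map (λ y → x + - y) bs) _)
    (*-congˡ (resRoots-prod as bs))

  prodR-scale : ∀ n (F G : Carrier → Carrier) L → All (λ x → F x ≈ n * G x) L →
    prodR R (List.map F L) ≈ pow R n (List.length L) * prodR R (List.map G L)
  prodR-scale n F G []      []      = sym (*-identityˡ _)
  prodR-scale n F G (x ∷ L) (e ∷ es) = trans (*-cong e (prodR-scale n F G L es))
    (solve 4 (λ n g p q → (n :* g) :* (p :* q) := (n :* p) :* (g :* q)) refl n (G x) _ _)

  private
    prodR-root : ∀ {x L} → x ∈ L → prodR R (List.map (λ y → x + - y) L) ≈ 0#
    prodR-root (here ≡.refl) = trans (*-congʳ (-‿inverseʳ _)) (zeroˡ _)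
    prodR-root (there x∈L)   = trans (*-congˡ (prodR-root x∈L)) (zeroʳ _)

  -- At an entry of `L` the polynomial of `L` vanishes, which leaves a multiple of n. The equal
  -- lengths matter: a congruence of series becomes one of polynomials only if both are reversed in
  -- the same degree.
  resRoots-scale : ∀ L M n h → List.length L ≡ List.length M →
    (∀ i → series M i ≈ series L i + n * h i) →
    resRoots R L M ≈ pow R n (List.length L) *
      prodR R (List.map (λ x → eval x (hornerPoly h (List.length L))) L)
  resRoots-scale L M n h |L|≡|M| e = trans (resRoots-prod L M)
    (prodR-scale n _ _ L (All.tabulate λ {x} x∈L → begin
      prodR R (List.map (λ y → x + - y) M)
        ≈⟨ eval-hornerPoly-series x M ⟨
      eval x (hornerPoly (series M) (List.length M))
        ≡⟨ ≡.cong (λ d → eval x (hornerPoly (series M) d)) |L|≡|M| ⟨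
      eval x (hornerPoly (series M) (List.length L))
        ≈⟨ eval-hornerPoly-cong x (List.length L) e ⟩
      eval x (hornerPoly (λ i → series L i + n * h i) (List.length L))
        ≈⟨ eval-hornerPoly-linear x (series L) n h (List.length L) ⟩
      eval x (hornerPoly (series L) (List.length L)) + n * eval x (hornerPoly h (List.length L))
        ≈⟨ +-congʳ (trans (eval-hornerPoly-series x L) (prodR-root x∈L)) ⟩
      0# + n * eval x (hornerPoly h (List.length L))
        ≈⟨ +-identityˡ _ ⟩
      n * eval x (hornerPoly h (List.length L)) ∎))

-- Lists of roots whose series is defined over a subring A

module Rationality (A : CommutativeRing 0ℓ 0ℓ) (R : CommutativeRing c ℓ)
  (φ : Hom A R) (injective : Injective φ) where
  private
    module A = CommutativeRing A
  open CommutativeRing R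
  open Hom φ
  open Series R

  Rational : List Carrier → (ℕ → A.Carrier) → Set ℓ
  Rational L s = ∀ i → fun (s i) ≈ series L i

  rational-monic : ∀ L s → Rational L s → Monic A (List.length L) s
  rational-monic L s r = injective (trans (r 0) (trans (series-0 L) (sym 1-homo))) ,
    λ i d<i → injective (trans (r i) (trans (series-> L i d<i) (sym 0-homo)))

  rational-unique : ∀ L M {s s′} → series L ≗ series M → Rational L s → Rational M s′ → ∀ i → s i A.≈ s′ i
  rational-unique L M e r r′ i = injective (trans (r i) (trans (e i) (sym (r′ i))))

  rational-powers : ∀ q L s → Rational L s →
    Rational (powers R q L) (RootOperations.powerSeries A (List.length L) q s)
  rational-powers q L s r i = trans (powerSeries~ φ (List.length L) q {s′ = fun ∘ s} (λ _ → refl) i)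
    (series-powers R q (fun ∘ s) L r i)

  rational-tensor : ∀ L s M e → Rational L s → Rational M e →
    Rational (tensor R L M) (RootOperations.tensorSeries A (List.length L) s (List.length M) e)
  rational-tensor L s M e r r′ i = trans
    (tensorSeries~ φ (List.length L) {s′ = fun ∘ s} (List.length M) {e′ = fun ∘ e} (λ _ → refl) (λ _ → refl) i)
    (series-tensor R (fun ∘ s) L (fun ∘ e) M r r′ i)

  resultant-divisible : ∀ L M s e n → List.length L ≡ List.length M →
    Rational L s → Rational M e → (∀ i → Quotient._≡ₘ_ A n (e i) (s i)) →
    Σ[ r ∈ A.Carrier ] fun (pow A n (List.length L) A.* r) ≈ resRoots R L M
  resultant-divisible L M s e n |L|≡|M| rL rM e≡s = r , (begin
    fun (pow A n d A.* r)
      ≈⟨ trans (*-homo _ _) (*-congʳ (pow-hom φ n d)) ⟩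
    pow R (fun n) d * fun r
      ≈⟨ *-congˡ (res~ φ d _ (Polynomials.hornerPoly R (fun ∘ h) d) (λ _ → refl) (horner~ d)) ⟩
    pow R (fun n) d * Resultant.res R d (fun ∘ s) (Polynomials.hornerPoly R (fun ∘ h) d)
      ≈⟨ *-congˡ (res-roots R (fun ∘ s) L _ rL) ⟩
    pow R (fun n) d * prodR R (List.map (λ x → Polynomials.eval R x (Polynomials.hornerPoly R (fun ∘ h) d)) L)
      ≈⟨ resRoots-scale R L M (fun n) (fun ∘ h) |L|≡|M| difference ⟨
    resRoots R L M ∎)
    where
    open SetoidReasoning setoid
    d = List.length L
    h : ℕ → A.Carrier
    h i = Quotient._≡ₘ_.quotient (e≡s i)
    -- The product over `L` of the values of the quotient polynomial, obtained inside `A` as a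
    -- determinant.
    r = Resultant.res A d s (Polynomials.hornerPoly A h d)
    horner~ : ∀ d → _~_ φ (Polynomials.coeff A (Polynomials.hornerPoly A h d)) (Polynomials.coeff R (Polynomials.hornerPoly R (fun ∘ h) d))
    horner~ zero    zero    = refl
    horner~ zero    (suc i) = 0-homo
    horner~ (suc d) zero    = refl
    horner~ (suc d) (suc i) = horner~ d i
    difference : ∀ i → series M i ≈ series L i + fun n * fun (h i)
    difference i = begin
      series M i                    ≈⟨ rM i ⟨
      fun (e i)                     ≈⟨ cong (Quotient._≡ₘ_.equality (e≡s i)) ⟩
      fun (s i A.+ n A.* h i)       ≈⟨ trans (+-homo _ _) (+-cong (rL i) (*-homo _ _)) ⟩
      series L i + fun n * fun (h i) ∎

  module _ {p : ℕ} (pp : Prime p)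
    (base : ∀ d s → Monic A d s →
      ∀ i → Quotient._≡ₘ_ A (natR A p) (RootOperations.powerSeries A d p s i) (s i)) where

    private
      -- The p-th power is taken k times, instead of using the formula for pᵏ, because congruences
      -- are lifted one p-th power at a time. The degree stays d, since powers do not change the
      -- number of roots.
      iterated : ℕ → (ℕ → A.Carrier) → ℕ → ℕ → A.Carrier
      iterated d s zero    = s
      iterated d s (suc k) = RootOperations.powerSeries A d p (iterated d s k)

      rational-iterated : ∀ L s → Rational L s → ∀ k →
        Rational (powers R (p ℕ.^ k) L) (iterated (List.length L) s k)
      rational-iterated L s r zero    i = trans (r i) (series-pointwise R (unit L) i)
        where
        unit : ∀ L → Listwise _≈_ L (powers R 1 L)
        unit []      = []
        unit (x ∷ L) = sym (*-identityʳ x) ∷ unit L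
      rational-iterated L s r (suc k) i = trans
        (≡.subst (λ d → Rational (powers R p (powers R (p ℕ.^ k) L))
            (RootOperations.powerSeries A d p (iterated (List.length L) s k)))
          (List.length-map _ L)
          (rational-powers p (powers R (p ℕ.^ k) L) _ (rational-iterated L s r k)) i)
        (series-pointwise R (compose L) i)
        where
        compose : ∀ L → Listwise _≈_ (powers R p (powers R (p ℕ.^ k) L)) (powers R (p ℕ.^ suc k) L)
        compose []      = []
        compose (x ∷ L) = pow-pow R x (p ℕ.^ k) p ∷ compose L

      monic-iterated : ∀ L s → Rational L s → ∀ k → Monic A (List.length L) (iterated (List.length L) s k)
      monic-iterated L s r k = ≡.subst (λ d → Monic A d (iterated (List.length L) s k)) (List.length-map _ L)
        (rational-monic (powers R (p ℕ.^ k) L) _ (rational-iterated L s r k))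

      iterated-congruent : ∀ L s → Rational L s → ∀ k i →
        Quotient._≡ₘ_ A (pow A (natR A p) (suc k))
          (iterated (List.length L) s (suc k) i) (iterated (List.length L) s k i)
      iterated-congruent L s r zero    i =
        ≡ₘ-modulus A (A.sym (A.*-identityʳ _)) (base _ s (rational-monic L s r) i)
      iterated-congruent L s r (suc k) i = powerSeries-lift A pp (List.length L)
        (pow A (natR A p) (suc k)) (pow A (natR A p) k) A.refl _ _
        (monic-iterated L s r (suc k)) (monic-iterated L s r k)
        (iterated-congruent L s r k) i

    -- Both series come from one formula whose inputs agree in A/(pᵏ⁺¹): the exponent moves down
    -- from k + 1 to k in L and up from k to k + 1 in M. Naturality along the projection equates the
    -- outputs.
    tensor-congruent : ∀ L s M e → Rational L s → Rational M e → ∀ k →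
      ∃₂ λ s₊ s₋ →
        Rational (tensor R (powers R (p ℕ.^ suc k) L) (powers R (p ℕ.^ k) M)) s₊ ×
        Rational (tensor R (powers R (p ℕ.^ k) L) (powers R (p ℕ.^ suc k) M)) s₋ ×
        ∀ i → Quotient._≡ₘ_ A (pow A (natR A p) (suc k)) (s₊ i) (s₋ i)
    tensor-congruent L s M e r r′ k = _ , _ , rational (suc k) k , rational k (suc k) ,
      λ i → Q.trans
        (tensorSeries~ projectʰ (List.length L) (List.length M)
          (iterated-congruent L s r k) (λ j → Q.sym (iterated-congruent M e r′ k j)) i)
        (Q.sym (tensorSeries~ projectʰ (List.length L) (List.length M) (λ _ → Q.refl) (λ _ → Q.refl) i))
      where
      open Quotient A (pow A (natR A p) (suc k)) using (projectʰ; quotientRing)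
      module Q = CommutativeRing quotientRing
      rational : ∀ j k → Rational (tensor R (powers R (p ℕ.^ j) L) (powers R (p ℕ.^ k) M))
        (RootOperations.tensorSeries A (List.length L) (iterated (List.length L) s j)
          (List.length M) (iterated (List.length M) e k))
      rational j k i = trans
        (reflexive (≡.cong₂ (λ d d′ → fun (RootOperations.tensorSeries A d (iterated (List.length L) s j) d′
            (iterated (List.length M) e k) i))
          (≡.sym (List.length-map _ L)) (≡.sym (List.length-map _ M))))
        (rational-tensor (powers R (p ℕ.^ j) L) _ (powers R (p ℕ.^ k) M) _
          (rational-iterated L s r j) (rational-iterated M e r′ k) i)

-- Lists of roots up to permutation.

module ProductRoots (R : CommutativeRing c ℓ) where
  open CommutativeRing R hiding (refl; trans)
  open Series R
  open SetoidPerm setoid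
  open SetoidPermProperties setoid using (++⁺; ++⁺ˡ; shifts; map⁺)

  -- Linear factors commute. The entries are compared by `≈`, because powers and products of roots
  -- are regrouped by the ring laws.
  series-↭ : ∀ {L M} → L ↭ M → series L ≗ series M
  series-↭ (refl p)     i = series-pointwise R p i
  series-↭ (prep e p)   i = lin-cong e (series-↭ p) i
  series-↭ (swap {ys = M} {x} {y} e f p) i =
    CommutativeRing.trans R (lin-comm x y _ i) (lin-cong f (lin-cong e (series-↭ p)) i)
  series-↭ (trans p q)  i = CommutativeRing.trans R (series-↭ p i) (series-↭ q i)

  private
    map-*-cong : ∀ {x y} M → x ≈ y → List.map (x *_) M ↭ List.map (y *_) M
    map-*-cong M e = refl (Listwise.map⁺ _ _ (Listwise.refl (*-congʳ e) {M}))

  powers-cong : ∀ q {L M} → L ↭ M → powers R q L ↭ powers R q M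
  powers-cong q = map⁺ setoid (pow-cong R q)

  tensor-congʳ : ∀ L {M N} → M ↭ N → tensor R L M ↭ tensor R L N
  tensor-congʳ []      p = ↭-refl
  tensor-congʳ (x ∷ L) p = ++⁺ (map⁺ setoid *-congˡ p) (tensor-congʳ L p)

  tensor-congˡ : ∀ {L M} N → L ↭ M → tensor R L N ↭ tensor R M N
  tensor-congˡ N (refl [])      = ↭-refl
  tensor-congˡ N (refl (e ∷ p)) = ++⁺ (map-*-cong N e) (tensor-congˡ N (refl p))
  tensor-congˡ N (prep e p)     = ++⁺ (map-*-cong N e) (tensor-congˡ N p)
  tensor-congˡ N (swap {x = x} {y} e f p) = ↭-trans
    (shifts (List.map (x *_) N) (List.map (y *_) N))
    (++⁺ (map-*-cong N f) (++⁺ (map-*-cong N e) (tensor-congˡ N p)))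
  tensor-congˡ N (trans p q)    = trans (tensor-congˡ N p) (tensor-congˡ N q)

  private
    tensor-map : ∀ x M N → tensor R (List.map (x *_) M) N ↭ List.map (x *_) (tensor R M N)
    tensor-map x []      N = ↭-refl
    tensor-map x (y ∷ M) N = ↭-trans
      (++⁺ (refl (assoc N)) (tensor-map x M N))
      (↭-reflexive (≡.sym (List.map-++ (x *_) (List.map (y *_) N) (tensor R M N))))
      where
      assoc : ∀ N → Listwise _≈_ (List.map ((x * y) *_) N) (List.map (x *_) (List.map (y *_) N))
      assoc []      = []
      assoc (z ∷ N) = *-assoc x y z ∷ assoc N

  tensor-assoc : ∀ L M N → tensor R (tensor R L M) N ↭ tensor R L (tensor R M N)
  tensor-assoc []      M N = ↭-refl
  tensor-assoc (x ∷ L) M N = ↭-trans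
    (↭-reflexive (List.concatMap-++ (λ y → List.map (y *_) N) (List.map (x *_) M) (tensor R L M)))
    (++⁺ (tensor-map x M N) (tensor-assoc L M N))

  tensor-comm : ∀ L M → tensor R L M ↭ tensor R M L
  tensor-comm []      []      = ↭-refl
  tensor-comm []      (y ∷ M) = tensor-comm [] M
  tensor-comm (x ∷ L) M       = ↭-trans (++⁺ˡ (List.map (x *_) M) (tensor-comm L M)) (unfold M)
    where
    unfold : ∀ M → List.map (x *_) M ++ tensor R M L ↭ tensor R M (x ∷ L)
    unfold []      = ↭-refl
    unfold (y ∷ M) = prep (*-comm x y) (↭-trans
      (shifts (List.map (x *_) M) (List.map (y *_) L))
      (++⁺ˡ (List.map (y *_) L) (unfold M)))

  tensor-swap : ∀ L M N → tensor R L (tensor R M N) ↭ tensor R M (tensor R L N)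
  tensor-swap L M N = ↭-trans (↭-sym (tensor-assoc L M N))
    (↭-trans (tensor-congˡ N (tensor-comm L M)) (tensor-assoc M L N))

  powers-tensor : ∀ q L M → powers R q (tensor R L M) ↭ tensor R (powers R q L) (powers R q M)
  powers-tensor q []      M = ↭-refl
  powers-tensor q (x ∷ L) M = ↭-trans
    (↭-reflexive (List.map-++ (λ y → pow R y q) (List.map (x *_) M) (tensor R L M)))
    (++⁺ (refl (scaled M)) (powers-tensor q L M))
    where
    scaled : ∀ M → Listwise _≈_ (powers R q (List.map (x *_) M)) (List.map (pow R x q *_) (powers R q M))
    scaled []      = []
    scaled (y ∷ M) = pow-* R x y q ∷ scaled M

  length-tensor : ∀ L M → List.length (tensor R L M) ≡ List.length L ℕ.* List.length M
  length-tensor []      M = ≡.refl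
  length-tensor (x ∷ L) M = ≡.trans (List.length-++ (List.map (x *_) M))
    (≡.cong₂ ℕ._+_ (List.length-map _ M) (length-tensor L M))

  module _ {d : ℕ} (α : Fin d → Carrier) where

    roots : List Carrier
    roots = List.tabulate α

    rootsP-∷ : ∀ n N → rootsP R α (n ∷ N) ≡ tensor R (powers R n roots) (rootsP R α N)
    rootsP-∷ n N = ≡.cong List.concat (≡.trans (List.map-tabulate (λ j → j) _)
      (≡.sym (≡.trans (≡.cong (List.map (λ x → List.map (x *_) (rootsP R α N))) (List.map-tabulate α _))
        (List.map-tabulate (λ j → pow R (α j) n) _))))

    length-rootsP : ∀ N → List.length (rootsP R α N) ≡ d ^ List.length N
    length-rootsP []      = ≡.refl
    length-rootsP (n ∷ N) = ≡.trans (≡.cong List.length (rootsP-∷ n N))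
      (≡.trans (length-tensor (powers R n roots) (rootsP R α N))
      (≡.cong₂ ℕ._*_ (≡.trans (List.length-map _ roots) (List.length-tabulate α)) (length-rootsP N)))

    rootsP-∷-cong : ∀ n N {X} → rootsP R α N ↭ X → rootsP R α (n ∷ N) ↭ tensor R (powers R n roots) X
    rootsP-∷-cong n N p = ↭-trans (↭-reflexive (rootsP-∷ n N)) (tensor-congʳ (powers R n roots) p)

    rootsP-↭ : ∀ {N N′} → N Perm.↭ N′ → rootsP R α N ↭ rootsP R α N′
    rootsP-↭ Perm.refl = ↭-refl
    rootsP-↭ {n ∷ N} {_ ∷ N′} (Perm.prep _ p) =
      ↭-trans (rootsP-∷-cong n N (rootsP-↭ p)) (↭-reflexive (≡.sym (rootsP-∷ n N′)))
    rootsP-↭ {m ∷ n ∷ N} {_ ∷ _ ∷ N′} (Perm.swap _ _ p) =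
      ↭-trans (rootsP-∷-cong m (n ∷ N) (rootsP-∷-cong n N (rootsP-↭ p)))
      (↭-trans (tensor-swap (powers R m roots) (powers R n roots) (rootsP R α N′))
      (↭-sym (rootsP-∷-cong n (m ∷ N′) (rootsP-∷-cong m N′ ↭-refl))))
    rootsP-↭ (Perm.trans p q) = ↭-trans (rootsP-↭ p) (rootsP-↭ q)

    rootsP-++ : ∀ N N′ → rootsP R α (N ++ N′) ↭ tensor R (rootsP R α N) (rootsP R α N′)
    rootsP-++ []      N′ = ↭-sym (↭-trans (↭-reflexive (List.++-identityʳ _)) (refl (units (rootsP R α N′))))
      where
      units : ∀ L → Listwise _≈_ (List.map (1# *_) L) L
      units []      = []
      units (x ∷ L) = *-identityˡ x ∷ units L
    rootsP-++ (n ∷ N) N′ = ↭-trans (rootsP-∷-cong n (N ++ N′) (rootsP-++ N N′))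
      (↭-trans (↭-sym (tensor-assoc (powers R n roots) (rootsP R α N) (rootsP R α N′)))
      (tensor-congˡ (rootsP R α N′) (↭-reflexive (≡.sym (rootsP-∷ n N)))))

    rootsP-scale : ∀ q N → rootsP R α (List.map (q ℕ.*_) N) ↭ powers R q (rootsP R α N)
    rootsP-scale q []      = refl (sym (pow-1 R q) ∷ [])
    rootsP-scale q (n ∷ N) = ↭-trans (rootsP-∷-cong (q ℕ.* n) (List.map (q ℕ.*_) N) (rootsP-scale q N))
      (↭-trans (tensor-congˡ (powers R q (rootsP R α N)) (refl (composed roots)))
      (↭-trans (↭-sym (powers-tensor q (powers R n roots) (rootsP R α N)))
      (powers-cong q (↭-reflexive (≡.sym (rootsP-∷ n N))))))
      where
      composed : ∀ L → Listwise _≈_ (powers R (q ℕ.* n) L) (powers R q (powers R n L))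
      composed []      = []
      composed (x ∷ L) = sym (pow-pow R x n q) ∷ composed L

    -- Concatenating exponent lists corresponds to `tensor`, and multiplying all exponents by q to
    -- `powers R q`; so a decomposition of the divisors becomes one of the roots.
    rootsP-lifted : ∀ {D} E F q r → D Perm.↭ List.map (q ℕ.*_) E ++ List.map (r ℕ.*_) F →
      rootsP R α D ↭ tensor R (powers R q (rootsP R α E)) (powers R r (rootsP R α F))
    rootsP-lifted E F q r p = ↭-trans (rootsP-↭ p) (↭-trans (rootsP-++ (List.map (q ℕ.*_) E) _)
      (↭-trans (tensor-congˡ (rootsP R α (List.map (r ℕ.*_) F)) (rootsP-scale q E))
        (tensor-congʳ (powers R q (rootsP R α E)) (rootsP-scale r F))))

-- The series of the roots of P in terms of its coefficients.

lookup-∷ʳ : ∀ {A : Set c} {n} (v : Vec A n) x (i : Fin (suc n)) →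
  (∃ λ j → toℕ i ≡ toℕ j × lookup (v ∷ʳ x) i ≡ lookup v j) ⊎ (toℕ i ≡ n × lookup (v ∷ʳ x) i ≡ x)
lookup-∷ʳ []      x Fin.zero    = inj₂ (≡.refl , ≡.refl)
lookup-∷ʳ (y ∷ v) x Fin.zero    = inj₁ (Fin.zero , ≡.refl , ≡.refl)
lookup-∷ʳ (y ∷ v) x (Fin.suc i) with lookup-∷ʳ v x i
... | inj₁ (j , e , e′) = inj₁ (Fin.suc j , ≡.cong suc e , e′)
... | inj₂ (e , e′)     = inj₂ (≡.cong suc e , e′)

module _ (R : CommutativeRing c ℓ) where
  open CommutativeRing R
  open Series R
  open ProductRoots R using (roots)

  -- The vector starts with the lowest degree and the series with the leading coefficient, which
  -- explains the index `d ∸ toℕ i`.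
  lookup-linProd : ∀ {d} (α : Fin d → Carrier) i → lookup (linProd R α) i ≈ series (roots α) (d ∸ toℕ i)
  lookup-linProd {zero}  α Fin.zero = refl
  lookup-linProd {suc d} α i = trans (reflexive (Vec.lookup-zipWith _ i (0# ∷ v) (Vec.map (x *_) v ∷ʳ 0#))) (trans
    (+-cong (shifted i) refl) (tail i))
    where
    x = α Fin.zero
    L = roots (λ j → α (Fin.suc j))
    v = linProd R (λ j → α (Fin.suc j))
    |L| : List.length L ≡ d
    |L| = List.length-tabulate (λ j → α (Fin.suc j))
    shifted : ∀ i → lookup (0# ∷ v) i ≈ series L (suc d ∸ toℕ i)
    shifted Fin.zero    = sym (series-> L (suc d) (s≤s (ℕ.≤-reflexive |L|)))
    shifted (Fin.suc i) = lookup-linProd (λ j → α (Fin.suc j)) i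
    tail : ∀ i → series L (suc d ∸ toℕ i) - lookup (Vec.map (x *_) v ∷ʳ 0#) i ≈ lin x (series L) (suc d ∸ toℕ i)
    tail i with lookup-∷ʳ (Vec.map (x *_) v) 0# i
    ... | inj₁ (j , i≡j , e) rewrite i≡j | e | ℕ.+-∸-assoc 1 (ℕ.≤-pred (Fin.toℕ<n j)) =
      +-congˡ (-‿cong (trans (reflexive (Vec.lookup-map j (x *_) v))
        (*-congˡ (lookup-linProd (λ j → α (Fin.suc j)) j))))
    -- The leading coefficient is the constant term of the series, from which `lin` subtracts
    -- nothing; this matches the appended zero.
    ... | inj₂ (i≡ , e) rewrite i≡ | e | ℕ.n∸n≡0 d =
      trans (+-congˡ -0#≈0#) (+-identityʳ _)
      where open RingProperties ring using (-0#≈0#)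

  lookup-monicCoeffs : ∀ {d} (p : Vec ℤ d) i → lookup (monicCoeffs R p) i ≈ ι R (lookup (p ∷ʳ + 1) i)
  lookup-monicCoeffs []      Fin.zero    = sym (+-identityʳ 1#)
  lookup-monicCoeffs (x ∷ p) Fin.zero    = refl
  lookup-monicCoeffs (x ∷ p) (Fin.suc i) = lookup-monicCoeffs p i

  -- The coefficients of tᵈ P(1/t). The case beyond d is separate because the truncated difference
  -- `d ∸ i` would repeat the constant coefficient of P there.
  reversed : ∀ {d} → Vec ℤ d → ℕ → ℤ
  reversed {d} p i with i ≤? d
  ... | yes _ = lookup (p ∷ʳ + 1) (Fin.fromℕ< (s≤s (ℕ.m∸n≤m d i)))
  ... | no  _ = + 0

  ι-reversed : ∀ {d} (p : Vec ℤ d) (α : Fin d → Carrier) →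
    Pointwise _≈_ (linProd R α) (monicCoeffs R p) →
    ∀ i → ι R (reversed p i) ≈ series (roots α) i
  ι-reversed {d} p α e i with i ≤? d
  ... | yes i≤d = trans (sym (lookup-monicCoeffs p j)) (trans (sym (VecPointwise.lookup e j))
    (trans (lookup-linProd α j) (reflexive (≡.cong (series (roots α))
      (≡.trans (≡.cong (d ∸_) (Fin.toℕ-fromℕ< (s≤s (ℕ.m∸n≤m d i)))) (ℕ.m∸[m∸n]≡n i≤d))))))
    where
    j : Fin (suc d)
    j = Fin.fromℕ< (s≤s (ℕ.m∸n≤m d i))
  ... | no i≰d = sym (series-> (roots α) i (≡.subst (_< i) (≡.sym (List.length-tabulate α)) (ℕ.≰⇒> i≰d)))

-- From congruences modulo prime powers to the divisibility of U(n).

pow-pos : ∀ n k → pow ℤᴿ (+ n) k ≡ + (n ^ k)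
pow-pos n zero    = ≡.refl
pow-pos n (suc k) = ≡.trans (≡.cong (ℤ._*_ (+ n)) (pow-pos n k)) (≡.sym (ℤ.pos-* n (n ^ k)))

∣⇒≡ₘ : ∀ {n} x y → n ℕ∣.∣ ℤ.∣ x ℤ.- y ∣ → Quotient._≡ₘ_ ℤᴿ (+ n) x y
∣⇒≡ₘ {n} x y h = Quotient.differBy quotient
  (≡.trans (solve 2 (λ x y → x := y :+ (x :- y)) ≡.refl x y)
    (≡.cong (ℤ._+_ y) (≡.trans equality (ℤ.*-comm quotient (+ n)))))
  where
  open Signed._∣_ (Signed.∣ᵤ⇒∣ {+ n} {x ℤ.- y} h)
  open Solver ℤᴿ

≡ₘ⇒∣ : ∀ {n} x y → Quotient._≡ₘ_ ℤᴿ (+ n) y x → n ℕ∣.∣ ℤ.∣ x ℤ.- y ∣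
≡ₘ⇒∣ {n} x y (Quotient.differBy q e) = Signed.∣⇒∣ᵤ {+ n} {x ℤ.- y} (Signed.divides (ℤ.- q)
  (≡.trans (≡.cong (ℤ._-_ x) e) (solve 3 (λ x n q → x :- (x :+ n :* q) := (:- q) :* n) ≡.refl x (+ n) q)))
  where open Solver ℤᴿ

module RationalRoots (A : CommutativeRing 0ℓ 0ℓ) (R : CommutativeRing c ℓ)
  (φ : Hom A R) (injective : Injective φ) where
  open CommutativeRing R
  open Rationality A R φ injective
  open ProductRoots R
  private
    module A = CommutativeRing A

  rootsP-rational : ∀ {d} (α : Fin d → Carrier) → ∃ (Rational (roots α)) →
    ∀ N → ∃ (Rational (rootsP R α N))
  rootsP-rational α r []      = Series.series A (A.1# ∷ []) , λ i →
    trans (series~ φ (A.1# ∷ []) i) (series-pointwise R (Hom.1-homo φ ∷ []) i)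
  rootsP-rational α r (m ∷ N) = ≡.subst (λ L → ∃ (Rational L)) (≡.sym (rootsP-∷ α m N))
    (_ , rational-tensor (powers R m (roots α)) _ (rootsP R α N) _
      (rational-powers m (roots α) (proj₁ r) (proj₂ r)) (proj₂ (rootsP-rational α r N)))

  -- The series `s` and `e` are arbitrary instead of being built from p, because the congruences for
  -- the different primes of n must concern the same coefficients. `rational-unique` identifies them
  -- with the series of `tensor-congruent`.
  Dplus≡Dminus : ∀ {p} → Prime p →
    (∀ d s → Monic A d s → ∀ i → Quotient._≡ₘ_ A (natR A p) (RootOperations.powerSeries A d p s i) (s i)) →
    ∀ {d} (α : Fin d → Carrier) → ∃ (Rational (roots α)) →
    ∀ n k m → n ≡ p ^ suc k ℕ.* m → ¬ p ℕ∣.∣ m →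
    ∀ s e → Rational (rootsP R α (Dplus n)) s → Rational (rootsP R α (Dminus n)) e →
    ∀ i → Quotient._≡ₘ_ A (pow A (natR A p) (suc k)) (s i) (e i)
  Dplus≡Dminus {p} pp base α r n k m ≡.refl p∤m s e rs re i =
    Q.trans (≈⇒≡ₘ (rational-unique (rootsP R α (Dplus n)) (tensor R (powers R (p ^ suc k) X) (powers R (p ^ k) Y)) (series-↭ L↭) rs r₊ i))
      (Q.trans (s₊≡s₋ i) (≈⇒≡ₘ (A.sym (rational-unique (rootsP R α (Dminus n)) (tensor R (powers R (p ^ k) X) (powers R (p ^ suc k) Y)) (series-↭ M↭) re r₋ i))))
    where
    open Quotient A (pow A (natR A p) (suc k)) using (≈⇒≡ₘ; quotientRing)
    module Q = CommutativeRing quotientRing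
    open SetoidPerm setoid using (_↭_)
    X = rootsP R α (Dplus m)
    Y = rootsP R α (Dminus m)
    L↭ : rootsP R α (Dplus n) ↭ tensor R (powers R (p ^ suc k) X) (powers R (p ^ k) Y)
    L↭ = rootsP-lifted α (Dplus m) (Dminus m) (p ^ suc k) (p ^ k) (Divisors-prime-power pp k m p∤m (+ 1) (λ ()))
    M↭ : rootsP R α (Dminus n) ↭ tensor R (powers R (p ^ k) X) (powers R (p ^ suc k) Y)
    -- The two parts of D₋(n) are exchanged so that D₊(m) supplies the first tensor factor for both
    -- lists, as `tensor-congruent` expects.
    M↭ = rootsP-lifted α (Dplus m) (Dminus m) (p ^ k) (p ^ suc k) (Perm.↭-trans (Divisors-prime-power pp k m p∤m (ℤ.- (+ 1)) (λ ()))
      (Perm.++-comm (List.map (p ^ suc k ℕ.*_) (Dminus m)) (List.map (p ^ k ℕ.*_) (Dplus m))))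
    congruence = tensor-congruent pp base X _ Y _
      (proj₂ (rootsP-rational α r (Dplus m))) (proj₂ (rootsP-rational α r (Dminus m))) k
    r₊ = proj₁ (proj₂ (proj₂ congruence))
    r₋ = proj₁ (proj₂ (proj₂ (proj₂ congruence)))
    s₊≡s₋ = proj₂ (proj₂ (proj₂ (proj₂ congruence)))

-- Each difference of coefficients is divisible by every exact prime power of n; absolute values
-- reduce this to `prime-powers-∣` in ℕ.
combine-prime-powers : ∀ n → 0 < n → ∀ (s e : ℕ → ℤ) →
  (∀ {p} → Prime p → ∀ k m → n ≡ p ^ suc k ℕ.* m → ¬ p ℕ∣.∣ m →
    ∀ i → Quotient._≡ₘ_ ℤᴿ (pow ℤᴿ (natR ℤᴿ p) (suc k)) (s i) (e i)) →
  ∀ i → Quotient._≡ₘ_ ℤᴿ (+ n) (e i) (s i)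
combine-prime-powers n 0<n s e s≡e i = ∣⇒≡ₘ (e i) (s i) (prime-powers-∣ n 0<n ℤ.∣ e i ℤ.- s i ∣
  λ {p} pp k m n≡ p∤m → ≡ₘ⇒∣ (e i) (s i) (≡ₘ-modulus ℤᴿ
    (≡.trans (≡.cong (λ x → pow ℤᴿ x (suc k)) (natR-ℤ p)) (pow-pos p (suc k)))
    (s≡e pp k m n≡ p∤m i)))

pow-∣ : ∀ n k r → + (n ^ k) ∣ pow ℤᴿ (+ n) k ℤ.* r
pow-∣ n k r = ≡.subst (λ x → + (n ^ k) ∣ x ℤ.* r) (≡.sym (pow-pos n k))
  (Signed.∣⇒∣ᵤ {+ (n ^ k)} {+ (n ^ k) ℤ.* r} (Signed.divides r (ℤ.*-comm (+ (n ^ k)) r)))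

theorem4p1 : {c ℓ : Level} (R : CommutativeRing c ℓ) →
    let open CommutativeRing R in
    (∀ a b → ι R a ≈ ι R b → a ≡ b) →
    (d : ℕ) (p : Vec ℤ d) (α : Fin d → Carrier) →
    Pointwise _≈_ (linProd R α) (monicCoeffs R p) →
    (n : ℕ) → 1 < n →
    Σ ℤ λ u → (ι R u ≈ U R α n) ×
    (+ (n ^ (d ^ (2 ^ (numPrimeFactors n ∸ 1)))) ∣ u)
theorem4p1 R injective d p α factors n 1<n =
  conclude (rootsP-rational α rational (Dplus n)) (rootsP-rational α rational (Dminus n))
  where
  open CommutativeRing R
  open ProductRoots R
  open Rationality ℤᴿ R (ιʰ R) (λ {x} {y} → injective x y)
  open RationalRoots ℤᴿ R (ιʰ R) (λ {x} {y} → injective x y)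

  -- The factorisation of P is used only here: its integer coefficients make the series of the roots
  -- integral, and every `rootsP R α N` inherits this.
  rational : ∃ (Rational (roots α))
  rational = reversed R p , ι-reversed R p α factors

  L = rootsP R α (Dplus n)
  M = rootsP R α (Dminus n)

  |L|≡ : List.length L ≡ d ^ (2 ^ (numPrimeFactors n ∸ 1))
  |L|≡ = ≡.trans (length-rootsP α (Dplus n)) (≡.cong (d ^_) (|Dplus| n 1<n))

  |M|≡ : List.length M ≡ d ^ (2 ^ (numPrimeFactors n ∸ 1))
  |M|≡ = ≡.trans (length-rootsP α (Dminus n)) (≡.cong (d ^_) (|Dminus| n 1<n))

  conclude : ∃ (Rational L) → ∃ (Rational M) →
    Σ ℤ λ u → (ι R u ≈ U R α n) × (+ (n ^ (d ^ (2 ^ (numPrimeFactors n ∸ 1)))) ∣ u)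
  conclude (s , rs) (e , re) = finish (resultant-divisible L M s e (+ n) (≡.trans |L|≡ (≡.sym |M|≡)) rs re
    (combine-prime-powers n (ℕ.<⇒≤ 1<n) s e λ pp k m n≡ p∤m →
      Dplus≡Dminus pp (powerSeries-fermat pp) α rational n k m n≡ p∤m s e rs re))
    where
    finish : (Σ[ r ∈ ℤ ] ι R (pow ℤᴿ (+ n) (List.length L) ℤ.* r) ≈ U R α n) →
      Σ ℤ λ u → (ι R u ≈ U R α n) × (+ (n ^ (d ^ (2 ^ (numPrimeFactors n ∸ 1)))) ∣ u)
    finish (r , eq) = pow ℤᴿ (+ n) (List.length L) ℤ.* r , eq ,
      ≡.subst (λ j → + (n ^ j) ∣ pow ℤᴿ (+ n) (List.length L) ℤ.* r) |L|≡ (pow-∣ n (List.length L) r)
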